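{- Let $n\ge 1$, let $\xi\in\mathbb{C}^n$ be a unit vector, and let $\varphi_\xi$ be the vector state on $M_n$ given by $\varphi_\xi(B)=\langle \xi,B\xi\rangle=\xi^*B\xi$. Let $A\in M_n$ be a Hermitian matrix whose eigenvalues $\lambda_1,\ldots,\lambda_n$ are all distinct. Then there exists a unique discrete probability measure $\mu$ on $\mathbb{R}$ such that $$\varphi_\xi(A^k)=\int_{\mathbb{R}}x^k\,d\mu(x)\quad\text{for all }k\in\mathbb{N},$$ and this measure has the explicit form $\mu=\sum_{i=1}^n\omega_i\delta_{\lambda_i}$ (for some real numbers $\omega_i\ge 0$ with $\sum_{i=1}^n\omega_i=1$). Conversely, for every discrete probability measure of the form $\mu=\sum_{i=1}^n\omega_i\delta_{\lambda_i}$ with $\lambda_i\in\mathbb{R}$, there exists a Hermitian matrix $A\in M_n$ with eigenvalues $\lambda_1,\ldots,\lambda_n$ such that $\varphi_\xi(A^k)=\int_{\mathbb{R}}x^k\,d\mu(x)$ for all $k\in\mathbb{N}$.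
   Context: $M_n$ is the set of $n\times n$ complex matrices and $\mathbb{N}=\{0,1,2,\ldots\}$. The inner product $\langle\cdot,\cdot\rangle$ on $\mathbb{C}^n$ is the usual one, conjugate-linear in the first argument. $\delta_\lambda$ is the Dirac measure at $\lambda\in\mathbb{R}$. A discrete measure on $\mathbb{R}$ is a Borel measure concentrated on a countable set. -}

module Defs where

open import Level using (Level; 0ℓ; lift; lower) renaming (suc to lsuc)
open import Axiom.ExcludedMiddle using (ExcludedMiddle)
open import Algebra.Bundles using (CommutativeRing; Ring; RawRing)
import Algebra.Definitions.RawSemiring as RawSemiringDefinitions
import Algebra.Construct.NaturalChoice.Max as Max
open import Data.Bool.Base using (if_then_else_)
open import Data.Fin.Base using (Fin; toℕ; punchIn) renaming (zero to fzero; suc to fsuc)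
open import Data.Fin.Properties using (_≟_)
open import Data.Nat.Base as ℕ using (ℕ; zero; suc)
open import Data.Product.Base using (Σ-syntax; ∃; ∃-syntax; _×_)
open import Data.Vec.Functional using (Vector)
open import Relation.Binary.Bundles using (TotalOrder)
open import Relation.Binary.Core using (Rel)
open import Relation.Binary.Structures using (IsTotalOrder)
import Relation.Binary.Construct.NonStrictToStrict as NonStrictToStrict
open import Relation.Binary.PropositionalEquality.Core using (_≢_)
open import Relation.Nullary.Decidable using (Dec; does; map′)
open import Relation.Unary using (Pred; _∈_; _≐_; ∁; ∅; U; ⋃; Empty; _∩_)

-- The real numbers are any Dedekind-complete ordered field; these axioms
-- determine ℝ up to unique isomorphism.  Equality is a setoid equality
-- because the usual constructions of ℝ are quotients.

record CompleteOrderedField : Set₁ where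
  field
    commutativeRing : CommutativeRing 0ℓ 0ℓ

  open CommutativeRing commutativeRing public

  infix 4 _≤_

  field
    _≤_          : Rel Carrier 0ℓ
    isTotalOrder : IsTotalOrder _≈_ _≤_
    0≉1          : 0# ≉ 1#
    inverse      : ∀ {x} → x ≉ 0# → ∃[ y ] x * y ≈ 1#
    +-monoʳ-≤    : ∀ z {x y} → x ≤ y → z + x ≤ z + y
    *-nonneg     : ∀ {x y} → 0# ≤ x → 0# ≤ y → 0# ≤ x * y

  totalOrder : TotalOrder 0ℓ 0ℓ 0ℓ
  totalOrder = record { isTotalOrder = isTotalOrder }

  open NonStrictToStrict _≈_ _≤_ public using (_<_)
  open Max totalOrder public using (_⊔_)

  UpperBound : ∀ {ℓ} → Pred Carrier ℓ → Pred Carrier ℓ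
  UpperBound S b = ∀ {x} → x ∈ S → x ≤ b

  IsSupremum : ∀ {ℓ} → Pred Carrier ℓ → Pred Carrier ℓ
  IsSupremum S s = UpperBound S s × (∀ {b} → UpperBound S b → s ≤ b)

  field
    complete : (S : Pred Carrier 0ℓ) → ∃ S → ∃ (UpperBound S) → ∃ (IsSupremum S)

module Matrices (R : RawRing 0ℓ 0ℓ) where

  open RawRing R
  open RawSemiringDefinitions rawSemiring using (sum; product; _^_)

  Matrix : ℕ → Set
  Matrix n = Vector (Vector Carrier n) n

  scalar : ∀ {n} → Carrier → Matrix n
  scalar z i j = if does (i ≟ j) then z else 0#

  infixl 7 _⊗_
  _⊗_ : ∀ {n} → Matrix n → Matrix n → Matrix n
  (A ⊗ B) i k = sum λ j → A i j * B j k

  infixr 8 _^ᴹ_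
  _^ᴹ_ : ∀ {n} → Matrix n → ℕ → Matrix n
  A ^ᴹ zero  = scalar 1#
  A ^ᴹ suc k = A ⊗ A ^ᴹ k

  infixr 7 _·_
  _·_ : ∀ {n} → Matrix n → Vector Carrier n → Vector Carrier n
  (A · v) i = sum λ j → A i j * v j

  -- Laplace expansion along the first row.
  det : ∀ {n} → Matrix n → Carrier
  det {zero}  A = 1#
  det {suc n} A = sum λ j →
    (- 1#) ^ toℕ j * (A fzero j * det λ i k → A (fsuc i) (punchIn j k))

  -- The characteristic polynomial det (zI − A) as a function of z; over an
  -- infinite field it is determined by its values.
  charPoly : ∀ {n} → Matrix n → Carrier → Carrier
  charPoly A z = det λ i j → scalar z i j + - A i j

  -- The family z lists the eigenvalues of A with algebraic multiplicity.
  HasEigenvalues : ∀ {n} → Matrix n → Vector Carrier n → Set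
  HasEigenvalues A z = ∀ w → charPoly A w ≈ product λ i → w + - z i

-- Classical logic is assumed explicitly: a Dirac measure, for instance, has to
-- decide membership in an arbitrary Borel set.

module Analysis (em : ExcludedMiddle (lsuc 0ℓ)) (F : CompleteOrderedField) where

  open CompleteOrderedField F public renaming (Carrier to ℝ)
  open RawSemiringDefinitions
    (RawRing.rawSemiring (Ring.rawRing ring)) public
    using (sum; _^_)

  decide : (P : Set) → Dec P
  decide P = map′ lower lift (em {Level.Lift (lsuc 0ℓ) P})

  ------------------------------------------------------------------------
  -- Complex numbers, vectors and matrices

  infixl 6 _+i_
  record ℂ : Set where
    constructor _+i_
    field
      re im : ℝ
  open ℂ public

  fromℝ : ℝ → ℂ
  fromℝ x = x +i 0#

  conj : ℂ → ℂ
  conj (x +i y) = x +i - y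

  rawRingℂ : RawRing 0ℓ 0ℓ
  rawRingℂ = record
    { Carrier = ℂ
    ; _≈_     = λ z w → re z ≈ re w × im z ≈ im w
    ; _+_     = λ z w → (re z + re w) +i (im z + im w)
    ; _*_     = λ z w → (re z * re w - im z * im w) +i (re z * im w + im z * re w)
    ; -_      = λ z → (- re z) +i (- im z)
    ; 0#      = fromℝ 0#
    ; 1#      = fromℝ 1#
    }

  open RawRing rawRingℂ public using () renaming (_≈_ to _≈ℂ_; _*_ to _*ℂ_)
  open RawSemiringDefinitions
    (RawRing.rawSemiring rawRingℂ) public
    using () renaming (sum to sumℂ)
  open Matrices rawRingℂ public

  ⟨_,_⟩ : ∀ {n} → Vector ℂ n → Vector ℂ n → ℂ
  ⟨ v , w ⟩ = sumℂ λ i → conj (v i) *ℂ w i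

  IsUnit : ∀ {n} → Vector ℂ n → Set
  IsUnit ξ = ⟨ ξ , ξ ⟩ ≈ℂ fromℝ 1#

  vectorState : ∀ {n} → Vector ℂ n → Matrix n → ℂ
  vectorState ξ B = ⟨ ξ , B · ξ ⟩

  IsHermitian : ∀ {n} → Matrix n → Set
  IsHermitian A = ∀ i j → A i j ≈ℂ conj (A j i)

  HasRealEigenvalues : ∀ {n} → Matrix n → Vector ℝ n → Set
  HasRealEigenvalues A λs = HasEigenvalues A (λ i → fromℝ (λs i))

  PairwiseDistinct : ∀ {n} → Vector ℝ n → Set
  PairwiseDistinct λs = ∀ {i j} → i ≢ j → λs i ≉ λs j

  ------------------------------------------------------------------------
  -- Borel probability measures on ℝ

  IsOpen : Pred ℝ 0ℓ → Set
  IsOpen G = ∀ {x} → x ∈ G →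
    ∃[ ε ] 0# < ε × (∀ {y} → x - ε < y → y < x + ε → y ∈ G)

  -- The σ-algebra generated by the open sets.  Sets are predicates, so closure
  -- under extensional equality is a constructor.
  data Borel : Pred ℝ 0ℓ → Set₁ where
    isOpen     : ∀ {G} → IsOpen G → Borel G
    complement : ∀ {B} → Borel B → Borel (∁ B)
    union      : ∀ {B : ℕ → Pred ℝ 0ℓ} → (∀ k → Borel (B k)) → Borel (⋃ ℕ B)
    resp       : ∀ {B C} → B ≐ C → Borel B → Borel C

  Disjoint : {I : Set} → (I → Pred ℝ 0ℓ) → Set
  Disjoint B = ∀ {i j} → i ≢ j → Empty (B i ∩ B j)

  HasSum : (ℕ → ℝ) → ℝ → Set
  HasSum a s = ∀ {ε} → 0# < ε → ∃[ N ] (∀ {m} → N ℕ.≤ m →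
    let S = sum {m} (λ i → a (toℕ i)) in s - ε < S × S < s + ε)

  -- A measure is carried by a function on all sets, but its values outside the
  -- Borel sets are meaningless; accordingly _≈ₘ_ compares Borel sets only.
  record ProbabilityMeasure : Set₁ where
    field
      measure    : Pred ℝ 0ℓ → ℝ
      measure-≐  : ∀ {B C} → Borel B → B ≐ C → measure B ≈ measure C
      nonneg     : ∀ {B} → Borel B → 0# ≤ measure B
      empty      : measure ∅ ≈ 0#
      total      : measure U ≈ 1#
      σ-additive : (B : ℕ → Pred ℝ 0ℓ) → (∀ k → Borel (B k)) → Disjoint B →
                   HasSum (λ k → measure (B k)) (measure (⋃ ℕ B))
  open ProbabilityMeasure public using (measure)

  infix 4 _≈ₘ_
  _≈ₘ_ : Rel (Pred ℝ 0ℓ → ℝ) (lsuc 0ℓ)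
  m ≈ₘ m′ = ∀ {B} → Borel B → m B ≈ m′ B

  -- Enumerations may repeat and may leave C; as ℝ is inhabited, this includes
  -- the finite and the empty sets.
  Countable : Pred ℝ 0ℓ → Set
  Countable C = Σ[ c ∈ (ℕ → ℝ) ] (∀ {x} → x ∈ C → ∃[ k ] x ≈ c k)

  IsDiscrete : ProbabilityMeasure → Set₁
  IsDiscrete μ = ∃[ C ] Borel C × Countable C × measure μ (∁ C) ≈ 0#

  δ : ℝ → Pred ℝ 0ℓ → ℝ
  δ x B = if does (decide (x ∈ B)) then 1# else 0#

  diracSum : ∀ {n} → Vector ℝ n → Vector ℝ n → Pred ℝ 0ℓ → ℝ
  diracSum ω λs B = sum λ i → ω i * δ (λs i) B

  IsWeights : ∀ {n} → Vector ℝ n → Set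
  IsWeights ω = (∀ i → 0# ≤ ω i) × sum ω ≈ 1#

  ------------------------------------------------------------------------
  -- The Lebesgue integral

  -- A nonnegative simple function below f ≥ 0: it equals height i on piece i
  -- and 0 off the pieces.
  record SimpleBelow (f : ℝ → ℝ) : Set₁ where
    field
      {size}   : ℕ
      height   : Vector ℝ size
      piece    : Vector (Pred ℝ 0ℓ) size
      borel    : ∀ i → Borel (piece i)
      disjoint : Disjoint piece
      nonneg   : ∀ i → 0# ≤ height i
      below    : ∀ i {x} → x ∈ piece i → height i ≤ f x

  simpleIntegral : ProbabilityMeasure → ∀ {f} → SimpleBelow f → ℝ
  simpleIntegral μ φ = sum λ i → height i * measure μ (piece i)
    where open SimpleBelow φ

  HasNonnegIntegral : ProbabilityMeasure → (ℝ → ℝ) → ℝ → Set₁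
  HasNonnegIntegral μ f =
    IsSupremum λ s → Σ[ φ ∈ SimpleBelow f ] s ≈ simpleIntegral μ φ

  Measurable : (ℝ → ℝ) → Set₁
  Measurable f = ∀ {B} → Borel B → Borel (λ x → f x ∈ B)

  -- f is μ-integrable with integral I = ∫ f⁺ dμ − ∫ f⁻ dμ.
  HasIntegral : ProbabilityMeasure → (ℝ → ℝ) → ℝ → Set₁
  HasIntegral μ f I = Measurable f ×
    (∃[ p ] ∃[ q ] HasNonnegIntegral μ (λ x → f x ⊔ 0#) p
                 × HasNonnegIntegral μ (λ x → - f x ⊔ 0#) q
                 × I ≈ p - q)

  -- φ_ξ(Aᵏ) = ∫ xᵏ dμ(x) for all k, integrability of xᵏ included.
  MomentsAgree : ∀ {n} → Vector ℂ n → Matrix n → ProbabilityMeasure → Set₁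
  MomentsAgree ξ A μ = ∀ k →
    ∃[ I ] HasIntegral μ (λ x → x ^ k) I × vectorState ξ (A ^ᴹ k) ≈ℂ fromℝ I

{-# OPTIONS --safe #-}

-- A Hermitian matrix with distinct real eigenvalues splits ξ into pairwise orthogonal eigenvectors wᵢ, so
-- ⟨ξ,Aᵏξ⟩ = ∑ λᵢᵏ⟨wᵢ,wᵢ⟩ and ωᵢ = ⟨wᵢ,wᵢ⟩.  For uniqueness, a discrete measure ν is a countable sum of atoms, and its
-- moments determine the integrals of all polynomials.  Integrating ∏(x - λᵢ)² shows that ν lives on {λᵢ}; there the
-- indicator of a Borel set is a polynomial, by interpolation.  Conversely, the vector with entries √ωᵢ is carried to ξ
-- by a unitary matrix V, and A = V diag(λ) V* has the required moments.
module Submission where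

open import Defs
open import Level using (0ℓ) renaming (suc to lsuc)
import Algebra.Construct.NaturalChoice.Max
import Algebra.Definitions.RawSemiring
import Algebra.Properties.Ring
import Algebra.Properties.Semiring.Mult.TCOptimised
import Algebra.Properties.Semiring.Sum
import Algebra.Solver.Ring
open import Algebra.Bundles using (CommutativeRing; RawRing; Ring)
open import Algebra.Solver.Ring.AlmostCommutativeRing using (fromCommutativeRing; _-Raw-AlmostCommutative⟶_)
open import Algebra.Structures using (IsCommutativeRing)
open import Axiom.ExcludedMiddle using (ExcludedMiddle)
open import Data.Bool.Base using (if_then_else_)
open import Data.Fin.Base using (Fin; toℕ; fromℕ<; inject₁; punchIn; punchOut; zero; suc)
open import Data.Fin.Induction using (<-weakInduction)
open import Data.Fin.Properties
  using (_≟_; any?; suc-injective; toℕ-injective; toℕ-inject₁; toℕ-fromℕ<; toℕ<n;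
         punchInᵢ≢i; punchIn-injective; punchIn-punchOut)
open import Data.Integer.Base as ℤ using (ℤ; +_; -[1+_]; 0ℤ; 1ℤ)
import Data.Integer.Properties as ℤₚ
open import Data.Maybe.Base as Maybe using (Maybe)
open import Data.Nat.Base as ℕ using (ℕ; zero; suc; z≤n; s≤s)
import Data.Nat.Properties as ℕₚ
open import Data.Product.Base using (∃-syntax; Σ-syntax; _×_; _,_; proj₁; proj₂)
import Data.Sign.Base as Sign
open import Data.Sum.Base using (_⊎_; inj₁; inj₂)
open import Data.Vec.Functional using (Vector; _∷_; insertAt; removeAt; updateAt; tail)
open import Data.Vec.Functional.Properties
  using (insertAt-lookup; insertAt-punchIn; updateAt-updates; updateAt-minimal)
open import Function.Base using (_∘_; const)
open import Relation.Binary.Consequences using (dec⇒weaklyDec)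
open import Relation.Binary.Definitions using (tri<; tri≈; tri>)
open import Relation.Binary.PropositionalEquality.Core as ≡ using (_≡_; _≢_)
import Relation.Binary.Reasoning.Setoid
open import Relation.Binary.Structures using (IsTotalOrder)
open import Relation.Nullary using (Dec; yes; no; ¬_; ¬?; does; contradiction; decidable-stable)
open import Relation.Unary using (Pred; _∈_; _∉_; _⊆_; ∁; ∅; U; ⋃; _∩_)

-- The hypothesis on the eigenvalues is only an identity between determinants defined by Laplace
-- expansion. To make an eigenvector out of a zero of the characteristic polynomial, a vanishing
-- determinant has to yield a kernel vector, and this rests on the multiplicativity of `det`. That
-- in turn comes from a uniqueness principle: every alternating function of the rows is a multiple
-- of `det`, and M ↦ det Mᵀ and M ↦ det (MN) are alternating. On the side of measures, integrals are
-- suprema over simple functions, and ν may have infinitely many atoms, possibly listed with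
-- repetitions. Against a sum of atoms, the integral of a nonnegative function is the sum of a
-- series, by completeness. After this translation a moment identity can be combined linearly with
-- others, term by term, which is all that polynomials require. Equality of reals is a setoid
-- equality while sets are arbitrary predicates; it has to be proved that Borel sets respect it
-- before the atoms of ν can be compared with the eigenvalues.

module RingSolver {c ℓ} (R : CommutativeRing c ℓ) where

  open CommutativeRing R
  open Algebra.Properties.Ring ring
  open Algebra.Properties.Semiring.Mult.TCOptimised semiring using (1+×; ×-homo-+; ×1-homo-*) renaming (_×_ to _×′_)
  open Relation.Binary.Reasoning.Setoid setoid

  private

    -- Integer coefficients let the solver compare constants by deciding equality in ℤ, a test that
    -- the ring itself may not offer. As `1 ×′ x` reduces to `x`, the constants `con 0ℤ` and
    -- `con 1ℤ` denote `0#` and `1#` on the nose.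
    fromℤ : ℤ → Carrier
    fromℤ (+ n)    = n ×′ 1#
    fromℤ -[1+ n ] = - (suc n ×′ 1#)

    fromℤ-⊖ : ∀ m n → fromℤ (m ℤ.⊖ n) ≈ m ×′ 1# - n ×′ 1#
    fromℤ-⊖ zero    zero    = sym (-‿inverseʳ 0#)
    fromℤ-⊖ zero    (suc n) = sym (+-identityˡ _)
    fromℤ-⊖ (suc m) zero    = sym (trans (+-congˡ -0#≈0#) (+-identityʳ _))
    fromℤ-⊖ (suc m) (suc n) = begin
      fromℤ (suc m ℤ.⊖ suc n)              ≡⟨ ≡.cong fromℤ (ℤₚ.[1+m]⊖[1+n]≡m⊖n m n) ⟩
      fromℤ (m ℤ.⊖ n)                      ≈⟨ fromℤ-⊖ m n ⟩
      m ×′ 1# - n ×′ 1#                    ≈⟨ +-congʳ (xyx⁻¹≈y 1# (m ×′ 1#)) ⟨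
      1# + m ×′ 1# - 1# - n ×′ 1#          ≈⟨ +-assoc _ _ _ ⟩
      1# + m ×′ 1# + (- 1# - n ×′ 1#)      ≈⟨ +-congˡ (-‿+-comm _ _) ⟩
      (1# + m ×′ 1#) - (1# + n ×′ 1#)      ≈⟨ +-cong (1+× m 1#) (-‿cong (1+× n 1#)) ⟨
      suc m ×′ 1# - suc n ×′ 1#            ∎

    fromℤ-+ : ∀ i j → fromℤ (i ℤ.+ j) ≈ fromℤ i + fromℤ j
    fromℤ-+ (+ m)    (+ n)    = ×-homo-+ 1# m n
    fromℤ-+ (+ m)    -[1+ n ] = fromℤ-⊖ m (suc n)
    fromℤ-+ -[1+ m ] (+ n)    = trans (fromℤ-⊖ n (suc m)) (+-comm _ _)
    fromℤ-+ -[1+ m ] -[1+ n ] = begin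
      - (suc (suc (m ℕ.+ n)) ×′ 1#)        ≡⟨ ≡.cong (λ k → - (k ×′ 1#)) (ℕₚ.+-suc (suc m) n) ⟨
      - ((suc m ℕ.+ suc n) ×′ 1#)          ≈⟨ -‿cong (×-homo-+ 1# (suc m) (suc n)) ⟩
      - (suc m ×′ 1# + suc n ×′ 1#)        ≈⟨ -‿+-comm _ _ ⟨
      - (suc m ×′ 1#) - suc n ×′ 1#        ∎

    fromℤ-+◃ : ∀ n → fromℤ (Sign.+ ℤ.◃ n) ≈ n ×′ 1#
    fromℤ-+◃ zero    = refl
    fromℤ-+◃ (suc n) = refl

    fromℤ--◃ : ∀ n → fromℤ (Sign.- ℤ.◃ n) ≈ - (n ×′ 1#)
    fromℤ--◃ zero    = sym -0#≈0#
    fromℤ--◃ (suc n) = refl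

    fromℤ-* : ∀ i j → fromℤ (i ℤ.* j) ≈ fromℤ i * fromℤ j
    fromℤ-* (+ m) (+ n) = trans (fromℤ-+◃ (m ℕ.* n)) (×1-homo-* m n)
    fromℤ-* (+ m) -[1+ n ] = begin
      fromℤ (Sign.- ℤ.◃ m ℕ.* suc n)   ≈⟨ fromℤ--◃ (m ℕ.* suc n) ⟩
      - ((m ℕ.* suc n) ×′ 1#)          ≈⟨ -‿cong (×1-homo-* m (suc n)) ⟩
      - (m ×′ 1# * suc n ×′ 1#)        ≈⟨ -‿distribʳ-* _ _ ⟩
      m ×′ 1# * - (suc n ×′ 1#)        ∎
    fromℤ-* -[1+ m ] (+ n) = begin
      fromℤ (Sign.- ℤ.◃ suc m ℕ.* n)   ≈⟨ fromℤ--◃ (suc m ℕ.* n) ⟩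
      - ((suc m ℕ.* n) ×′ 1#)          ≈⟨ -‿cong (×1-homo-* (suc m) n) ⟩
      - (suc m ×′ 1# * n ×′ 1#)        ≈⟨ -‿distribˡ-* _ _ ⟩
      - (suc m ×′ 1#) * n ×′ 1#        ∎
    fromℤ-* -[1+ m ] -[1+ n ] = begin
      (suc m ℕ.* suc n) ×′ 1#          ≈⟨ ×1-homo-* (suc m) (suc n) ⟩
      suc m ×′ 1# * suc n ×′ 1#        ≈⟨ -‿involutive _ ⟨
      - - (suc m ×′ 1# * suc n ×′ 1#)  ≈⟨ -‿cong (-‿distribʳ-* _ _) ⟩
      - (suc m ×′ 1# * - (suc n ×′ 1#)) ≈⟨ -‿distribˡ-* _ _ ⟩
      - (suc m ×′ 1#) * - (suc n ×′ 1#) ∎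

    fromℤ-neg : ∀ i → fromℤ (ℤ.- i) ≈ - fromℤ i
    fromℤ-neg (+ zero)  = sym -0#≈0#
    fromℤ-neg (+ suc n) = refl
    fromℤ-neg -[1+ n ]  = sym (-‿involutive _)

    ℤ-ring : RawRing 0ℓ 0ℓ
    ℤ-ring = record
      { Carrier = ℤ ; _≈_ = ≡._≡_ ; _+_ = ℤ._+_ ; _*_ = ℤ._*_ ; -_ = ℤ.-_
      ; 0# = ℤ.0ℤ ; 1# = ℤ.1ℤ }

    homomorphism : ℤ-ring -Raw-AlmostCommutative⟶ fromCommutativeRing R
    homomorphism = record
      { ⟦_⟧ = fromℤ ; +-homo = fromℤ-+ ; *-homo = fromℤ-* ; -‿homo = fromℤ-neg
      ; 0-homo = refl ; 1-homo = refl }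

    coefficient≟ : ∀ i j → Maybe (fromℤ i ≈ fromℤ j)
    coefficient≟ i j =
      Maybe.map (λ i≡j → reflexive (≡.cong fromℤ i≡j)) (dec⇒weaklyDec ℤₚ._≟_ i j)

  open Algebra.Solver.Ring ℤ-ring (fromCommutativeRing R) homomorphism coefficient≟ public
    using (solve; _:=_; _:+_; _:*_; _:-_; :-_; con)

-- Neighbouring indices and their behaviour under deletion

data Adjacent : ∀ {n} → Fin n → Fin n → Set where
  here  : ∀ {n} → Adjacent {suc (suc n)} zero (suc zero)
  there : ∀ {n} {p q : Fin n} → Adjacent p q → Adjacent (suc p) (suc q)

adjacent-inject₁ : ∀ {n} (i : Fin n) → Adjacent (inject₁ i) (suc i)
adjacent-inject₁ zero    = here
adjacent-inject₁ (suc i) = there (adjacent-inject₁ i)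

adjacent⇒≢ : ∀ {n} {p q : Fin n} → Adjacent p q → p ≢ q
adjacent⇒≢ (there pq) ≡.refl = adjacent⇒≢ pq ≡.refl

toℕ-adjacent : ∀ {n} {p q : Fin n} → Adjacent p q → toℕ q ≡ suc (toℕ p)
toℕ-adjacent here       = ≡.refl
toℕ-adjacent (there pq) = ≡.cong suc (toℕ-adjacent pq)

-- Nothing lies between neighbours, so deleting a third index keeps them neighbours. This carries a
-- pair of equal adjacent rows into the minors.
punchOut-adjacent : ∀ {n} {j p q : Fin (suc n)} (j≢p : j ≢ p) (j≢q : j ≢ q) →
                    Adjacent p q → Adjacent (punchOut j≢p) (punchOut j≢q)
punchOut-adjacent {j = zero}              j≢p j≢q here       = contradiction ≡.refl j≢p
punchOut-adjacent {j = suc zero}          j≢p j≢q here       = contradiction ≡.refl j≢q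
punchOut-adjacent {suc (suc _)} {suc (suc j)} j≢p j≢q here       = here
punchOut-adjacent {j = zero}              j≢p j≢q (there pq) = pq
punchOut-adjacent {suc _} {suc j}         j≢p j≢q (there pq) =
  there (punchOut-adjacent (j≢p ∘ ≡.cong suc) (j≢q ∘ ≡.cong suc) pq)

-- The rows left after deleting `p` and those left after deleting `q` come in the same order, except
-- that `q` stands in one list where `p` stands in the other. If these two rows coincide, the minors
-- are equal without any permutation; this is the advantage of neighbours.
punchIn-adjacent : ∀ {n} {p q : Fin (suc n)} → Adjacent p q → ∀ k →
                   punchIn p k ≡ punchIn q k ⊎ (punchIn p k ≡ q × punchIn q k ≡ p)
punchIn-adjacent here       zero    = inj₂ (≡.refl , ≡.refl)
punchIn-adjacent here       (suc k) = inj₁ ≡.refl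
punchIn-adjacent (there pq) zero    = inj₁ ≡.refl
punchIn-adjacent (there pq) (suc k) with punchIn-adjacent pq k
... | inj₁ eq        = inj₁ (≡.cong suc eq)
... | inj₂ (eq , eq′) = inj₂ (≡.cong suc eq , ≡.cong suc eq′)

-- With the next two lemmas: the enumerations that omit `inject₁ i` and `suc i` differ only at
-- position `i`. Consecutive matrices `cyclic` therefore differ by one exchange of two rows.
punchIn-inject₁ : ∀ {n} (i k : Fin n) → k ≢ i → punchIn (inject₁ i) k ≡ punchIn (suc i) k
punchIn-inject₁ zero    zero    k≢i = contradiction ≡.refl k≢i
punchIn-inject₁ zero    (suc k) k≢i = ≡.refl
punchIn-inject₁ (suc i) zero    k≢i = ≡.refl
punchIn-inject₁ (suc i) (suc k) k≢i = ≡.cong suc (punchIn-inject₁ i k (k≢i ∘ ≡.cong suc))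

punchIn-inject₁-same : ∀ {n} (i : Fin n) → punchIn (inject₁ i) i ≡ suc i
punchIn-inject₁-same zero    = ≡.refl
punchIn-inject₁-same (suc i) = ≡.cong suc (punchIn-inject₁-same i)

punchIn-suc-same : ∀ {n} (i : Fin n) → punchIn (suc i) i ≡ inject₁ i
punchIn-suc-same zero    = ≡.refl
punchIn-suc-same (suc i) = ≡.cong suc (punchIn-suc-same i)

-- Determinants, characterised by their alternating property

module Determinant (K : CommutativeRing 0ℓ 0ℓ) where

  open CommutativeRing K hiding (zero)
  open Matrices (Ring.rawRing ring)
  open Algebra.Definitions.RawSemiring (RawRing.rawSemiring (Ring.rawRing ring)) using (product; _^_)
  open Algebra.Properties.Ring ring using (+-identityʳ-unique)
  open Algebra.Properties.Semiring.Sum semiring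
  open RingSolver K
  open Relation.Binary.Reasoning.Setoid setoid

  infix 4 _≋_
  _≋_ : ∀ {n} → Vector Carrier n → Vector Carrier n → Set
  u ≋ v = ∀ j → u j ≈ v j

  infix 9 _ᵀ
  _ᵀ : ∀ {n} → Matrix n → Matrix n
  (M ᵀ) i j = M j i

  sum-zero : ∀ {n} {f : Vector Carrier n} → (∀ i → f i ≈ 0#) → sum f ≈ 0#
  sum-zero {n} f≈0 = trans (sum-cong-≋ f≈0) (sum-replicate-zero n)

  sum-linear : ∀ {n} a (f g : Vector Carrier n) →
               sum (λ i → a * f i + g i) ≈ a * sum f + sum g
  sum-linear a f g = trans (∑-distrib-+ _ g) (+-congʳ (sym (*-distribˡ-sum a f)))

  sum-adjacent : ∀ {n} {p q : Fin n} → Adjacent p q → (f : Vector Carrier n) →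
                 (∀ j → j ≢ p → j ≢ q → f j ≈ 0#) → f p + f q ≈ 0# → sum f ≈ 0#
  sum-adjacent here f f≈0 fp+fq≈0 = begin
    f zero + (f (suc zero) + sum (λ i → f (suc (suc i))))
      ≈⟨ +-congˡ (trans (+-congˡ (sum-zero λ i → f≈0 (suc (suc i)) (λ ()) λ ())) (+-identityʳ _)) ⟩
    f zero + f (suc zero)
      ≈⟨ fp+fq≈0 ⟩
    0# ∎
  sum-adjacent (there pq) f f≈0 fp+fq≈0 =
    trans (+-cong (f≈0 zero (λ ()) λ ())
                  (sum-adjacent pq (f ∘ suc) (λ j j≢p j≢q → f≈0 (suc j) (j≢p ∘ suc-injective) (j≢q ∘ suc-injective)) fp+fq≈0))
          (+-identityˡ 0#)

  -- Linearity in row i relates matrices that agree off row i, so that no updated matrices have to be formed.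
  record IsAlternating {n} (D : Matrix n → Carrier) : Set where
    field
      cong     : ∀ {M N} → (∀ i → M i ≋ N i) → D M ≈ D N
      linear   : ∀ i a {M N P} → (∀ k → k ≢ i → M k ≋ P k) → (∀ k → k ≢ i → N k ≋ P k) →
                 (∀ j → P i j ≈ a * M i j + N i j) → D P ≈ a * D M + D N
      adjacent : ∀ {p q} → Adjacent p q → ∀ {M} → M p ≋ M q → D M ≈ 0#

  det-cong : ∀ {n} {M N : Matrix n} → (∀ i → M i ≋ N i) → det M ≈ det N
  det-cong {zero}  M≈N = refl
  det-cong {suc n} M≈N = sum-cong-≋ {suc n} λ j →
    *-congˡ {(- 1#) ^ toℕ j} (*-cong (M≈N zero j) (det-cong λ i k → M≈N (suc i) (punchIn j k)))

  private

    minorᵀ : ∀ {n} → Matrix (suc n) → Fin (suc n) → Matrix n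
    minorᵀ M j k i = M (punchIn j k) (suc i)

    -- The terms of the expansion of `M` along its first column, to which `det (M ᵀ)` unfolds. An
    -- expansion along the first row singles that row out; here all rows enter alike, so that
    -- linearity and alternation in the rows can be checked term by term.
    termᵀ : ∀ {n} → Matrix (suc n) → Fin (suc n) → Carrier
    termᵀ M j = (- 1#) ^ toℕ j * (M j zero * det (minorᵀ M j ᵀ))

  -- The term of row `i` is linear through its entry in the first column, since its minor omits row
  -- `i`. Every other term has row `i` in its minor and is linear by induction.
  detᵀ-linear : ∀ {n} (i : Fin n) a {M N P : Matrix n} →
                (∀ k → k ≢ i → M k ≋ P k) → (∀ k → k ≢ i → N k ≋ P k) →
                (∀ j → P i j ≈ a * M i j + N i j) → det (P ᵀ) ≈ a * det (M ᵀ) + det (N ᵀ)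
  detᵀ-linear {suc n} c a {M} {N} {P} M≋P N≋P Pc = begin
    sum (termᵀ P)                              ≈⟨ sum-cong-≋ term ⟩
    sum (λ j → a * termᵀ M j + termᵀ N j)      ≈⟨ sum-linear a (termᵀ M) (termᵀ N) ⟩
    a * sum (termᵀ M) + sum (termᵀ N)          ∎
    where
    term : ∀ j → termᵀ P j ≈ a * termᵀ M j + termᵀ N j
    term j with j ≟ c
    ... | yes ≡.refl = begin
      s * (P c zero * d)
        ≈⟨ *-congˡ (*-congʳ (Pc zero)) ⟩
      s * ((a * M c zero + N c zero) * d)
        ≈⟨ solve 5 (λ s a m n d → s :* ((a :* m :+ n) :* d) := a :* (s :* (m :* d)) :+ s :* (n :* d)) refl s a (M c zero) (N c zero) d ⟩
      a * (s * (M c zero * d)) + s * (N c zero * d)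
        ≈⟨ +-cong (*-congˡ (*-congˡ (*-congˡ (minor M≋P)))) (*-congˡ (*-congˡ (minor N≋P))) ⟨
      a * termᵀ M c + termᵀ N c ∎
      where
      s = (- 1#) ^ toℕ c
      d = det (minorᵀ P c ᵀ)
      minor : ∀ {Q : Matrix (suc n)} → (∀ k → k ≢ c → Q k ≋ P k) → det (minorᵀ Q c ᵀ) ≈ d
      minor Q≋P = det-cong λ i k → Q≋P (punchIn c k) (punchInᵢ≢i c k) (suc i)
    ... | no j≢c = begin
      s * (P j zero * det (minorᵀ P j ᵀ))
        ≈⟨ *-congˡ (*-congˡ (detᵀ-linear c′ a (minor M≋P) (minor N≋P) Pc′)) ⟩
      s * (P j zero * (a * det (minorᵀ M j ᵀ) + det (minorᵀ N j ᵀ)))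
        ≈⟨ solve 5 (λ s a m n d → s :* (d :* (a :* m :+ n)) := a :* (s :* (d :* m)) :+ s :* (d :* n)) refl s a (det (minorᵀ M j ᵀ)) (det (minorᵀ N j ᵀ)) (P j zero) ⟩
      a * (s * (P j zero * det (minorᵀ M j ᵀ))) + s * (P j zero * det (minorᵀ N j ᵀ))
        ≈⟨ +-cong (*-congˡ (*-congˡ (*-congʳ (M≋P j j≢c zero)))) (*-congˡ (*-congʳ (N≋P j j≢c zero))) ⟨
      a * termᵀ M j + termᵀ N j ∎
      where
      s = (- 1#) ^ toℕ j
      c′ = punchOut j≢c
      minor : ∀ {Q : Matrix (suc n)} → (∀ k → k ≢ c → Q k ≋ P k) →
              ∀ k → k ≢ c′ → minorᵀ Q j k ≋ minorᵀ P j k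
      minor Q≋P k k≢c′ i = Q≋P (punchIn j k)
        (λ eq → k≢c′ (punchIn-injective j k c′ (≡.trans eq (≡.sym (punchIn-punchOut j≢c))))) (suc i)
      Pc′ : ∀ i → minorᵀ P j c′ i ≈ a * minorᵀ M j c′ i + minorᵀ N j c′ i
      Pc′ i rewrite punchIn-punchOut j≢c = Pc (suc i)

  -- A term that deletes neither of the two rows has both in its minor and vanishes by induction.
  -- The two remaining terms have equal entries and equal minors, and opposite signs because the
  -- positions differ by one.
  detᵀ-adjacent : ∀ {n} {p q : Fin n} → Adjacent p q → ∀ {M : Matrix n} →
                  M p ≋ M q → det (M ᵀ) ≈ 0#
  detᵀ-adjacent {suc n} {p} {q} pq {M} Mp≋Mq = sum-adjacent pq (termᵀ M) others cancel
    where
    others : ∀ j → j ≢ p → j ≢ q → termᵀ M j ≈ 0#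
    others j j≢p j≢q = trans (*-congˡ (trans (*-congˡ (detᵀ-adjacent (punchOut-adjacent j≢p j≢q pq) rows)) (zeroʳ _))) (zeroʳ _)
      where
      rows : minorᵀ M j (punchOut j≢p) ≋ minorᵀ M j (punchOut j≢q)
      rows i rewrite punchIn-punchOut j≢p | punchIn-punchOut j≢q = Mp≋Mq (suc i)

    minors : ∀ k → minorᵀ M p k ≋ minorᵀ M q k
    minors k i with punchIn-adjacent pq k
    ... | inj₁ eq         = reflexive (≡.cong (λ r → M r (suc i)) eq)
    ... | inj₂ (eq , eq′) = begin
      M (punchIn p k) (suc i)  ≡⟨ ≡.cong (λ r → M r (suc i)) eq ⟩
      M q (suc i)              ≈⟨ Mp≋Mq (suc i) ⟨
      M p (suc i)              ≡⟨ ≡.cong (λ r → M r (suc i)) eq′ ⟨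
      M (punchIn q k) (suc i)  ∎

    cancel : termᵀ M p + termᵀ M q ≈ 0#
    cancel = begin
      s * (M p zero * det (minorᵀ M p ᵀ)) + (- 1#) ^ toℕ q * (M q zero * d)
        ≈⟨ +-cong (*-congˡ (*-cong (Mp≋Mq zero) (det-cong λ i k → minors k i)))
                  (*-congʳ (reflexive (≡.cong ((- 1#) ^_) (toℕ-adjacent pq)))) ⟩
      s * (M q zero * d) + - 1# * s * (M q zero * d)
        ≈⟨ solve 3 (λ s m d → s :* (m :* d) :+ (:- con 1ℤ) :* s :* (m :* d) := con 0ℤ) refl s (M q zero) d ⟩
      0# ∎
      where
      s = (- 1#) ^ toℕ p
      d = det (minorᵀ M q ᵀ)

  detᵀ-alternating : ∀ {n} → IsAlternating {n} (λ M → det (M ᵀ))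
  detᵀ-alternating = record
    { cong     = λ M≋N → det-cong λ i j → M≋N j i
    ; linear   = λ i a M≋P N≋P Pi → detᵀ-linear i a M≋P N≋P Pi
    ; adjacent = λ pq Mp≋Mq → detᵀ-adjacent pq Mp≋Mq
    }

  linear-functional : ∀ {n} (g : Vector Carrier n → Carrier) →
    (∀ {u v} → u ≋ v → g u ≈ g v) →
    (∀ a u v → g (λ j → a * u j + v j) ≈ a * g u + g v) →
    ∀ v → g v ≈ sum λ j → v j * g (scalar 1# j)
  -- A vector of length 0 coincides with 1·v + v, so g v + g v = g v and g v is zero.
  linear-functional {zero} g g-cong g-linear v = +-identityʳ-unique (g v) (g v) (begin
    g v + g v           ≈⟨ +-congʳ (*-identityˡ (g v)) ⟨
    1# * g v + g v      ≈⟨ g-linear 1# v v ⟨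
    g (λ j → 1# * v j + v j)  ≈⟨ g-cong (λ ()) ⟩
    g v                 ∎)
  linear-functional {suc n} g g-cong g-linear v = begin
    g v
      ≈⟨ g-cong split ⟩
    g (λ j → v zero * scalar 1# zero j + (0# ∷ tail v) j)
      ≈⟨ g-linear _ _ _ ⟩
    v zero * g (scalar 1# zero) + g (0# ∷ tail v)
      ≈⟨ +-congˡ (linear-functional (λ w → g (0# ∷ w))
           (λ u≋v → g-cong λ { zero → refl ; (suc j) → u≋v j })
           (λ a u w → trans (g-cong λ { zero → sym (trans (+-identityʳ _) (zeroʳ a)) ; (suc j) → refl }) (g-linear a (0# ∷ u) (0# ∷ w)))
           (tail v)) ⟩
    v zero * g (scalar 1# zero) + sum (λ j → v (suc j) * g (0# ∷ scalar 1# j))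
      ≈⟨ +-congˡ (sum-cong-≋ {n} λ j → *-congˡ (g-cong λ { zero → refl ; (suc k) → refl })) ⟩
    v zero * g (scalar 1# zero) + sum (λ j → v (suc j) * g (scalar 1# (suc j))) ∎
    where
    split : v ≋ (λ j → v zero * scalar 1# zero j + (0# ∷ tail v) j)
    split zero    = sym (trans (+-identityʳ _) (*-identityʳ _))
    split (suc j) = sym (trans (+-congʳ (zeroʳ _)) (+-identityˡ _))

  -- Rows are replaced one at a time, so invariance is only asked for matrices that differ in a
  -- single row. In the induction the replaced first row is absorbed into `H`.
  replace-rows : ∀ {m n} (H : Vector (Vector Carrier n) m → Carrier)
    (_∼_ : Vector Carrier n → Vector Carrier n → Set) →
    (∀ i {r r′} → (∀ k → k ≢ i → r k ≋ r′ k) → r i ∼ r′ i → H r ≈ H r′) →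
    (∀ {r r′} → (∀ k → r k ≋ r′ k) → H r ≈ H r′) →
    ∀ {r r′} → (∀ i → r i ∼ r′ i) → H r ≈ H r′
  replace-rows {zero}  H _∼_ invariant H-cong r∼r′ = H-cong λ ()
  replace-rows {suc m} H _∼_ invariant H-cong {r} {r′} r∼r′ = begin
    H r
      ≈⟨ invariant zero (λ { zero k≢ → contradiction ≡.refl k≢ ; (suc k) _ _ → refl }) (r∼r′ zero) ⟩
    H (r′ zero ∷ tail r)
      ≈⟨ replace-rows (λ q → H (r′ zero ∷ q)) _∼_
           (λ i eq q∼q′ → invariant (suc i) (λ { zero _ _ → refl ; (suc k) k≢ → eq k (k≢ ∘ ≡.cong suc) }) q∼q′)
           (λ eq → H-cong λ { zero _ → refl ; (suc k) → eq k })
           (λ i → r∼r′ (suc i)) ⟩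
    H (r′ zero ∷ tail r′)
      ≈⟨ H-cong (λ { zero _ → refl ; (suc k) _ → refl }) ⟩
    H r′ ∎

  module _ {n} {D : Matrix n → Carrier} (D-alternating : IsAlternating D) where

    open IsAlternating D-alternating

    private

      additive : ∀ i {M N P} → (∀ k → k ≢ i → M k ≋ P k) → (∀ k → k ≢ i → N k ≋ P k) →
                 (∀ j → P i j ≈ M i j + N i j) → D P ≈ D M + D N
      additive i M≋P N≋P Pi =
        trans (linear i 1# M≋P N≋P λ j → trans (Pi j) (+-congʳ (sym (*-identityˡ _)))) (+-congʳ (*-identityˡ _))

    -- Polarisation: with the other rows fixed, `D` is a biadditive form B in rows `p` and `q` with
    -- B(u,u) = 0, and expanding B(x+y,x+y) = 0 leaves B(x,y) + B(y,x) = 0. The vanishing is a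
    -- hypothesis of its own because the lemma is also applied to rows that are not neighbours.
    swap-rows : ∀ {p q} → p ≢ q → (∀ M → M p ≋ M q → D M ≈ 0#) →
                ∀ {M N} → N p ≋ M q → N q ≋ M p → (∀ k → k ≢ p → k ≢ q → N k ≋ M k) → D N ≈ - D M
    swap-rows {p} {q} p≢q vanish {M} {N} Np Nq N≋M = +-inverseʳ-unique (D M) (D N) (begin
      D M + D N                    ≈⟨ +-cong (cong M≋B) (cong N≋B) ⟩
      B x y + B y x                ≈⟨ +-cong (+-identityˡ _) (+-identityʳ _) ⟨
      (0# + B x y) + (B y x + 0#)  ≈⟨ +-cong (+-congʳ (diagonal x)) (+-congˡ (diagonal y)) ⟨
      (B x x + B x y) + (B y x + B y y)  ≈⟨ +-cong (right x x y) (right y x y) ⟨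
      B x (x ⊞ y) + B y (x ⊞ y)    ≈⟨ left x y (x ⊞ y) ⟨
      B (x ⊞ y) (x ⊞ y)            ≈⟨ diagonal (x ⊞ y) ⟩
      0#                           ∎)
      where
      open Algebra.Properties.Ring ring using (+-inverseʳ-unique)
      x = M p
      y = M q
      _⊞_ : Vector Carrier n → Vector Carrier n → Vector Carrier n
      (u ⊞ v) j = u j + v j
      mat : Vector Carrier n → Vector Carrier n → Matrix n
      mat u v = updateAt (updateAt M q (const v)) p (const u)
      B : Vector Carrier n → Vector Carrier n → Carrier
      B u v = D (mat u v)
      at-p : ∀ u v → mat u v p ≡ u
      at-p u v = updateAt-updates p _
      at-q : ∀ u v → mat u v q ≡ v
      at-q u v = ≡.trans (updateAt-minimal q p _ (p≢q ∘ ≡.sym)) (updateAt-updates q M)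
      at-k : ∀ u v k → k ≢ p → k ≢ q → mat u v k ≡ M k
      at-k u v k k≢p k≢q = ≡.trans (updateAt-minimal k p _ k≢p) (updateAt-minimal k q M k≢q)
      ≡⇒≋ : ∀ {u v : Vector Carrier n} → u ≡ v → u ≋ v
      ≡⇒≋ u≡v j = reflexive (≡.cong (λ w → w j) u≡v)
      diagonal : ∀ u → B u u ≈ 0#
      diagonal u = vanish (mat u u) (≡⇒≋ (≡.trans (at-p u u) (≡.sym (at-q u u))))
      off-p : ∀ u u′ v k → k ≢ p → mat u v k ≋ mat u′ v k
      off-p u u′ v k k≢p = ≡⇒≋ (≡.trans (updateAt-minimal k p _ k≢p) (≡.sym (updateAt-minimal k p _ k≢p)))
      off-q : ∀ u v v′ k → k ≢ q → mat u v k ≋ mat u v′ k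
      off-q u v v′ k k≢q with k ≟ p
      ... | yes ≡.refl = ≡⇒≋ (≡.trans (at-p u v) (≡.sym (at-p u v′)))
      ... | no  k≢p    = ≡⇒≋ (≡.trans (at-k u v k k≢p k≢q) (≡.sym (at-k u v′ k k≢p k≢q)))
      left : ∀ u u′ v → B (u ⊞ u′) v ≈ B u v + B u′ v
      left u u′ v = additive p (off-p _ _ v) (off-p _ _ v) λ j →
        reflexive (≡.trans (≡.cong (λ w → w j) (at-p _ v)) (≡.sym (≡.cong₂ (λ w w′ → w j + w′ j) (at-p u v) (at-p u′ v))))
      right : ∀ u v v′ → B u (v ⊞ v′) ≈ B u v + B u v′
      right u v v′ = additive q (off-q u _ _) (off-q u _ _) λ j →
        reflexive (≡.trans (≡.cong (λ w → w j) (at-q u _)) (≡.sym (≡.cong₂ (λ w w′ → w j + w′ j) (at-q u v) (at-q u v′))))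
      M≋B : ∀ k → M k ≋ mat x y k
      M≋B k with k ≟ p | k ≟ q
      ... | yes ≡.refl | _          = ≡⇒≋ (≡.sym (at-p x y))
      ... | no  k≢p    | yes ≡.refl = ≡⇒≋ (≡.sym (at-q x y))
      ... | no  k≢p    | no  k≢q    = ≡⇒≋ (≡.sym (at-k x y k k≢p k≢q))
      N≋B : ∀ k → N k ≋ mat y x k
      N≋B k with k ≟ p | k ≟ q
      ... | yes ≡.refl | _          = λ j → trans (Np j) (≡⇒≋ (≡.sym (at-p y x)) j)
      ... | no  k≢p    | yes ≡.refl = λ j → trans (Nq j) (≡⇒≋ (≡.sym (at-q y x)) j)
      ... | no  k≢p    | no  k≢q    = λ j → trans (N≋M k k≢p k≢q j) (≡⇒≋ (≡.sym (at-k y x k k≢p k≢q)) j)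

  -- Exchanging the copy of the first row with the row just above it moves it one place up at the
  -- cost of a sign, until the two equal rows are neighbours.
  repeated-first-row : ∀ {n} {D : Matrix (suc n) → Carrier} → IsAlternating D →
                       ∀ i M → M zero ≋ M (suc i) → D M ≈ 0#
  repeated-first-row {suc n} {D} D-alternating =
    <-weakInduction (λ i → ∀ M → M zero ≋ M (suc i) → D M ≈ 0#) (λ M → adjacent here) step
    where
    open IsAlternating D-alternating
    open Algebra.Properties.Ring ring using (-‿involutive; -0#≈0#)
    step : ∀ i → (∀ M → M zero ≋ M (suc (inject₁ i)) → D M ≈ 0#) →
           ∀ M → M zero ≋ M (suc (suc i)) → D M ≈ 0#
    step i rec M M₀≋Mq = begin
      D M      ≈⟨ -‿involutive _ ⟨
      - - D M  ≈⟨ -‿cong (swap-rows D-alternating (adjacent⇒≢ pq) (λ M → adjacent pq) Np Nq N≋M) ⟨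
      - D N    ≈⟨ -‿cong (rec N (λ j → trans (N≋M zero (λ ()) (λ ()) j) (trans (M₀≋Mq j) (sym (Np j))))) ⟩
      - 0#     ≈⟨ -0#≈0# ⟩
      0#       ∎
      where
      p = suc (inject₁ i)
      q = suc (suc i)
      pq : Adjacent p q
      pq = there (adjacent-inject₁ i)
      N = updateAt (updateAt M q (const (M p))) p (const (M q))
      Np : N p ≋ M q
      Np j = reflexive (≡.cong (λ w → w j) (updateAt-updates p (updateAt M q (const (M p)))))
      Nq : N q ≋ M p
      Nq j = reflexive (≡.cong (λ w → w j) (≡.trans (updateAt-minimal q p (updateAt M q (const (M p))) (adjacent⇒≢ pq ∘ ≡.sym)) (updateAt-updates q M)))
      N≋M : ∀ k → k ≢ p → k ≢ q → N k ≋ M k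
      N≋M k k≢p k≢q j = reflexive (≡.cong (λ w → w j) (≡.trans (updateAt-minimal k p _ k≢p) (updateAt-minimal k q M k≢q)))

  insertAt-cong : ∀ {n} {u v : Vector Carrier n} j → u ≋ v → insertAt u j 0# ≋ insertAt v j 0#
  insertAt-cong         zero    u≋v zero    = refl
  insertAt-cong         zero    u≋v (suc l) = u≋v l
  insertAt-cong {suc n} (suc j) u≋v zero    = u≋v zero
  insertAt-cong {suc n} (suc j) u≋v (suc l) = insertAt-cong j (u≋v ∘ suc) l

  insertAt-linear : ∀ {n} a {u v w : Vector Carrier n} j → (∀ l → w l ≈ a * u l + v l) →
                    ∀ l → insertAt w j 0# l ≈ a * insertAt u j 0# l + insertAt v j 0# l
  insertAt-linear         a zero    eq zero    = sym (trans (+-identityʳ _) (zeroʳ a))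
  insertAt-linear         a zero    eq (suc l) = eq l
  insertAt-linear {suc n} a (suc j) eq zero    = eq zero
  insertAt-linear {suc n} a (suc j) eq (suc l) = insertAt-linear a j (eq ∘ suc) l

  insertAt-0 : ∀ {n} j l → insertAt {n = n} (const 0#) j 0# l ≈ 0#
  insertAt-0         zero    zero    = refl
  insertAt-0         zero    (suc l) = refl
  insertAt-0 {suc n} (suc j) zero    = refl
  insertAt-0 {suc n} (suc j) (suc l) = insertAt-0 j l

  insertAt-unit : ∀ {n} j (k : Fin n) → insertAt (scalar 1# k) j 0# ≋ scalar 1# (punchIn j k)
  insertAt-unit zero    k       zero    = refl
  insertAt-unit zero    k       (suc l) = refl
  insertAt-unit (suc j) zero    zero    = refl
  insertAt-unit (suc j) zero    (suc l) = insertAt-0 j l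
  insertAt-unit (suc j) (suc k) zero    = refl
  insertAt-unit (suc j) (suc k) (suc l) = insertAt-unit j k l

  insertAt-removeAt : ∀ {n} (u : Vector Carrier (suc n)) j l →
                      u l ≈ u j * scalar 1# j l + insertAt (removeAt u j) j 0# l
  insertAt-removeAt         u zero    zero    = sym (trans (+-identityʳ _) (*-identityʳ _))
  insertAt-removeAt         u zero    (suc l) = sym (trans (+-congʳ (zeroʳ _)) (+-identityˡ _))
  insertAt-removeAt {suc n} u (suc j) zero    = sym (trans (+-congʳ (zeroʳ _)) (+-identityˡ _))
  insertAt-removeAt {suc n} u (suc j) (suc l) = insertAt-removeAt (tail u) j l

  private

    -- `N` is completed by the first row e_j and by zeros in column `j`. The result is alternating
    -- in the smaller matrix, so the induction of `alternating-unique` applies to it; for `D = det`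
    -- it is (-1)^j det N.
    cofactor : ∀ {n} → (Matrix (suc n) → Carrier) → Fin (suc n) → Matrix n → Carrier
    cofactor D j N = D (scalar 1# j ∷ λ i → insertAt (N i) j 0#)

    cofactor-alternating : ∀ {n} {D : Matrix (suc n) → Carrier} → IsAlternating D →
                           ∀ j → IsAlternating (cofactor D j)
    cofactor-alternating D-alternating j = record
      { cong     = λ M≋N → cong λ { zero _ → refl ; (suc i) → insertAt-cong j (M≋N i) }
      ; linear   = λ i a M≋P N≋P Pi → linear (suc i) a
          (λ { zero _ _ → refl ; (suc k) k≢ → insertAt-cong j (M≋P k (k≢ ∘ ≡.cong suc)) })
          (λ { zero _ _ → refl ; (suc k) k≢ → insertAt-cong j (N≋P k (k≢ ∘ ≡.cong suc)) })
          (insertAt-linear a j Pi)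
      ; adjacent = λ pq Mp≋Mq → adjacent (there pq) (insertAt-cong j Mp≋Mq)
      }
      where open IsAlternating D-alternating

    -- The permutation matrix of the cycle that moves `j` to the front; `D` takes on it the value of
    -- `cofactor D j` at the identity. Each increment of `j` costs one exchange with the first row,
    -- which is the origin of the sign in the Laplace expansion.
    cyclic : ∀ {n} → Fin (suc n) → Matrix (suc n)
    cyclic j = scalar 1# j ∷ λ k → scalar 1# (punchIn j k)

    D-cyclic : ∀ {n} {D : Matrix (suc n) → Carrier} → IsAlternating D →
               ∀ j → D (cyclic j) ≈ (- 1#) ^ toℕ j * D (scalar 1#)
    D-cyclic {n} {D} D-alternating = <-weakInduction (λ j → D (cyclic j) ≈ (- 1#) ^ toℕ j * D (scalar 1#))
      (trans (cong λ { zero _ → refl ; (suc k) _ → refl }) (sym (*-identityˡ _)))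
      step
      where
      open IsAlternating D-alternating
      unit-cong : ∀ {i j : Fin (suc n)} → i ≡ j → scalar 1# i ≋ scalar 1# j
      unit-cong ≡.refl _ = refl
      step : ∀ i → D (cyclic (inject₁ i)) ≈ (- 1#) ^ toℕ (inject₁ i) * D (scalar 1#) →
             D (cyclic (suc i)) ≈ (- 1#) ^ suc (toℕ i) * D (scalar 1#)
      step i rec = begin
        D (cyclic (suc i))
          ≈⟨ swap-rows D-alternating {zero} {suc i} (λ ()) (repeated-first-row D-alternating i)
               (unit-cong (≡.sym (punchIn-inject₁-same i)))
               (unit-cong (punchIn-suc-same i))
               (λ { zero 0≢ _ → contradiction ≡.refl 0≢
                  ; (suc k) _ k≢ → unit-cong (≡.sym (punchIn-inject₁ i k (k≢ ∘ ≡.cong suc))) }) ⟩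
        - D (cyclic (inject₁ i))
          ≈⟨ -‿cong rec ⟩
        - ((- 1#) ^ toℕ (inject₁ i) * D (scalar 1#))
          ≡⟨ ≡.cong (λ t → - ((- 1#) ^ t * D (scalar 1#))) (toℕ-inject₁ i) ⟩
        - ((- 1#) ^ toℕ i * D (scalar 1#))
          ≈⟨ solve 2 (λ s d → :- (s :* d) := (:- con 1ℤ) :* s :* d) refl ((- 1#) ^ toℕ i) (D (scalar 1#)) ⟩
        (- 1#) ^ suc (toℕ i) * D (scalar 1#) ∎

  -- Linearity in the first row reduces to the case where that row is some e_j. Subtracting
  -- multiples of e_j from the other rows changes nothing, since the extra terms contain e_j twice.
  -- What remains is a function of the j-th minor, determined by induction up to its value on
  -- `cyclic j`.
  alternating-unique : ∀ {n} {D : Matrix n → Carrier} → IsAlternating D →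
                       ∀ M → D M ≈ D (scalar 1#) * det M
  alternating-unique {zero}      D-alternating M =
    trans (IsAlternating.cong D-alternating λ ()) (sym (*-identityʳ _))
  alternating-unique {suc n} {D} D-alternating M = begin
    D M
      ≈⟨ cong (λ { zero _ → refl ; (suc i) _ → refl }) ⟩
    D (M zero ∷ tail M)
      ≈⟨ linear-functional (λ v → D (v ∷ tail M))
           (λ u≋v → cong λ { zero → u≋v ; (suc i) _ → refl })
           (λ a u v → linear zero a (λ { zero 0≢ → contradiction ≡.refl 0≢ ; (suc i) _ _ → refl })
                                    (λ { zero 0≢ → contradiction ≡.refl 0≢ ; (suc i) _ _ → refl })
                                    (λ _ → refl))
           (M zero) ⟩
    sum (λ j → M zero j * D (scalar 1# j ∷ tail M))
      ≈⟨ sum-cong-≋ {suc n} (λ j → *-congˡ {M zero j} (expand j)) ⟩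
    sum (λ j → M zero j * ((- 1#) ^ toℕ j * D (scalar 1#) * det (minor j)))
      ≈⟨ sum-cong-≋ {suc n} (λ j → solve 4 (λ m s d e → m :* (s :* d :* e) := d :* (s :* (m :* e))) refl (M zero j) ((- 1#) ^ toℕ j) (D (scalar 1#)) (det (minor j))) ⟩
    sum (λ j → D (scalar 1#) * ((- 1#) ^ toℕ j * (M zero j * det (minor j))))
      ≈⟨ *-distribˡ-sum {suc n} (D (scalar 1#)) (λ j → (- 1#) ^ toℕ j * (M zero j * det (minor j))) ⟨
    D (scalar 1#) * det M ∎
    where
    open IsAlternating D-alternating
    minor : Fin (suc n) → Matrix n
    minor j i = removeAt (M (suc i)) j
    -- The row e_j clears column j of the rows below it.
    clear : ∀ j → D (scalar 1# j ∷ tail M) ≈ cofactor D j (minor j)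
    clear j = replace-rows (λ r → D (scalar 1# j ∷ r))
      (λ u v → ∃[ t ] ∀ l → u l ≈ t * scalar 1# j l + v l)
      (λ { i {r} {r′} eq (t , ri) → begin
        D (scalar 1# j ∷ r)
          ≈⟨ linear (suc i) t {M = λ k → updateAt (scalar 1# j ∷ r′) (suc i) (const (scalar 1# j)) k}
               (λ { zero _ _ → refl
                  ; (suc k) k≢ l → trans (reflexive (≡.cong (λ w → w l) (updateAt-minimal k i r′ (k≢ ∘ ≡.cong suc)))) (sym (eq k (k≢ ∘ ≡.cong suc) l)) })
               (λ { zero _ _ → refl ; (suc k) k≢ l → sym (eq k (k≢ ∘ ≡.cong suc) l) })
               (λ l → trans (ri l) (+-congʳ (*-congˡ (reflexive (≡.cong (λ w → w l) (≡.sym (updateAt-updates i r′))))))) ⟩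
        t * D (updateAt (scalar 1# j ∷ r′) (suc i) (const (scalar 1# j))) + D (scalar 1# j ∷ r′)
          ≈⟨ +-congʳ (*-congˡ (repeated-first-row D-alternating i _ λ l → reflexive (≡.cong (λ w → w l) (≡.sym (updateAt-updates i r′))))) ⟩
        t * 0# + D (scalar 1# j ∷ r′)
          ≈⟨ trans (+-congʳ (zeroʳ t)) (+-identityˡ _) ⟩
        D (scalar 1# j ∷ r′) ∎ })
      (λ eq → cong λ { zero _ → refl ; (suc k) → eq k })
      (λ i → M (suc i) j , insertAt-removeAt (M (suc i)) j)
    expand : ∀ j → D (scalar 1# j ∷ tail M) ≈ (- 1#) ^ toℕ j * D (scalar 1#) * det (minor j)
    expand j = begin
      D (scalar 1# j ∷ tail M)
        ≈⟨ clear j ⟩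
      cofactor D j (minor j)
        ≈⟨ alternating-unique (cofactor-alternating D-alternating j) (minor j) ⟩
      cofactor D j (scalar 1#) * det (minor j)
        ≈⟨ *-congʳ (cong λ { zero _ → refl ; (suc k) → insertAt-unit j k }) ⟩
      D (cyclic j) * det (minor j)
        ≈⟨ *-congʳ (D-cyclic D-alternating j) ⟩
      (- 1#) ^ toℕ j * D (scalar 1#) * det (minor j) ∎

  det-diagonal : ∀ {n} (M : Matrix n) → (∀ {i j} → i ≢ j → M i j ≈ 0#) →
                 det M ≈ product λ i → M i i
  det-diagonal {zero}  M off = refl
  det-diagonal {suc n} M off = begin
    1# * (M zero zero * det M′) + sum (λ j → s (suc j) * (M zero (suc j) * minor j))
      ≈⟨ +-cong (*-identityˡ _) (sum-zero {n} λ j → trans (*-congˡ (trans (*-congʳ (off λ ())) (zeroˡ _))) (zeroʳ _)) ⟩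
    M zero zero * det M′ + 0#
      ≈⟨ +-identityʳ _ ⟩
    M zero zero * det M′
      ≈⟨ *-congˡ (det-diagonal M′ λ i≢j → off (i≢j ∘ suc-injective)) ⟩
    M zero zero * product (λ i → M (suc i) (suc i)) ∎
    where
    s : Fin (suc n) → Carrier
    s j = (- 1#) ^ toℕ j
    M′ : Matrix n
    M′ i k = M (suc i) (suc k)
    minor : Fin n → Carrier
    minor j = det λ i k → M (suc i) (punchIn (suc j) k)

  scalar-off : ∀ {n} z {i j : Fin n} → i ≢ j → scalar z i j ≈ 0#
  scalar-off z {i} {j} i≢j with i ≟ j
  ... | yes i≡j = contradiction i≡j i≢j
  ... | no  _   = refl

  scalar-diagonal : ∀ {n} z (i : Fin n) → scalar z i i ≈ z
  scalar-diagonal z i with i ≟ i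
  ... | yes _  = refl
  ... | no i≢i = contradiction ≡.refl i≢i

  det-1 : ∀ {n} → det (scalar {n} 1#) ≈ 1#
  det-1 {n} = trans (det-diagonal (scalar {n} 1#) (scalar-off 1#)) (ones n)
    where
    ones : ∀ n → product {n} (λ i → scalar 1# i i) ≈ 1#
    ones zero    = refl
    ones (suc n) = trans (*-identityˡ _) (ones n)

  scalar-sym : ∀ {n} z (i j : Fin n) → scalar z i j ≈ scalar z j i
  scalar-sym z i j with i ≟ j
  ... | yes ≡.refl = sym (scalar-diagonal z i)
  ... | no  i≢j    = sym (scalar-off z (i≢j ∘ ≡.sym))

  -- The transposed determinant is the one already known to be alternating in the rows, hence a
  -- multiple of `det`; the identity matrix fixes the factor.
  det-transpose : ∀ {n} (M : Matrix n) → det (M ᵀ) ≈ det M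
  det-transpose {n} M = begin
    det (M ᵀ)                    ≈⟨ alternating-unique detᵀ-alternating M ⟩
    det (scalar {n} 1# ᵀ) * det M    ≈⟨ *-congʳ (det-cong {n} {scalar 1# ᵀ} λ i j → scalar-sym 1# j i) ⟩
    det (scalar {n} 1#) * det M      ≈⟨ *-congʳ (det-1 {n}) ⟩
    1# * det M                   ≈⟨ *-identityˡ _ ⟩
    det M                        ∎

  sum-single : ∀ {n} i (f : Vector Carrier n) → (∀ j → j ≢ i → f j ≈ 0#) → sum f ≈ f i
  sum-single zero    f f≈0 = trans (+-congˡ (sum-zero λ j → f≈0 (suc j) λ ())) (+-identityʳ _)
  sum-single (suc i) f f≈0 =
    trans (+-cong (f≈0 zero λ ()) (sum-single i (f ∘ suc) λ j j≢i → f≈0 (suc j) (j≢i ∘ suc-injective))) (+-identityˡ _)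

  ⊗-identityˡ : ∀ {n} (M : Matrix n) i → (scalar 1# ⊗ M) i ≋ M i
  ⊗-identityˡ M i j =
    trans (sum-single i _ λ k k≢i → trans (*-congʳ (scalar-off 1# (k≢i ∘ ≡.sym))) (zeroˡ _))
          (trans (*-congʳ (scalar-diagonal 1# i)) (*-identityˡ _))

  -- For fixed `N`, the rows of the product depend linearly on the rows of `M`, so the left side is
  -- alternating in `M`, with value det N at the identity. Transposition serves to import the
  -- alternating property, which was established for `det (M ᵀ)`.
  det-⊗ : ∀ {n} (M N : Matrix n) → det (M ⊗ N) ≈ det M * det N
  det-⊗ {n} M N = begin
    det (M ⊗ N)                      ≈⟨ alternating-unique ⊗-alternating M ⟩
    det (scalar 1# ⊗ N) * det M      ≈⟨ *-congʳ (det-cong (⊗-identityˡ N)) ⟩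
    det N * det M                    ≈⟨ *-comm _ _ ⟩
    det M * det N                    ∎
    where
    open IsAlternating detᵀ-alternating
    ⊗-alternating : IsAlternating (λ M → det (M ⊗ N))
    ⊗-alternating = record
      { cong     = λ M≋M′ → det-cong λ i j → sum-cong-≋ {n} λ k → *-congʳ (M≋M′ i k)
      ; linear   = λ i a {M} {M′} {P} M≋P M′≋P Pi → begin
          det (P ⊗ N)                          ≈⟨ det-transpose (P ⊗ N) ⟨
          det ((P ⊗ N) ᵀ)
            ≈⟨ linear i a (λ k k≢i j → sum-cong-≋ {n} λ l → *-congʳ (M≋P k k≢i l))
                          (λ k k≢i j → sum-cong-≋ {n} λ l → *-congʳ (M′≋P k k≢i l))
                          (λ j → trans (sum-cong-≋ {n} λ l → trans (*-congʳ (Pi l)) (trans (distribʳ _ _ _) (+-congʳ (*-assoc _ _ _))))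
                                       (sum-linear {n} a _ _)) ⟩
          a * det ((M ⊗ N) ᵀ) + det ((M′ ⊗ N) ᵀ)
            ≈⟨ +-cong (*-congˡ (det-transpose (M ⊗ N))) (det-transpose (M′ ⊗ N)) ⟩
          a * det (M ⊗ N) + det (M′ ⊗ N)       ∎
      ; adjacent = λ pq {M} Mp≋Mq → trans (sym (det-transpose (M ⊗ N))) (adjacent pq λ j → sum-cong-≋ {n} λ k → *-congʳ (Mp≋Mq k))
      }

-- Linear dependence and kernels over a field

record IsDiscreteField (K : CommutativeRing 0ℓ 0ℓ) : Set where
  open CommutativeRing K
  field
    0≉1     : 0# ≉ 1#
    _≟0     : ∀ x → Dec (x ≈ 0#)
    inverse : ∀ {x} → x ≉ 0# → ∃[ y ] x * y ≈ 1#

module LinearAlgebra (K : CommutativeRing 0ℓ 0ℓ) (isDiscreteField : IsDiscreteField K) where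

  open CommutativeRing K hiding (zero)
  open IsDiscreteField isDiscreteField
  open Matrices (Ring.rawRing ring)
  open Algebra.Properties.Semiring.Sum semiring
  open RingSolver K
  open Determinant K
  open Relation.Binary.Reasoning.Setoid setoid

  NonZeroVector : ∀ {n} → Vector Carrier n → Set
  NonZeroVector v = ∃[ i ] v i ≉ 0#

  -- Gaussian elimination in the first coordinate. If it vanishes on all vectors, one vector gets
  -- the coefficient 0 and the coordinate is dropped. Otherwise a pivot `p` clears it from the other
  -- vectors, which are dependent by induction.
  dependence : ∀ {n} (v : Vector (Vector Carrier n) (suc n)) →
               ∃[ c ] NonZeroVector c × (∀ j → sum (λ i → c i * v i j) ≈ 0#)
  dependence {zero}  v = const 1# , (zero , 0≉1 ∘ sym) , λ ()
  dependence {suc n} v with any? (λ i → ¬? (v i zero ≟0))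
  ... | no none with dependence (λ i j → v (suc i) (suc j))
  ...   | c , (i , ci≉0) , cv≈0 = (0# ∷ c) , (suc i , ci≉0) , relation
    where
    relation : ∀ j → 0# * v zero j + sum (λ i → c i * v (suc i) j) ≈ 0#
    relation zero    = trans (+-cong (zeroˡ _) (sum-zero {suc n} λ i →
      trans (*-congˡ {c i} (decidable-stable (v (suc i) zero ≟0) λ vi≉0 → none (suc i , vi≉0))) (zeroʳ _))) (+-identityˡ _)
    relation (suc j) = trans (+-cong (zeroˡ _) (cv≈0 j)) (+-identityˡ _)
  dependence {suc n} v | yes (p , vp≉0) with inverse vp≉0
  ... | y , vp*y≈1 with dependence (λ k j → v (punchIn p k) (suc j) - v (punchIn p k) zero * y * v p (suc j))
  ...   | c , (i , ci≉0) , cw≈0 = c′ , (punchIn p i , c′≉0) , relation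
    where
    t : Vector Carrier (suc n)
    t k = v (punchIn p k) zero * y
    T = sum (λ k → c k * t k)
    -- The relation among the cleared vectors contains the pivot vector with total coefficient -T,
    -- as t_k times the pivot was subtracted from the k-th of them.
    c′ = insertAt c p (- T)
    c′≉0 : c′ (punchIn p i) ≉ 0#
    c′≉0 eq = ci≉0 (trans (reflexive (≡.sym (insertAt-punchIn c p (- T) i))) eq)
    reduced : ∀ j → sum (λ i → c′ i * v i j) ≈ sum (λ k → c k * (v (punchIn p k) j - t k * v p j))
    reduced j = begin
      sum (λ i → c′ i * v i j)
        ≈⟨ sum-remove {suc n} {p} (λ i → c′ i * v i j) ⟩
      c′ p * v p j + sum (λ k → c′ (punchIn p k) * v (punchIn p k) j)
        ≈⟨ +-cong (*-congʳ (reflexive (insertAt-lookup c p (- T))))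
                  (sum-cong-≋ {suc n} λ k → *-congʳ {v (punchIn p k) j} (reflexive (insertAt-punchIn c p (- T) k))) ⟩
      - T * v p j + sum (λ k → c k * v (punchIn p k) j)
        ≈⟨ +-congʳ (solve 2 (λ T v → (:- T) :* v := (:- v) :* T) refl T (v p j)) ⟩
      - v p j * T + sum (λ k → c k * v (punchIn p k) j)
        ≈⟨ sum-linear {suc n} (- v p j) (λ k → c k * t k) (λ k → c k * v (punchIn p k) j) ⟨
      sum (λ k → - v p j * (c k * t k) + c k * v (punchIn p k) j)
        ≈⟨ sum-cong-≋ {suc n} (λ k → solve 4 (λ v c t w → (:- v) :* (c :* t) :+ c :* w := c :* (w :- t :* v)) refl (v p j) (c k) (t k) (v (punchIn p k) j)) ⟩
      sum (λ k → c k * (v (punchIn p k) j - t k * v p j)) ∎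
    relation : ∀ j → sum (λ i → c′ i * v i j) ≈ 0#
    relation zero    = trans (reduced zero) (sum-zero {suc n} λ k → begin
      c k * (v (punchIn p k) zero - t k * v p zero)
        ≈⟨ solve 4 (λ c w y v → c :* (w :- w :* y :* v) := c :* w :* (con 1ℤ :- v :* y)) refl (c k) (v (punchIn p k) zero) y (v p zero) ⟩
      c k * v (punchIn p k) zero * (1# - v p zero * y)
        ≈⟨ *-congˡ (trans (+-congˡ (-‿cong vp*y≈1)) (-‿inverseʳ 1#)) ⟩
      c k * v (punchIn p k) zero * 0#
        ≈⟨ zeroʳ _ ⟩
      0# ∎)
    relation (suc j) = trans (reduced (suc j)) (cw≈0 j)

  -- For each l, the unit vector e_l and the columns of M are dependent.  If the coefficient of some e_l vanishes, this
  -- is a kernel vector; otherwise every e_l lies in the span of the columns, and M has a right inverse.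
  kernel : ∀ {n} (M : Matrix n) → det M ≈ 0# →
           ∃[ v ] NonZeroVector v × (∀ i → (M · v) i ≈ 0#)
  kernel {n} M det≈0 with any? (λ l → coefficient l zero ≟0)
    where
    coefficient : Fin n → Vector Carrier (suc n)
    coefficient l = let c , _ = dependence (scalar 1# l ∷ λ j i → M i j) in c
  ... | yes (l , c₀≈0) with dependence (scalar 1# l ∷ λ j i → M i j)
  ...   | c , (zero , c₀≉0) , _ = contradiction c₀≈0 c₀≉0
  ...   | c , (suc k , ck≉0) , relation = tail c , (k , ck≉0) , λ i → begin
    sum (λ j → M i j * c (suc j))
      ≈⟨ sum-cong-≋ {n} (λ j → *-comm (M i j) (c (suc j))) ⟩
    sum (λ j → c (suc j) * M i j)
      ≈⟨ +-identityˡ _ ⟨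
    0# + sum (λ j → c (suc j) * M i j)
      ≈⟨ +-congʳ (trans (*-congʳ c₀≈0) (zeroˡ _)) ⟨
    c zero * scalar 1# l i + sum (λ j → c (suc j) * M i j)
      ≈⟨ relation i ⟩
    0# ∎
  kernel {n} M det≈0 | no c₀≉0 = contradiction 0≈1 0≉1
    where
    c : Fin n → Vector Carrier (suc n)
    c l = let c , _ = dependence (scalar 1# l ∷ λ j i → M i j) in c
    relation : ∀ l i → c l zero * scalar 1# l i + sum (λ j → c l (suc j) * M i j) ≈ 0#
    relation l = let _ , _ , r = dependence (scalar 1# l ∷ λ j i → M i j) in r
    inv : ∀ l → ∃[ y ] c l zero * y ≈ 1#
    inv l = inverse λ eq → c₀≉0 (l , eq)
    N : Matrix n
    N j l = let y , _ = inv l in - y * c l (suc j)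
    M⊗N≈1 : ∀ i → (M ⊗ N) i ≋ scalar 1# i
    M⊗N≈1 i l with inv l
    ... | y , c₀*y≈1 = begin
      sum (λ j → M i j * (- y * c l (suc j)))
        ≈⟨ sum-cong-≋ {n} (λ j → solve 3 (λ m y c → m :* ((:- y) :* c) := (:- y) :* (c :* m)) refl (M i j) y (c l (suc j))) ⟩
      sum (λ j → - y * (c l (suc j) * M i j))
        ≈⟨ *-distribˡ-sum {n} (- y) (λ j → c l (suc j) * M i j) ⟨
      - y * S
        ≈⟨ solve 4 (λ y c e s → (:- y) :* s := (c :* y) :* e :- y :* (c :* e :+ s)) refl y (c l zero) e S ⟩
      c l zero * y * e - y * (c l zero * e + S)
        ≈⟨ +-cong (*-congʳ c₀*y≈1) (-‿cong (*-congˡ (relation l i))) ⟩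
      1# * e - y * 0#
        ≈⟨ solve 2 (λ e y → con 1ℤ :* e :- y :* con 0ℤ := e) refl e y ⟩
      e
        ≈⟨ scalar-sym 1# l i ⟩
      scalar 1# i l ∎
      where
      S = sum (λ j → c l (suc j) * M i j)
      e = scalar 1# l i
    -- A right inverse makes det M a divisor of 1, which a vanishing determinant cannot be.
    0≈1 : 0# ≈ 1#
    0≈1 = begin
      0#               ≈⟨ zeroˡ (det N) ⟨
      0# * det N       ≈⟨ *-congʳ det≈0 ⟨
      det M * det N    ≈⟨ det-⊗ M N ⟨
      det (M ⊗ N)      ≈⟨ det-cong M⊗N≈1 ⟩
      det (scalar {n} 1#)  ≈⟨ det-1 {n} ⟩
      1#               ∎

-- Inner products, eigenvectors and unitary matrices over a field with conjugation

record IsStarField (K : CommutativeRing 0ℓ 0ℓ) (conj : CommutativeRing.Carrier K → CommutativeRing.Carrier K) : Set where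
  open CommutativeRing K
  open Algebra.Properties.Semiring.Sum semiring using (sum)
  field
    isDiscreteField : IsDiscreteField K
    conj-cong       : ∀ {x y} → x ≈ y → conj x ≈ conj y
    conj-+          : ∀ x y → conj (x + y) ≈ conj x + conj y
    conj-*          : ∀ x y → conj (x * y) ≈ conj x * conj y
    conj-involutive : ∀ x → conj (conj x) ≈ x
    -- The trace of positivity in this otherwise algebraic setting; it fails for ℂ with the identity
    -- in place of conjugation. It makes ⟨v,v⟩ invertible for nonzero v, on which the independence
    -- of the eigenvectors rests, and it settles the degenerate case of the reflection below.
    definite        : ∀ {n} (v : Vector Carrier n) → sum (λ i → conj (v i) * v i) ≈ 0# → ∀ i → v i ≈ 0#

module InnerProduct (K : CommutativeRing 0ℓ 0ℓ) (conj : CommutativeRing.Carrier K → CommutativeRing.Carrier K)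
  (isStarField : IsStarField K conj) where

  open CommutativeRing K hiding (zero)
  open IsStarField isStarField
  open IsDiscreteField isDiscreteField
  open Matrices (Ring.rawRing ring)
  open Algebra.Definitions.RawSemiring (RawRing.rawSemiring (Ring.rawRing ring)) using (product; _^_)
  open Algebra.Properties.Ring ring using (x∙y⁻¹≈ε⇒x≈y; +-identityʳ-unique; +-inverseʳ-unique)
  open Algebra.Properties.Semiring.Sum semiring
  open RingSolver K
  open Determinant K
  open LinearAlgebra K isDiscreteField
  open Relation.Binary.Reasoning.Setoid setoid

  *-cancel-0 : ∀ {x y} → x ≉ 0# → x * y ≈ 0# → y ≈ 0#
  *-cancel-0 {x} {y} x≉0 xy≈0 with inverse x≉0
  ... | z , xz≈1 = begin
    y            ≈⟨ *-identityˡ y ⟨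
    1# * y       ≈⟨ *-congʳ xz≈1 ⟨
    x * z * y    ≈⟨ solve 3 (λ x y z → x :* z :* y := z :* (x :* y)) refl x y z ⟩
    z * (x * y)  ≈⟨ *-congˡ xy≈0 ⟩
    z * 0#       ≈⟨ zeroʳ z ⟩
    0#           ∎

  *-cancelˡ : ∀ {x y z} → x ≉ 0# → x * y ≈ x * z → y ≈ z
  *-cancelˡ {x} {y} {z} x≉0 eq = x∙y⁻¹≈ε⇒x≈y y z (*-cancel-0 x≉0 (begin
    x * (y - z)    ≈⟨ solve 3 (λ x y z → x :* (y :- z) := x :* y :- x :* z) refl x y z ⟩
    x * y - x * z  ≈⟨ +-congʳ eq ⟩
    x * z - x * z  ≈⟨ -‿inverseʳ _ ⟩
    0#             ∎))

  conj-0 : conj 0# ≈ 0#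
  conj-0 = +-identityʳ-unique (conj 0#) (conj 0#) (trans (sym (conj-+ 0# 0#)) (conj-cong (+-identityˡ 0#)))

  conj-neg : ∀ x → conj (- x) ≈ - conj x
  conj-neg x = +-inverseʳ-unique (conj x) (conj (- x))
    (trans (sym (conj-+ x (- x))) (trans (conj-cong (-‿inverseʳ x)) conj-0))

  -- Every element is a conjugate, so multiplicativity makes conj 1 a neutral element; this is
  -- applied to 1 = conj (conj 1).
  conj-1 : conj 1# ≈ 1#
  conj-1 = begin
    conj 1#                   ≈⟨ *-identityʳ _ ⟨
    conj 1# * 1#              ≈⟨ *-congˡ (conj-involutive 1#) ⟨
    conj 1# * conj (conj 1#)  ≈⟨ conj-* _ _ ⟨
    conj (1# * conj 1#)       ≈⟨ conj-cong (*-identityˡ _) ⟩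
    conj (conj 1#)            ≈⟨ conj-involutive 1# ⟩
    1#                        ∎

  conj-sum : ∀ {n} (f : Vector Carrier n) → conj (sum f) ≈ sum (conj ∘ f)
  conj-sum {zero}  f = conj-0
  conj-sum {suc n} f = trans (conj-+ _ _) (+-congˡ (conj-sum (f ∘ suc)))

  conj-scalar : ∀ {n} (i j : Fin n) → conj (scalar 1# i j) ≈ scalar 1# i j
  conj-scalar i j with i ≟ j
  ... | yes _ = conj-1
  ... | no  _ = conj-0

  ⟨_∣_⟩ : ∀ {n} → Vector Carrier n → Vector Carrier n → Carrier
  ⟨ v ∣ w ⟩ = sum λ i → conj (v i) * w i

  ip-cong : ∀ {n} {v v′ w w′ : Vector Carrier n} → v ≋ v′ → w ≋ w′ → ⟨ v ∣ w ⟩ ≈ ⟨ v′ ∣ w′ ⟩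
  ip-cong {n} v≋v′ w≋w′ = sum-cong-≋ {n} λ i → *-cong (conj-cong (v≋v′ i)) (w≋w′ i)

  ip-conj : ∀ {n} (v w : Vector Carrier n) → conj ⟨ v ∣ w ⟩ ≈ ⟨ w ∣ v ⟩
  ip-conj {n} v w = trans (conj-sum {n} _) (sum-cong-≋ {n} λ i → begin
    conj (conj (v i) * w i)         ≈⟨ conj-* _ _ ⟩
    conj (conj (v i)) * conj (w i)  ≈⟨ *-congʳ (conj-involutive (v i)) ⟩
    v i * conj (w i)                ≈⟨ *-comm _ _ ⟩
    conj (w i) * v i                ∎)

  ip-linearʳ : ∀ {n} a (v x y : Vector Carrier n) →
               ⟨ v ∣ (λ i → a * x i + y i) ⟩ ≈ a * ⟨ v ∣ x ⟩ + ⟨ v ∣ y ⟩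
  ip-linearʳ {n} a v x y = trans
    (sum-cong-≋ {n} λ i → solve 4 (λ a v x y → v :* (a :* x :+ y) := a :* (v :* x) :+ v :* y) refl a (conj (v i)) (x i) (y i))
    (sum-linear {n} a (λ i → conj (v i) * x i) (λ i → conj (v i) * y i))

  ip-linearˡ : ∀ {n} a (x y w : Vector Carrier n) →
               ⟨ (λ i → a * x i + y i) ∣ w ⟩ ≈ conj a * ⟨ x ∣ w ⟩ + ⟨ y ∣ w ⟩
  ip-linearˡ a x y w = begin
    ⟨ (λ i → a * x i + y i) ∣ w ⟩         ≈⟨ ip-conj w (λ i → a * x i + y i) ⟨
    conj ⟨ w ∣ (λ i → a * x i + y i) ⟩    ≈⟨ conj-cong (ip-linearʳ a w x y) ⟩
    conj (a * ⟨ w ∣ x ⟩ + ⟨ w ∣ y ⟩)      ≈⟨ trans (conj-+ _ _) (+-congʳ (conj-* _ _)) ⟩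
    conj a * conj ⟨ w ∣ x ⟩ + conj ⟨ w ∣ y ⟩ ≈⟨ +-cong (*-congˡ (ip-conj w x)) (ip-conj w y) ⟩
    conj a * ⟨ x ∣ w ⟩ + ⟨ y ∣ w ⟩        ∎

  ip-scaleʳ : ∀ {n} a (v x : Vector Carrier n) → ⟨ v ∣ (λ i → a * x i) ⟩ ≈ a * ⟨ v ∣ x ⟩
  ip-scaleʳ {n} a v x = trans
    (sum-cong-≋ {n} λ i → solve 3 (λ a v x → v :* (a :* x) := a :* (v :* x)) refl a (conj (v i)) (x i))
    (sym (*-distribˡ-sum {n} a (λ i → conj (v i) * x i)))

  ip-scaleˡ : ∀ {n} a (x w : Vector Carrier n) → ⟨ (λ i → a * x i) ∣ w ⟩ ≈ conj a * ⟨ x ∣ w ⟩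
  ip-scaleˡ a x w = begin
    ⟨ (λ i → a * x i) ∣ w ⟩       ≈⟨ ip-conj w (λ i → a * x i) ⟨
    conj ⟨ w ∣ (λ i → a * x i) ⟩  ≈⟨ conj-cong (ip-scaleʳ a w x) ⟩
    conj (a * ⟨ w ∣ x ⟩)          ≈⟨ conj-* _ _ ⟩
    conj a * conj ⟨ w ∣ x ⟩       ≈⟨ *-congˡ (ip-conj w x) ⟩
    conj a * ⟨ x ∣ w ⟩            ∎

  ip-sumʳ : ∀ {m n} (v : Vector Carrier n) (w : Vector (Vector Carrier n) m) →
            ⟨ v ∣ (λ j → sum λ i → w i j) ⟩ ≈ sum λ i → ⟨ v ∣ w i ⟩
  ip-sumʳ {m} {n} v w = trans
    (sum-cong-≋ {n} λ j → *-distribˡ-sum {m} (conj (v j)) λ i → w i j)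
    (∑-comm {n} {m} λ j i → conj (v j) * w i j)

  ip-sumˡ : ∀ {m n} (v : Vector (Vector Carrier n) m) (w : Vector Carrier n) →
            ⟨ (λ j → sum λ i → v i j) ∣ w ⟩ ≈ sum λ i → ⟨ v i ∣ w ⟩
  ip-sumˡ {m} v w = begin
    ⟨ (λ j → sum λ i → v i j) ∣ w ⟩       ≈⟨ ip-conj w (λ j → sum λ i → v i j) ⟨
    conj ⟨ w ∣ (λ j → sum λ i → v i j) ⟩  ≈⟨ conj-cong (ip-sumʳ w v) ⟩
    conj (sum λ i → ⟨ w ∣ v i ⟩)          ≈⟨ conj-sum {m} _ ⟩
    (sum λ i → conj ⟨ w ∣ v i ⟩)          ≈⟨ sum-cong-≋ {m} (λ i → ip-conj w (v i)) ⟩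
    (sum λ i → ⟨ v i ∣ w ⟩)               ∎

  sum-scalar : ∀ {n} z (v : Vector Carrier n) i → sum (λ j → scalar z i j * v j) ≈ z * v i
  sum-scalar {n} z v i =
    trans (sum-single {n} i _ λ j j≢i → trans (*-congʳ (scalar-off z (j≢i ∘ ≡.sym))) (zeroˡ _))
          (*-congʳ (scalar-diagonal z i))

  ip-unitˡ : ∀ {n} (i : Fin n) v → ⟨ scalar 1# i ∣ v ⟩ ≈ v i
  ip-unitˡ {n} i v = trans (sum-cong-≋ {n} λ j → *-congʳ (conj-scalar i j)) (trans (sum-scalar 1# v i) (*-identityˡ _))

  ip-unitʳ : ∀ {n} (i : Fin n) v → ⟨ v ∣ scalar 1# i ⟩ ≈ conj (v i)
  ip-unitʳ i v = trans (sym (ip-conj (scalar 1# i) v)) (conj-cong (ip-unitˡ i v))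

  Hermitian : ∀ {n} → Matrix n → Set
  Hermitian A = ∀ i j → A i j ≈ conj (A j i)

  hermitian⇒self-adjoint : ∀ {n} {A : Matrix n} → Hermitian A → ∀ v w → ⟨ v ∣ A · w ⟩ ≈ ⟨ A · v ∣ w ⟩
  hermitian⇒self-adjoint {n} {A} A-hermitian v w = begin
    (sum λ i → conj (v i) * sum λ j → A i j * w j)
      ≈⟨ sum-cong-≋ {n} (λ i → *-distribˡ-sum {n} (conj (v i)) λ j → A i j * w j) ⟩
    (sum λ i → sum λ j → conj (v i) * (A i j * w j))
      ≈⟨ ∑-comm {n} {n} (λ i j → conj (v i) * (A i j * w j)) ⟩
    (sum λ j → sum λ i → conj (v i) * (A i j * w j))
      ≈⟨ sum-cong-≋ {n} (λ j → sum-cong-≋ {n} λ i → begin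
           conj (v i) * (A i j * w j)         ≈⟨ *-congˡ (*-congʳ (A-hermitian i j)) ⟩
           conj (v i) * (conj (A j i) * w j)  ≈⟨ solve 3 (λ v a w → v :* (a :* w) := a :* v :* w) refl (conj (v i)) (conj (A j i)) (w j) ⟩
           conj (A j i) * conj (v i) * w j    ≈⟨ *-congʳ (conj-* _ _) ⟨
           conj (A j i * v i) * w j           ∎) ⟩
    (sum λ j → sum λ i → conj (A j i * v i) * w j)
      ≈⟨ sum-cong-≋ {n} (λ j → *-distribʳ-sum {n} (w j) λ i → conj (A j i * v i)) ⟨
    (sum λ j → sum (λ i → conj (A j i * v i)) * w j)
      ≈⟨ sum-cong-≋ {n} (λ j → *-congʳ (conj-sum {n} λ i → A j i * v i)) ⟨
    ⟨ A · v ∣ w ⟩ ∎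

  ·-cong : ∀ {n} (A : Matrix n) {v w : Vector Carrier n} → v ≋ w → A · v ≋ A · w
  ·-cong {n} A v≋w i = sum-cong-≋ {n} λ j → *-congˡ (v≋w j)

  ·-scale : ∀ {n} (A : Matrix n) a v i → (A · (λ j → a * v j)) i ≈ a * (A · v) i
  ·-scale {n} A a v i = trans
    (sum-cong-≋ {n} λ j → solve 3 (λ m a v → m :* (a :* v) := a :* (m :* v)) refl (A i j) a (v j))
    (sym (*-distribˡ-sum {n} a λ j → A i j * v j))

  ·-sum : ∀ {m n} (A : Matrix n) (w : Vector (Vector Carrier n) m) i →
          (A · (λ j → sum λ l → w l j)) i ≈ sum λ l → (A · w l) i
  ·-sum {m} {n} A w i = trans
    (sum-cong-≋ {n} λ j → *-distribˡ-sum {m} (A i j) λ l → w l j)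
    (∑-comm {n} {m} λ j l → A i j * w l j)

  ·-⊗ : ∀ {n} (A B : Matrix n) v → (A ⊗ B) · v ≋ A · (B · v)
  ·-⊗ {n} A B v i = begin
    (sum λ k → (sum λ j → A i j * B j k) * v k)
      ≈⟨ sum-cong-≋ {n} (λ k → *-distribʳ-sum {n} (v k) λ j → A i j * B j k) ⟩
    (sum λ k → sum λ j → A i j * B j k * v k)
      ≈⟨ ∑-comm {n} {n} (λ k j → A i j * B j k * v k) ⟩
    (sum λ j → sum λ k → A i j * B j k * v k)
      ≈⟨ sum-cong-≋ {n} (λ j → trans (sum-cong-≋ {n} λ k → *-assoc _ _ _) (sym (*-distribˡ-sum {n} (A i j) λ k → B j k * v k))) ⟩
    (A · (B · v)) i ∎

  product-zero : ∀ {n} (f : Vector Carrier n) i → f i ≈ 0# → product f ≈ 0#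
  product-zero f zero    fi≈0 = trans (*-congʳ fi≈0) (zeroˡ _)
  product-zero f (suc i) fi≈0 = trans (*-congˡ (product-zero (f ∘ suc) i fi≈0)) (zeroʳ _)

  product-cong : ∀ {n} (f g : Vector Carrier n) → f ≋ g → product f ≈ product g
  product-cong {zero}  f g f≋g = refl
  product-cong {suc n} f g f≋g = *-cong (f≋g zero) (product-cong (f ∘ suc) (g ∘ suc) (f≋g ∘ suc))

  -- The common ground of both directions: the moments follow from these data, whether the matrix
  -- was given or constructed. The components are not normalised and may be zero, because their
  -- squared norms are to be the weights.
  record EigenDecomposition {n} (A : Matrix n) (z : Vector Carrier n) (ξ : Vector Carrier n) : Set where
    field
      component  : Vector (Vector Carrier n) n
      eigen      : ∀ i j → (A · component i) j ≈ z i * component i j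
      orthogonal : ∀ {i j} → i ≢ j → ⟨ component i ∣ component j ⟩ ≈ 0#
      decompose  : ∀ j → ξ j ≈ sum λ i → component i j

  module _ {n} {A : Matrix n} {z ξ : Vector Carrier n} (decomposition : EigenDecomposition A z ξ) where

    open EigenDecomposition decomposition

    power-decompose : ∀ k → (A ^ᴹ k) · ξ ≋ (λ j → sum λ i → z i ^ k * component i j)
    power-decompose zero j = begin
      (scalar 1# · ξ) j                     ≈⟨ trans (sum-scalar 1# ξ j) (*-identityˡ _) ⟩
      ξ j                                   ≈⟨ decompose j ⟩
      (sum λ i → component i j)             ≈⟨ sum-cong-≋ {n} (λ i → *-identityˡ _) ⟨
      (sum λ i → 1# * component i j)        ∎
    power-decompose (suc k) j = begin
      ((A ⊗ A ^ᴹ k) · ξ) j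
        ≈⟨ ·-⊗ A (A ^ᴹ k) ξ j ⟩
      (A · ((A ^ᴹ k) · ξ)) j
        ≈⟨ ·-cong A (power-decompose k) j ⟩
      (A · (λ l → sum λ i → z i ^ k * component i l)) j
        ≈⟨ ·-sum A (λ i l → z i ^ k * component i l) j ⟩
      (sum λ i → (A · (λ l → z i ^ k * component i l)) j)
        ≈⟨ sum-cong-≋ {n} (λ i → trans (·-scale A (z i ^ k) (component i) j) (*-congˡ (eigen i j))) ⟩
      (sum λ i → z i ^ k * (z i * component i j))
        ≈⟨ sum-cong-≋ {n} (λ i → solve 3 (λ p z w → p :* (z :* w) := z :* p :* w) refl (z i ^ k) (z i) (component i j)) ⟩
      (sum λ i → z i ^ suc k * component i j) ∎

    -- Orthogonality removes all other components of `ξ`. This is why squared norms, and not mixed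
    -- products, appear in the moments.
    ip-component : ∀ i → ⟨ ξ ∣ component i ⟩ ≈ ⟨ component i ∣ component i ⟩
    ip-component i = begin
      ⟨ ξ ∣ component i ⟩
        ≈⟨ ip-cong decompose (λ _ → refl) ⟩
      ⟨ (λ j → sum λ l → component l j) ∣ component i ⟩
        ≈⟨ ip-sumˡ component (component i) ⟩
      (sum λ l → ⟨ component l ∣ component i ⟩)
        ≈⟨ sum-single {n} i _ (λ l l≢i → orthogonal l≢i) ⟩
      ⟨ component i ∣ component i ⟩ ∎

    moment : ∀ k → ⟨ ξ ∣ (A ^ᴹ k) · ξ ⟩ ≈ sum λ i → z i ^ k * ⟨ component i ∣ component i ⟩
    moment k = begin
      ⟨ ξ ∣ (A ^ᴹ k) · ξ ⟩
        ≈⟨ ip-cong (λ _ → refl) (power-decompose k) ⟩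
      ⟨ ξ ∣ (λ j → sum λ i → z i ^ k * component i j) ⟩
        ≈⟨ ip-sumʳ ξ (λ i j → z i ^ k * component i j) ⟩
      (sum λ i → ⟨ ξ ∣ (λ j → z i ^ k * component i j) ⟩)
        ≈⟨ sum-cong-≋ {n} (λ i → trans (ip-scaleʳ (z i ^ k) ξ (component i)) (*-congˡ (ip-component i))) ⟩
      (sum λ i → z i ^ k * ⟨ component i ∣ component i ⟩) ∎

  eigenvector : ∀ {n} (A : Matrix n) z → charPoly A z ≈ 0# →
                ∃[ v ] NonZeroVector v × (∀ j → (A · v) j ≈ z * v j)
  eigenvector {n} A z det≈0 with kernel (λ i j → scalar z i j + - A i j) det≈0
  ... | v , v≉0 , Mv≈0 = v , v≉0 , λ j → sym (x∙y⁻¹≈ε⇒x≈y (z * v j) ((A · v) j) (begin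
    z * v j - (A · v) j
      ≈⟨ solve 2 (λ x y → x :- y := (:- con 1ℤ) :* y :+ x) refl (z * v j) ((A · v) j) ⟩
    - 1# * (A · v) j + z * v j
      ≈⟨ +-congˡ (sum-scalar z v j) ⟨
    - 1# * (A · v) j + sum (λ l → scalar z j l * v l)
      ≈⟨ sum-linear {n} (- 1#) (λ l → A j l * v l) (λ l → scalar z j l * v l) ⟨
    sum (λ l → - 1# * (A j l * v l) + scalar z j l * v l)
      ≈⟨ sum-cong-≋ {n} (λ l → solve 3 (λ a s v → (:- con 1ℤ) :* (a :* v) :+ s :* v := (s :+ :- a) :* v) refl (A j l) (scalar z j l) (v l)) ⟩
    sum (λ l → (scalar z j l + - A j l) * v l)
      ≈⟨ Mv≈0 j ⟩
    0# ∎))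

  module _ {n} {A : Matrix n} {z : Vector Carrier n} (A-hermitian : Hermitian A) (z-eigenvalues : HasEigenvalues A z)
    (z-real : ∀ i → conj (z i) ≈ z i) (z-distinct : ∀ {i j} → i ≢ j → z i ≉ z j) where

    private

      eigenvectors : ∀ i → ∃[ v ] NonZeroVector v × (∀ j → (A · v) j ≈ z i * v j)
      eigenvectors i = eigenvector A (z i)
        (trans (z-eigenvalues (z i)) (product-zero (λ j → z i + - z j) i (-‿inverseʳ (z i))))

      v : Fin n → Vector Carrier n
      v i = let u , _ = eigenvectors i in u

      v-eigen : ∀ i j → (A · v i) j ≈ z i * v i j
      v-eigen i = let _ , _ , e = eigenvectors i in e

      v-norm≉0 : ∀ i → ⟨ v i ∣ v i ⟩ ≉ 0#
      v-norm≉0 i eq = let _ , (l , vl≉0) , _ = eigenvectors i in vl≉0 (definite (v i) eq l)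

      -- `A` may act on either argument: on the left it gives the conjugate of z_i, which is z_i,
      -- and on the right z_j. The difference z_i - z_j can be cancelled.
      v-orthogonal : ∀ {i j} → i ≢ j → ⟨ v i ∣ v j ⟩ ≈ 0#
      v-orthogonal {i} {j} i≢j = *-cancel-0 (λ eq → z-distinct i≢j (x∙y⁻¹≈ε⇒x≈y (z i) (z j) eq)) (begin
        (z i - z j) * ⟨ v i ∣ v j ⟩
          ≈⟨ solve 3 (λ x y p → (x :- y) :* p := x :* p :- y :* p) refl (z i) (z j) ⟨ v i ∣ v j ⟩ ⟩
        z i * ⟨ v i ∣ v j ⟩ - z j * ⟨ v i ∣ v j ⟩
          ≈⟨ +-congʳ (*-congʳ (z-real i)) ⟨
        conj (z i) * ⟨ v i ∣ v j ⟩ - z j * ⟨ v i ∣ v j ⟩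
          ≈⟨ +-cong (ip-scaleˡ (z i) (v i) (v j)) (-‿cong (ip-scaleʳ (z j) (v i) (v j))) ⟨
        ⟨ (λ l → z i * v i l) ∣ v j ⟩ - ⟨ v i ∣ (λ l → z j * v j l) ⟩
          ≈⟨ +-cong (ip-cong (v-eigen i) (λ _ → refl)) (-‿cong (ip-cong (λ _ → refl) (v-eigen j))) ⟨
        ⟨ A · v i ∣ v j ⟩ - ⟨ v i ∣ A · v j ⟩
          ≈⟨ +-congˡ (-‿cong (hermitian⇒self-adjoint A-hermitian (v i) (v j))) ⟩
        ⟨ A · v i ∣ v j ⟩ - ⟨ A · v i ∣ v j ⟩
          ≈⟨ -‿inverseʳ _ ⟩
        0# ∎)

      independent : ∀ (c : Vector Carrier n) → (∀ j → sum (λ i → c i * v i j) ≈ 0#) → ∀ i → c i ≈ 0#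
      independent c cv≈0 i = *-cancel-0 (v-norm≉0 i) (begin
        ⟨ v i ∣ v i ⟩ * c i
          ≈⟨ *-comm _ _ ⟩
        c i * ⟨ v i ∣ v i ⟩
          ≈⟨ sum-single {n} i _ (λ l l≢i → trans (*-congˡ (v-orthogonal (l≢i ∘ ≡.sym))) (zeroʳ (c l))) ⟨
        (sum λ l → c l * ⟨ v i ∣ v l ⟩)
          ≈⟨ sum-cong-≋ {n} (λ l → ip-scaleʳ (c l) (v i) (v l)) ⟨
        (sum λ l → ⟨ v i ∣ (λ j → c l * v l j) ⟩)
          ≈⟨ ip-sumʳ (v i) (λ l j → c l * v l j) ⟨
        ⟨ v i ∣ (λ j → sum λ l → c l * v l j) ⟩
          ≈⟨ sum-zero {n} (λ j → trans (*-congˡ (cv≈0 j)) (zeroʳ _)) ⟩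
        0# ∎)

    -- `ξ` and the n eigenvectors are n + 1 vectors in dimension n, hence dependent. The coefficient
    -- of `ξ` is not zero, since the eigenvectors are independent, and the relation is solved for
    -- `ξ`.
    eigenDecomposition : ∀ ξ → EigenDecomposition A z ξ
    eigenDecomposition ξ with dependence (ξ ∷ v)
    ... | c , c≉0 , relation with c zero ≟0
    ...   | yes c₀≈0 = contradiction c≉0 λ { (zero , c₀≉0) → c₀≉0 c₀≈0 ; (suc i , ci≉0) → ci≉0 (independent (c ∘ suc) tail-relation i) }
      where
      tail-relation : ∀ j → sum (λ i → c (suc i) * v i j) ≈ 0#
      tail-relation j = begin
        sum (λ i → c (suc i) * v i j)                   ≈⟨ +-identityˡ _ ⟨
        0# + sum (λ i → c (suc i) * v i j)              ≈⟨ +-congʳ (trans (*-congʳ c₀≈0) (zeroˡ _)) ⟨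
        c zero * ξ j + sum (λ i → c (suc i) * v i j)    ≈⟨ relation j ⟩
        0#                                              ∎
    ...   | no  c₀≉0 with inverse c₀≉0
    ...     | y , c₀y≈1 = record
      { component  = λ i j → a i * v i j
      ; eigen      = λ i j → trans (·-scale A (a i) (v i) j) (trans (*-congˡ (v-eigen i j))
          (solve 3 (λ a z v → a :* (z :* v) := z :* (a :* v)) refl (a i) (z i) (v i j)))
      ; orthogonal = λ {i} {j} i≢j → trans (ip-scaleˡ (a i) (v i) _) (trans (*-congˡ
          (trans (ip-scaleʳ (a j) (v i) (v j)) (trans (*-congˡ (v-orthogonal i≢j)) (zeroʳ _)))) (zeroʳ _))
      ; decompose  = λ j → begin
          ξ j
            ≈⟨ trans (*-congʳ c₀y≈1) (*-identityˡ _) ⟨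
          c zero * y * ξ j
            ≈⟨ solve 4 (λ c y ξ s → c :* y :* ξ := y :* (c :* ξ :+ s) :+ (:- y) :* s) refl (c zero) y (ξ j) (S j) ⟩
          y * (c zero * ξ j + S j) + - y * S j
            ≈⟨ +-congʳ (trans (*-congˡ (relation j)) (zeroʳ y)) ⟩
          0# + - y * S j
            ≈⟨ +-identityˡ _ ⟩
          - y * S j
            ≈⟨ *-distribˡ-sum {n} (- y) (λ i → c (suc i) * v i j) ⟩
          sum (λ i → - y * (c (suc i) * v i j))
            ≈⟨ sum-cong-≋ {n} (λ i → sym (*-assoc _ _ _)) ⟩
          sum (λ i → a i * v i j) ∎
      }
      where
      a : Vector Carrier n
      a i = - y * c (suc i)
      S : Vector Carrier n
      S j = sum λ i → c (suc i) * v i j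

  Orthonormal : ∀ {n} → Vector (Vector Carrier n) n → Set
  Orthonormal u = ∀ i j → ⟨ u i ∣ u j ⟩ ≈ scalar 1# i j

  -- For v = η − ξ and s = ⟨v,η⟩, the equality of norms gives ⟨v,v⟩ = s + s̄.  Hence I − s⁻¹vv* is unitary, and it
  -- maps η to ξ.  Its columns form the basis.
  basis-with-coordinates : ∀ {n} (η ξ : Vector Carrier n) → ⟨ η ∣ η ⟩ ≈ ⟨ ξ ∣ ξ ⟩ →
    ∃[ u ] Orthonormal u × (∀ j → ξ j ≈ sum λ i → η i * u i j)
  basis-with-coordinates {n} η ξ norms with reflection
    where
    v : Vector Carrier n
    v j = - 1# * ξ j + η j
    s = ⟨ v ∣ η ⟩
    norm : ⟨ v ∣ v ⟩ ≈ s + conj s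
    norm = begin
      ⟨ v ∣ v ⟩
        ≈⟨ ip-linearʳ (- 1#) v ξ η ⟩
      - 1# * ⟨ v ∣ ξ ⟩ + s
        ≈⟨ solve 2 (λ p s → (:- con 1ℤ) :* p :+ s := s :+ :- p) refl ⟨ v ∣ ξ ⟩ s ⟩
      s + - ⟨ v ∣ ξ ⟩
        ≈⟨ +-congˡ (begin
          - ⟨ v ∣ ξ ⟩                                ≈⟨ -‿cong (ip-linearˡ (- 1#) ξ η ξ) ⟩
          - (conj (- 1#) * ⟨ ξ ∣ ξ ⟩ + ⟨ η ∣ ξ ⟩)    ≈⟨ -‿cong (+-congʳ (*-cong (trans (conj-neg 1#) (-‿cong conj-1)) (sym norms))) ⟩
          - (- 1# * ⟨ η ∣ η ⟩ + ⟨ η ∣ ξ ⟩)           ≈⟨ solve 2 (λ p q → :- ((:- con 1ℤ) :* p :+ q) := (:- con 1ℤ) :* q :+ p) refl ⟨ η ∣ η ⟩ ⟨ η ∣ ξ ⟩ ⟩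
          - 1# * ⟨ η ∣ ξ ⟩ + ⟨ η ∣ η ⟩               ≈⟨ ip-linearʳ (- 1#) η ξ η ⟨
          ⟨ η ∣ v ⟩                                  ≈⟨ ip-conj v η ⟨
          conj s                                     ∎) ⟩
      s + conj s ∎
    -- The equation for `c` says that I - c v v* is unitary. Stated for a general `c`, it covers the
    -- case s = 0 as well: there ⟨v,v⟩ = 0, so that η = ξ, and c = 0 gives the identity matrix.
    reflection : ∃[ v ] ∃[ c ] c + conj c ≈ c * conj c * ⟨ v ∣ v ⟩ × (∀ j → ξ j ≈ - (c * ⟨ v ∣ η ⟩ * v j) + η j)
    reflection with s ≟0
    ... | yes s≈0 = v , 0# , trans (+-congˡ conj-0) (trans (+-identityˡ 0#) (sym (trans (*-congʳ (zeroˡ _)) (zeroˡ _)))) , λ j → begin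
      ξ j                     ≈⟨ x∙y⁻¹≈ε⇒x≈y (η j) (ξ j) (trans (solve 2 (λ x y → x :- y := (:- con 1ℤ) :* y :+ x) refl (η j) (ξ j)) (definite v v≈0 j)) ⟨
      η j                     ≈⟨ solve 3 (λ s v η → η := :- (con 0ℤ :* s :* v) :+ η) refl s (v j) (η j) ⟩
      - (0# * s * v j) + η j  ∎
      where
      v≈0 : ⟨ v ∣ v ⟩ ≈ 0#
      v≈0 = trans norm (trans (+-cong s≈0 (trans (conj-cong s≈0) conj-0)) (+-identityˡ 0#))
    ... | no s≉0 with inverse s≉0
    ...   | c , sc≈1 = v , c , (begin
      c + conj c
        ≈⟨ solve 2 (λ c d → c :+ d := c :* con 1ℤ :+ d :* con 1ℤ) refl c (conj c) ⟩
      c * 1# + conj c * 1#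
        ≈⟨ +-cong (*-congˡ (trans (sym (conj-* s c)) (trans (conj-cong sc≈1) conj-1))) (*-congˡ sc≈1) ⟨
      c * (conj s * conj c) + conj c * (s * c)
        ≈⟨ solve 4 (λ c d s t → c :* (t :* d) :+ d :* (s :* c) := c :* d :* (s :+ t)) refl c (conj c) s (conj s) ⟩
      c * conj c * (s + conj s)
        ≈⟨ *-congˡ norm ⟨
      c * conj c * ⟨ v ∣ v ⟩ ∎) , λ j → begin
      ξ j                         ≈⟨ solve 2 (λ ξ η → ξ := :- (con 1ℤ :* ((:- con 1ℤ) :* ξ :+ η)) :+ η) refl (ξ j) (η j) ⟩
      - (1# * v j) + η j          ≈⟨ +-congʳ (-‿cong (*-congʳ (trans (*-comm c s) sc≈1))) ⟨
      - (c * s * v j) + η j       ∎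
  ... | v , c , c-norm , ξ≈ = u , orthonormal , coordinates
    where
    u : Vector (Vector Carrier n) n
    u i j = - (c * conj (v i)) * v j + scalar 1# i j
    orthonormal : Orthonormal u
    orthonormal i j = begin
      ⟨ u i ∣ u j ⟩
        ≈⟨ ip-linearˡ (- (c * conj (v i))) v (scalar 1# i) (u j) ⟩
      conj (- (c * conj (v i))) * ⟨ v ∣ u j ⟩ + ⟨ scalar 1# i ∣ u j ⟩
        ≈⟨ +-cong (*-cong
             (trans (conj-neg _) (-‿cong (trans (conj-* c (conj (v i))) (*-congˡ (conj-involutive (v i))))))
             (trans (ip-linearʳ (- (c * conj (v j))) v v (scalar 1# j)) (+-congˡ (ip-unitʳ j v))))
             (ip-unitˡ i (u j)) ⟩
      - (conj c * v i) * (- (c * conj (v j)) * ⟨ v ∣ v ⟩ + conj (v j)) + (- (c * conj (v j)) * v i + scalar 1# j i)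
        ≈⟨ solve 6 (λ c d x y N e → (:- (d :* x)) :* ((:- (c :* y)) :* N :+ y) :+ ((:- (c :* y)) :* x :+ e) := x :* y :* (c :* d :* N :- (c :+ d)) :+ e)
             refl c (conj c) (v i) (conj (v j)) ⟨ v ∣ v ⟩ (scalar 1# j i) ⟩
      v i * conj (v j) * (c * conj c * ⟨ v ∣ v ⟩ - (c + conj c)) + scalar 1# j i
        ≈⟨ +-cong (*-congˡ (trans (+-congˡ (-‿cong c-norm)) (-‿inverseʳ _))) (scalar-sym 1# j i) ⟩
      v i * conj (v j) * 0# + scalar 1# i j
        ≈⟨ trans (+-congʳ (zeroʳ _)) (+-identityˡ _) ⟩
      scalar 1# i j ∎
    coordinates : ∀ j → ξ j ≈ sum λ i → η i * u i j
    coordinates j = begin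
      ξ j
        ≈⟨ ξ≈ j ⟩
      - (c * ⟨ v ∣ η ⟩ * v j) + η j
        ≈⟨ +-cong (solve 3 (λ c s v → :- (c :* s :* v) := (:- (c :* v)) :* s) refl c ⟨ v ∣ η ⟩ (v j))
                  (trans (sym (*-identityˡ _)) (sym (sum-scalar 1# η j))) ⟩
      - (c * v j) * ⟨ v ∣ η ⟩ + sum (λ i → scalar 1# j i * η i)
        ≈⟨ sum-linear {n} (- (c * v j)) (λ i → conj (v i) * η i) (λ i → scalar 1# j i * η i) ⟨
      sum (λ i → - (c * v j) * (conj (v i) * η i) + scalar 1# j i * η i)
        ≈⟨ sum-cong-≋ {n} (λ i → trans (+-congˡ (*-congʳ (scalar-sym 1# j i)))
             (solve 5 (λ c x y η e → (:- (c :* y)) :* (x :* η) :+ e :* η := η :* ((:- (c :* x)) :* y :+ e)) refl c (conj (v i)) (v j) (η i) (scalar 1# i j))) ⟩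
      sum (λ i → η i * u i j) ∎

  module _ {n} {u : Vector (Vector Carrier n) n} (u-orthonormal : Orthonormal u)
    {z : Vector Carrier n} (z-real : ∀ i → conj (z i) ≈ z i) where

    spectralMatrix : Matrix n
    spectralMatrix a b = sum λ l → z l * (u l a * conj (u l b))

    spectral-hermitian : Hermitian spectralMatrix
    spectral-hermitian a b = sym (trans (conj-sum {n} _) (sum-cong-≋ {n} λ l → begin
      conj (z l * (u l b * conj (u l a)))
        ≈⟨ trans (conj-* _ _) (*-cong (z-real l) (trans (conj-* _ _) (*-congˡ (conj-involutive _)))) ⟩
      z l * (conj (u l b) * u l a)
        ≈⟨ *-congˡ (*-comm _ _) ⟩
      z l * (u l a * conj (u l b)) ∎))

    spectral-eigen : ∀ m a → (spectralMatrix · u m) a ≈ z m * u m a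
    spectral-eigen m a = begin
      (sum λ b → (sum λ l → z l * (u l a * conj (u l b))) * u m b)
        ≈⟨ sum-cong-≋ {n} (λ b → *-distribʳ-sum {n} (u m b) λ l → z l * (u l a * conj (u l b))) ⟩
      (sum λ b → sum λ l → z l * (u l a * conj (u l b)) * u m b)
        ≈⟨ ∑-comm {n} {n} (λ b l → z l * (u l a * conj (u l b)) * u m b) ⟩
      (sum λ l → sum λ b → z l * (u l a * conj (u l b)) * u m b)
        ≈⟨ sum-cong-≋ {n} (λ l → trans
             (sum-cong-≋ {n} λ b → solve 4 (λ z x y w → z :* (x :* y) :* w := z :* x :* (y :* w)) refl (z l) (u l a) (conj (u l b)) (u m b))
             (sym (*-distribˡ-sum {n} (z l * u l a) λ b → conj (u l b) * u m b))) ⟩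
      (sum λ l → z l * u l a * ⟨ u l ∣ u m ⟩)
        ≈⟨ sum-single {n} m _ (λ l l≢m → trans (*-congˡ (trans (u-orthonormal l m) (scalar-off 1# l≢m))) (zeroʳ _)) ⟩
      z m * u m a * ⟨ u m ∣ u m ⟩
        ≈⟨ trans (*-congˡ (trans (u-orthonormal m m) (scalar-diagonal 1# m))) (*-identityʳ _) ⟩
      z m * u m a ∎

    -- With the basis as the columns of V one has (wI - A)V = V(wI - diag z). Taking determinants,
    -- det V cancels; it is not zero because V*V = I.
    spectral-eigenvalues : HasEigenvalues spectralMatrix z
    spectral-eigenvalues w = *-cancelˡ det-V≉0 (begin
      det V * charPoly spectralMatrix w           ≈⟨ *-comm _ _ ⟩
      charPoly spectralMatrix w * det V           ≈⟨ det-⊗ (λ i j → scalar w i j + - spectralMatrix i j) V ⟨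
      det ((λ i j → scalar w i j + - spectralMatrix i j) ⊗ V)  ≈⟨ det-cong diagonalize ⟩
      det (V ⊗ D)                                 ≈⟨ det-⊗ V D ⟩
      det V * det D                               ≈⟨ *-congˡ (trans (det-diagonal D λ i≢j → trans (*-congˡ (scalar-off 1# i≢j)) (zeroʳ _))
                                                                   (product-cong {n} (λ i → D i i) (λ i → w + - z i) λ i → trans (*-congˡ (scalar-diagonal 1# i)) (*-identityʳ _))) ⟩
      det V * product (λ i → w + - z i)           ∎)
      where
      V : Matrix n
      V a l = u l a
      D : Matrix n
      D l m = (w + - z l) * scalar 1# l m
      det-V≉0 : det V ≉ 0#
      det-V≉0 det≈0 = 0≉1 (begin
        0#                                ≈⟨ zeroʳ _ ⟨
        det (λ i a → conj (u i a)) * 0#   ≈⟨ *-congˡ det≈0 ⟨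
        det (λ i a → conj (u i a)) * det V ≈⟨ det-⊗ (λ i a → conj (u i a)) V ⟨
        det ((λ i a → conj (u i a)) ⊗ V)  ≈⟨ det-cong u-orthonormal ⟩
        det (scalar {n} 1#)               ≈⟨ det-1 {n} ⟩
        1#                                ∎)
      diagonalize : ∀ a → ((λ i j → scalar w i j + - spectralMatrix i j) ⊗ V) a ≋ (V ⊗ D) a
      diagonalize a m = begin
        (sum λ b → (scalar w a b + - spectralMatrix a b) * u m b)
          ≈⟨ sum-cong-≋ {n} (λ b → solve 3 (λ s x y → (s :+ :- x) :* y := (:- con 1ℤ) :* (x :* y) :+ s :* y) refl (scalar w a b) (spectralMatrix a b) (u m b)) ⟩
        (sum λ b → - 1# * (spectralMatrix a b * u m b) + scalar w a b * u m b)
          ≈⟨ sum-linear {n} (- 1#) (λ b → spectralMatrix a b * u m b) (λ b → scalar w a b * u m b) ⟩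
        - 1# * (spectralMatrix · u m) a + (sum λ b → scalar w a b * u m b)
          ≈⟨ +-cong (*-congˡ (spectral-eigen m a)) (sum-scalar w (u m) a) ⟩
        - 1# * (z m * u m a) + w * u m a
          ≈⟨ solve 3 (λ z w x → (:- con 1ℤ) :* (z :* x) :+ w :* x := x :* ((w :+ :- z) :* con 1ℤ)) refl (z m) w (u m a) ⟩
        u m a * ((w + - z m) * 1#)
          ≈⟨ *-congˡ (*-congˡ (scalar-diagonal 1# m)) ⟨
        u m a * D m m
          ≈⟨ sum-single {n} m _ (λ l l≢m → trans (*-congˡ (trans (*-congˡ (scalar-off 1# l≢m)) (zeroʳ _))) (zeroʳ _)) ⟨
        (sum λ l → u l a * D l m) ∎

    spectral-decomposition : ∀ {η ξ : Vector Carrier n} → (∀ j → ξ j ≈ sum λ i → η i * u i j) →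
                             EigenDecomposition spectralMatrix z ξ
    spectral-decomposition {η} ξ≈ = record
      { component  = λ i j → η i * u i j
      ; eigen      = λ i j → trans (·-scale spectralMatrix (η i) (u i) j) (trans (*-congˡ (spectral-eigen i j))
          (solve 3 (λ a z v → a :* (z :* v) := z :* (a :* v)) refl (η i) (z i) (u i j)))
      ; orthogonal = λ {i} {j} i≢j → trans (ip-scaleˡ (η i) (u i) _) (trans (*-congˡ
          (trans (ip-scaleʳ (η j) (u i) (u j)) (trans (*-congˡ (trans (u-orthonormal i j) (scalar-off 1# i≢j))) (zeroʳ _)))) (zeroʳ _))
      ; decompose  = ξ≈
      }

    spectral-weight : ∀ a i → ⟨ (λ j → a * u i j) ∣ (λ j → a * u i j) ⟩ ≈ conj a * a
    spectral-weight a i = trans (ip-scaleˡ a (u i) _) (*-congˡ (trans (ip-scaleʳ a (u i) (u i))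
      (trans (*-congˡ (trans (u-orthonormal i i) (scalar-diagonal 1# i))) (*-identityʳ a))))

-- Order and square roots in a complete ordered field

module Reals (em : ExcludedMiddle (lsuc 0ℓ)) (F : CompleteOrderedField) where

  open Analysis em F hiding (zero)
  open IsTotalOrder isTotalOrder public using () renaming
    (refl to ≤-refl; reflexive to ≤-reflexive; trans to ≤-trans; antisym to ≤-antisym; total to ≤-total)
  open Algebra.Properties.Ring ring public using (-‿involutive; -0#≈0#; x∙y⁻¹≈ε⇒x≈y; x≈y⇒x∙y⁻¹≈ε)
  open Algebra.Properties.Semiring.Sum semiring public
    using (sum-cong-≋; *-distribˡ-sum; ∑-distrib-+; sum-replicate-zero)
  open RingSolver commutativeRing public
  open Relation.Binary.Reasoning.Setoid setoid

  ≤-respˡ : ∀ {x y z} → x ≈ y → x ≤ z → y ≤ z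
  ≤-respˡ x≈y = ≤-trans (≤-reflexive (sym x≈y))

  ≤-respʳ : ∀ {x y z} → x ≈ y → z ≤ x → z ≤ y
  ≤-respʳ x≈y z≤x = ≤-trans z≤x (≤-reflexive x≈y)

  <-resp : ∀ {x y x′ y′} → x ≈ x′ → y ≈ y′ → x < y → x′ < y′
  <-resp x≈x′ y≈y′ (x≤y , x≉y) =
    ≤-respˡ x≈x′ (≤-respʳ y≈y′ x≤y) , λ x′≈y′ → x≉y (trans x≈x′ (trans x′≈y′ (sym y≈y′)))

  ≰⇒> : ∀ {x y} → ¬ (x ≤ y) → y < x
  ≰⇒> {x} {y} x≰y with ≤-total x y
  ... | inj₁ x≤y = contradiction x≤y x≰y
  ... | inj₂ y≤x = y≤x , λ y≈x → x≰y (≤-reflexive (sym y≈x))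

  <⇒≱ : ∀ {x y} → x < y → ¬ (y ≤ x)
  <⇒≱ (x≤y , x≉y) y≤x = x≉y (≤-antisym x≤y y≤x)

  ≮⇒≥ : ∀ {x y} → ¬ (x < y) → y ≤ x
  ≮⇒≥ {x} {y} x≮y with decide (y ≤ x)
  ... | yes y≤x = y≤x
  ... | no  y≰x = contradiction (≰⇒> y≰x) x≮y

  ≤-<-trans : ∀ {x y z} → x ≤ y → y < z → x < z
  ≤-<-trans x≤y (y≤z , y≉z) = ≤-trans x≤y y≤z , λ x≈z → y≉z (≤-antisym y≤z (≤-respˡ x≈z x≤y))

  <-≤-trans : ∀ {x y z} → x < y → y ≤ z → x < z
  <-≤-trans (x≤y , x≉y) y≤z = ≤-trans x≤y y≤z , λ x≈z → x≉y (≤-antisym x≤y (≤-respʳ (sym x≈z) y≤z))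

  +-mono-≤ : ∀ {x y u v} → x ≤ y → u ≤ v → x + u ≤ y + v
  +-mono-≤ {x} {y} {u} {v} x≤y u≤v =
    ≤-trans (+-monoʳ-≤ x u≤v) (≤-respˡ (+-comm v x) (≤-respʳ (+-comm v y) (+-monoʳ-≤ v x≤y)))

  +-nonneg : ∀ {x y} → 0# ≤ x → 0# ≤ y → 0# ≤ x + y
  +-nonneg 0≤x 0≤y = ≤-respˡ (+-identityˡ 0#) (+-mono-≤ 0≤x 0≤y)

  difference-nonneg : ∀ {x y} → x ≤ y → 0# ≤ y - x
  difference-nonneg {x} {y} x≤y =
    ≤-respˡ (-‿inverseˡ x) (≤-respʳ (+-comm (- x) y) (+-monoʳ-≤ (- x) x≤y))

  ≤-by : ∀ {x y e} → 0# ≤ e → e ≈ y - x → x ≤ y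
  ≤-by {x} {y} {e} 0≤e e≈y-x = ≤-respˡ (+-identityʳ x)
    (≤-respʳ (trans (+-congˡ e≈y-x) (solve 2 (λ x y → x :+ (y :- x) := y) refl x y)) (+-monoʳ-≤ x 0≤e))

  difference-pos : ∀ {x y} → x < y → 0# < y - x
  difference-pos {x} {y} (x≤y , x≉y) =
    difference-nonneg x≤y , λ 0≈ → x≉y (sym (x∙y⁻¹≈ε⇒x≈y y x (sym 0≈)))

  <-by : ∀ {x y e} → 0# < e → e ≈ y - x → x < y
  <-by {x} {y} (0≤e , 0≉e) e≈ =
    ≤-by 0≤e e≈ , λ x≈y → 0≉e (sym (trans e≈ (x≈y⇒x∙y⁻¹≈ε (sym x≈y))))

  +-pos-nonneg : ∀ {x y} → 0# < x → 0# ≤ y → 0# < x + y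
  +-pos-nonneg {x} 0<x 0≤y = <-≤-trans 0<x (≤-respˡ (+-identityʳ x) (+-monoʳ-≤ x 0≤y))

  +-pos : ∀ {x y} → 0# < x → 0# < y → 0# < x + y
  +-pos 0<x (0≤y , _) = +-pos-nonneg 0<x 0≤y

  neg-nonneg : ∀ {x} → x ≤ 0# → 0# ≤ - x
  neg-nonneg {x} x≤0 = ≤-respʳ (+-identityˡ (- x)) (difference-nonneg x≤0)

  square-nonneg : ∀ x → 0# ≤ x * x
  square-nonneg x with ≤-total 0# x
  ... | inj₁ 0≤x = *-nonneg 0≤x 0≤x
  ... | inj₂ x≤0 = ≤-respʳ (solve 1 (λ x → :- x :* :- x := x :* x) refl x) (*-nonneg (neg-nonneg x≤0) (neg-nonneg x≤0))

  0<1 : 0# < 1#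
  0<1 = ≤-respʳ (*-identityˡ 1#) (square-nonneg 1#) , 0≉1

  *-cancel-0 : ∀ {x y} → x ≉ 0# → x * y ≈ 0# → y ≈ 0#
  *-cancel-0 {x} {y} x≉0 xy≈0 with inverse x≉0
  ... | z , xz≈1 = begin
    y            ≈⟨ *-identityˡ y ⟨
    1# * y       ≈⟨ *-congʳ xz≈1 ⟨
    x * z * y    ≈⟨ solve 3 (λ x y z → x :* z :* y := z :* (x :* y)) refl x y z ⟩
    z * (x * y)  ≈⟨ *-congˡ xy≈0 ⟩
    z * 0#       ≈⟨ zeroʳ z ⟩
    0#           ∎

  *-pos : ∀ {x y} → 0# < x → 0# < y → 0# < x * y
  *-pos (0≤x , 0≉x) (0≤y , 0≉y) =
    *-nonneg 0≤x 0≤y , λ 0≈xy → 0≉y (sym (*-cancel-0 (0≉x ∘ sym) (sym 0≈xy)))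

  *-monoˡ-≤ : ∀ {x y z} → 0# ≤ z → x ≤ y → z * x ≤ z * y
  *-monoˡ-≤ {x} {y} {z} 0≤z x≤y =
    ≤-by (*-nonneg 0≤z (difference-nonneg x≤y)) (solve 3 (λ x y z → z :* (y :- x) := z :* y :- z :* x) refl x y z)

  opaque

    inverse-pos : ∀ {x} → 0# < x → ∃[ y ] 0# < y × x * y ≈ 1#
    inverse-pos {x} 0<x@(0≤x , 0≉x) with inverse (0≉x ∘ sym)
    ... | y , xy≈1 = y , ≰⇒> (λ y≤0 → <⇒≱ 0<1
        (≤-by (*-nonneg 0≤x (neg-nonneg y≤0)) (trans (solve 2 (λ x y → x :* :- y := con 0ℤ :- x :* y) refl x y) (+-congˡ (-‿cong xy≈1)))))
      , xy≈1

  opaque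

    halve : ∀ {ε} → 0# < ε → ∃[ h ] 0# < h × h + h ≈ ε
    halve {ε} 0<ε with inverse-pos (+-pos 0<1 0<1)
    ... | z , 0<z , 2z≈1 = ε * z , *-pos 0<ε 0<z , (begin
      ε * z + ε * z          ≈⟨ solve 2 (λ ε z → ε :* z :+ ε :* z := ε :* ((con 1ℤ :+ con 1ℤ) :* z)) refl ε z ⟩
      ε * ((1# + 1#) * z)    ≈⟨ *-congˡ 2z≈1 ⟩
      ε * 1#                 ≈⟨ *-identityʳ ε ⟩
      ε                      ∎)

  opaque

    square-cancel-≤ : ∀ {x y} → 0# ≤ y → x * x ≤ y * y → x ≤ y
    square-cancel-≤ {x} {y} 0≤y x²≤y² with decide (x ≤ y)
    ... | yes x≤y = x≤y
    ... | no  x≰y = contradiction x²≤y² (<⇒≱ (<-by (*-pos 0<x-y (+-pos-nonneg 0<x-y (+-nonneg 0≤y 0≤y)))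
        (solve 2 (λ x y → (x :- y) :* (x :- y :+ (y :+ y)) := x :* x :- y :* y) refl x y)))
      where
      0<x-y : 0# < x - y
      0<x-y = difference-pos (≰⇒> x≰y)

  opaque

    -- Let s be the supremum.  If s² > a, the Newton iterate (s² + a)/2s is a smaller upper bound; if s² < a, then
    -- 2as/(s² + a) is a larger element of the set.
    sqrt : ∀ {a} → 0# ≤ a → ∃[ s ] s * s ≈ a
    sqrt {a} 0≤a with decide (a ≈ 0#)
    ... | yes a≈0 = 0# , trans (zeroˡ 0#) (sym a≈0)
    ... | no  a≉0 with complete (λ x → x * x ≤ a) (0# , ≤-respˡ (sym (zeroˡ 0#)) 0≤a) (1# + a , bound)
      where
      bound : ∀ {x} → x * x ≤ a → x ≤ 1# + a
      bound x²≤a = square-cancel-≤ (+-nonneg (proj₁ 0<1) 0≤a)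
        (≤-trans x²≤a (≤-by (+-nonneg (+-nonneg (proj₁ 0<1) 0≤a) (square-nonneg a))
          (solve 1 (λ a → con 1ℤ :+ a :+ a :* a := (con 1ℤ :+ a) :* (con 1ℤ :+ a) :- a) refl a)))
    ...   | s , upper , least = s , ≤-antisym s²≤a a≤s²
      where
      0<a : 0# < a
      0<a = 0≤a , a≉0 ∘ sym
      0<s : 0# < s
      -- A positive element of the set is a/(1 + a), whose square is at most a because a ≤ (1 + a)².
      0<s with inverse-pos (+-pos 0<1 0<a)
      ... | z , 0<z , [1+a]z≈1 = <-≤-trans (*-pos 0<a 0<z) (upper (≤-by (*-nonneg 0≤a (*-nonneg (+-nonneg (proj₁ 0<1) (+-nonneg 0≤a (square-nonneg a))) (square-nonneg z))) (begin
        a * ((1# + (a + a * a)) * (z * z))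
          ≈⟨ solve 2 (λ a z → a :* ((con 1ℤ :+ (a :+ a :* a)) :* (z :* z)) := a :* (((con 1ℤ :+ a) :* z) :* ((con 1ℤ :+ a) :* z)) :- (a :* z) :* (a :* z)) refl a z ⟩
        a * (((1# + a) * z) * ((1# + a) * z)) - (a * z) * (a * z)
          ≈⟨ +-congʳ (*-congˡ (*-cong [1+a]z≈1 [1+a]z≈1)) ⟩
        a * (1# * 1#) - (a * z) * (a * z)
          ≈⟨ +-congʳ (trans (*-congˡ (*-identityˡ 1#)) (*-identityʳ a)) ⟩
        a - (a * z) * (a * z) ∎)))
      s²≤a : s * s ≤ a
      s²≤a = ≮⇒≥ λ a<s² → let
          z , 0<z , sz≈1 = inverse-pos (+-pos 0<s 0<s)
          -- As z = 1/2s, this is the Newton correction; the square of s - d exceeds a by exactly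
          -- d².
          d = (s * s - a) * z
          0<d = *-pos (difference-pos a<s²) 0<z
        in <⇒≱ (<-by 0<d (solve 2 (λ s d → d := s :- (s :- d)) refl s d))
          (least λ {x} x²≤a → square-cancel-≤
            (≤-by (*-nonneg (+-nonneg (square-nonneg s) 0≤a) (proj₁ 0<z)) (begin
              (s * s + a) * z
                ≈⟨ solve 3 (λ s a z → (s :* s :+ a) :* z := (s :* ((s :+ s) :* z) :- (s :* s :- a) :* z) :- con 0ℤ) refl s a z ⟩
              (s * ((s + s) * z) - d) - 0#
                ≈⟨ +-congʳ (+-congʳ (trans (*-congˡ sz≈1) (*-identityʳ s))) ⟩
              (s - d) - 0# ∎))
            (≤-trans x²≤a (≤-by (square-nonneg d) (begin
              d * d
                ≈⟨ solve 4 (λ s a z d → d :* d := (s :- d) :* (s :- d) :- (s :* s :- (s :+ s) :* d)) refl s a z d ⟩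
              (s - d) * (s - d) - (s * s - (s + s) * ((s * s - a) * z))
                ≈⟨ +-congˡ (-‿cong (+-congˡ (-‿cong (trans (solve 3 (λ s a z → (s :+ s) :* ((s :* s :- a) :* z) := (s :* s :- a) :* ((s :+ s) :* z)) refl s a z) (trans (*-congˡ sz≈1) (*-identityʳ _)))))) ⟩
              (s - d) * (s - d) - (s * s - (s * s - a))
                ≈⟨ solve 3 (λ s a d → (s :- d) :* (s :- d) :- (s :* s :- (s :* s :- a)) := (s :- d) :* (s :- d) :- a) refl s a d ⟩
              (s - d) * (s - d) - a ∎))))
      a≤s² : a ≤ s * s
      a≤s² = ≮⇒≥ λ s²<a → let
          z , 0<z , dz≈1 = inverse-pos (+-pos-nonneg 0<a (square-nonneg s))
          -- As z = 1/(a + s²), the number s + sw is 2as/(s² + a), that is, a divided by the Newton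
          -- iterate. Its square falls short of a by exactly aw².
          w = (a - s * s) * z
          0<w = *-pos (difference-pos s²<a) 0<z
        in <⇒≱ (<-by (*-pos 0<s 0<w) (solve 2 (λ s w → s :* w := (s :+ s :* w) :- s) refl s w))
          (upper (≤-by (*-nonneg 0≤a (square-nonneg w)) (begin
            a * (w * w)
              ≈⟨ solve 4 (λ a s w z → a :* (w :* w) := a :* (((a :+ s :* s) :* z) :* ((a :+ s :* s) :* z)) :- (s :* ((a :+ s :* s) :* z :+ (a :- s :* s) :* z)) :* (s :* ((a :+ s :* s) :* z :+ (a :- s :* s) :* z)) :+ (a :* (w :* w) :- a :* (((a :- s :* s) :* z) :* ((a :- s :* s) :* z)))) refl a s w z ⟩
            a * (((a + s * s) * z) * ((a + s * s) * z)) - (s * ((a + s * s) * z + w)) * (s * ((a + s * s) * z + w)) + (a * (w * w) - a * (w * w))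
              ≈⟨ +-cong (+-cong (*-congˡ (*-cong dz≈1 dz≈1)) (-‿cong (*-cong (*-congˡ (+-congʳ dz≈1)) (*-congˡ (+-congʳ dz≈1))))) (-‿inverseʳ _) ⟩
            a * (1# * 1#) - (s * (1# + w)) * (s * (1# + w)) + 0#
              ≈⟨ solve 3 (λ a s w → a :* (con 1ℤ :* con 1ℤ) :- (s :* (con 1ℤ :+ w)) :* (s :* (con 1ℤ :+ w)) :+ con 0ℤ := a :- (s :+ s :* w) :* (s :+ s :* w)) refl a s w ⟩
            a - (s + s * w) * (s + s * w) ∎)))

-- Convergent series

module Series (em : ExcludedMiddle (lsuc 0ℓ)) (F : CompleteOrderedField) where

  open Analysis em F hiding (zero)
  open Reals em F
  open Relation.Binary.Reasoning.Setoid setoid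

  sum-nonneg : ∀ {n} (f : Vector ℝ n) → (∀ i → 0# ≤ f i) → 0# ≤ sum f
  sum-nonneg {zero}  f 0≤f = ≤-refl
  sum-nonneg {suc n} f 0≤f = +-nonneg (0≤f zero) (sum-nonneg (f ∘ suc) (0≤f ∘ suc))

  sum-mono : ∀ {n} (f g : Vector ℝ n) → (∀ i → f i ≤ g i) → sum f ≤ sum g
  sum-mono {zero}  f g f≤g = ≤-refl
  sum-mono {suc n} f g f≤g = +-mono-≤ (f≤g zero) (sum-mono (f ∘ suc) (g ∘ suc) (f≤g ∘ suc))

  term≤sum : ∀ {n} (f : Vector ℝ n) → (∀ i → 0# ≤ f i) → ∀ i → f i ≤ sum f
  term≤sum f 0≤f zero    = ≤-respˡ (+-identityʳ _) (+-monoʳ-≤ (f zero) (sum-nonneg (f ∘ suc) (0≤f ∘ suc)))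
  term≤sum f 0≤f (suc i) = ≤-respˡ (+-identityˡ _) (+-mono-≤ (0≤f zero) (term≤sum (f ∘ suc) (0≤f ∘ suc) i))

  partial : (ℕ → ℝ) → ℕ → ℝ
  partial a m = sum {m} λ i → a (toℕ i)

  partial-mono : ∀ {a} → (∀ k → 0# ≤ a k) → ∀ {m n} → m ℕ.≤ n → partial a m ≤ partial a n
  partial-mono     0≤a (z≤n {n}) = sum-nonneg {n} _ λ i → 0≤a (toℕ i)
  partial-mono {a} 0≤a (s≤s m≤n) = +-monoʳ-≤ (a 0) (partial-mono (0≤a ∘ suc) m≤n)

  partial-cong : ∀ {a b} → (∀ k → a k ≈ b k) → ∀ m → partial a m ≈ partial b m
  partial-cong a≈b m = sum-cong-≋ {m} λ i → a≈b (toℕ i)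

  Within : ℝ → ℝ → ℝ → Set
  Within ε x y = x - ε < y × y < x + ε

  within-resp : ∀ {ε ε′ x x′ y y′} → ε ≈ ε′ → x ≈ x′ → y ≈ y′ → Within ε x y → Within ε′ x′ y′
  within-resp ε≈ x≈ y≈ (lo , hi) =
    <-resp (+-cong x≈ (-‿cong ε≈)) y≈ lo , <-resp y≈ (+-cong x≈ ε≈) hi

  within-refl : ∀ {ε x} → 0# < ε → Within ε x x
  within-refl {ε} {x} 0<ε =
    <-by 0<ε (solve 2 (λ ε x → ε := x :- (x :- ε)) refl ε x) ,
    <-by 0<ε (solve 2 (λ ε x → ε := (x :+ ε) :- x) refl ε x)

  within-+ : ∀ {ε η x y u v} → Within ε x y → Within η u v → Within (ε + η) (x + u) (y + v)
  within-+ {ε} {η} {x} {y} {u} {v} (lo , hi) (lo′ , hi′) =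
    <-by (+-pos (difference-pos lo) (difference-pos lo′))
      (solve 6 (λ ε η x y u v → (y :- (x :- ε)) :+ (v :- (u :- η)) := (y :+ v) :- (x :+ u :- (ε :+ η))) refl ε η x y u v) ,
    <-by (+-pos (difference-pos hi) (difference-pos hi′))
      (solve 6 (λ ε η x y u v → ((x :+ ε) :- y) :+ ((u :+ η) :- v) := (x :+ u :+ (ε :+ η)) :- (y :+ v)) refl ε η x y u v)

  within-* : ∀ {c ε x y} → 0# < c → Within ε x y → Within (c * ε) (c * x) (c * y)
  within-* {c} {ε} {x} {y} 0<c (lo , hi) =
    <-by (*-pos 0<c (difference-pos lo)) (solve 4 (λ c ε x y → c :* (y :- (x :- ε)) := c :* y :- (c :* x :- c :* ε)) refl c ε x y) ,
    <-by (*-pos 0<c (difference-pos hi)) (solve 4 (λ c ε x y → c :* ((x :+ ε) :- y) := (c :* x :+ c :* ε) :- c :* y) refl c ε x y)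

  within-neg : ∀ {ε x y} → Within ε x y → Within ε (- x) (- y)
  within-neg {ε} {x} {y} (lo , hi) =
    <-by (difference-pos hi) (solve 3 (λ ε x y → (x :+ ε) :- y := :- y :- (:- x :- ε)) refl ε x y) ,
    <-by (difference-pos lo) (solve 3 (λ ε x y → y :- (x :- ε) := (:- x :+ ε) :- :- y) refl ε x y)

  -- HasSum unfolds to a function type, from which a and s cannot be inferred.
  infix 4 _sumsTo_
  record _sumsTo_ (a : ℕ → ℝ) (s : ℝ) : Set where
    constructor sums
    field hasSum : HasSum a s
  open _sumsTo_ public

  hasSum-cong : ∀ {a b s t} → (∀ k → a k ≈ b k) → s ≈ t → a sumsTo s → b sumsTo t
  hasSum-cong a≈b s≈t h .hasSum 0<ε with hasSum h 0<ε
  ... | N , close = N , λ {m} N≤m → within-resp refl s≈t (partial-cong a≈b m) (close N≤m)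

  hasSum-0 : const 0# sumsTo 0#
  hasSum-0 .hasSum 0<ε = 0 , λ {m} _ → within-resp refl refl (sym (sum-replicate-zero m)) (within-refl 0<ε)

  hasSum-∷ : ∀ {a s} → a ∘ suc sumsTo s → a sumsTo a 0 + s
  hasSum-∷ {a} {s} h .hasSum {ε} 0<ε with hasSum h 0<ε
  ... | N , close = suc N , λ { (s≤s N≤m) → shift (close N≤m) }
    where
    shift : ∀ {S} → Within ε s S → Within ε (a 0 + s) (a 0 + S)
    shift {S} (lo , hi) =
      <-by (difference-pos lo) (solve 4 (λ ε a s S → S :- (s :- ε) := (a :+ S) :- (a :+ s :- ε)) refl ε (a 0) s S) ,
      <-by (difference-pos hi) (solve 4 (λ ε a s S → (s :+ ε) :- S := (a :+ s :+ ε) :- (a :+ S)) refl ε (a 0) s S)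

  hasSum-tail : ∀ {a s} → a 0 ≈ 0# → a sumsTo s → a ∘ suc sumsTo s
  hasSum-tail a0≈0 h .hasSum 0<ε with hasSum h 0<ε
  ... | N , close = N , λ N≤m →
    within-resp refl refl (trans (+-congʳ a0≈0) (+-identityˡ _)) (close (ℕₚ.m≤n⇒m≤1+n N≤m))

  hasSum-single : ∀ {a} k → (∀ j → j ≢ k → a j ≈ 0#) → a sumsTo a k
  hasSum-single zero    a≈0 = hasSum-cong (λ _ → refl) (+-identityʳ _)
    (hasSum-∷ (hasSum-cong (λ j → sym (a≈0 (suc j) λ ())) refl hasSum-0))
  hasSum-single (suc k) a≈0 = hasSum-cong (λ _ → refl) (trans (+-congʳ (a≈0 0 λ ())) (+-identityˡ _))
    (hasSum-∷ (hasSum-single k λ j j≢k → a≈0 (suc j) (j≢k ∘ ℕₚ.suc-injective)))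

  hasSum-+ : ∀ {a b s t} → a sumsTo s → b sumsTo t → (λ k → a k + b k) sumsTo s + t
  hasSum-+ ha hb .hasSum 0<ε with halve 0<ε
  ... | h , 0<h , h+h≈ε with hasSum ha 0<h | hasSum hb 0<h
  ...   | N , close | N′ , close′ = N ℕ.⊔ N′ , λ {m} N≤m →
    within-resp h+h≈ε refl (sym (∑-distrib-+ {m} _ _))
      (within-+ (close (ℕₚ.≤-trans (ℕₚ.m≤m⊔n N N′) N≤m)) (close′ (ℕₚ.≤-trans (ℕₚ.m≤n⊔m N N′) N≤m)))

  hasSum-neg : ∀ {a s} → a sumsTo s → (λ k → - a k) sumsTo - s
  hasSum-neg {a} h .hasSum 0<ε with hasSum h 0<ε
  ... | N , close = N , λ {m} N≤m → within-resp refl refl (partial-neg a m) (within-neg (close N≤m))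
    where
    partial-neg : ∀ a m → - partial a m ≈ partial (λ k → - a k) m
    partial-neg a zero    = -0#≈0#
    partial-neg a (suc m) = trans (solve 2 (λ x y → :- (x :+ y) := :- x :+ :- y) refl (a 0) _) (+-congˡ (partial-neg (a ∘ suc) m))

  hasSum-*-pos : ∀ {a s c} → 0# < c → a sumsTo s → (λ k → c * a k) sumsTo c * s
  hasSum-*-pos {a} {s} {c} 0<c h .hasSum {ε} 0<ε with inverse-pos 0<c
  ... | z , 0<z , cz≈1 with hasSum h (*-pos 0<ε 0<z)
  ...   | N , close = N , λ {m} N≤m →
    within-resp (trans (solve 3 (λ c ε z → c :* (ε :* z) := ε :* (c :* z)) refl c ε z) (trans (*-congˡ cz≈1) (*-identityʳ ε)))
      refl (*-distribˡ-sum {m} c _) (within-* 0<c (close N≤m))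

  -- Scaling by `c` turns an error bound into an error bound only when `c` is positive; a negative
  -- factor is split into negation and a positive one.
  hasSum-* : ∀ {a s} c → a sumsTo s → (λ k → c * a k) sumsTo c * s
  hasSum-* {a} {s} c h with decide (0# < c) | decide (c ≈ 0#)
  ... | yes 0<c | _       = hasSum-*-pos 0<c h
  ... | no  c≤0 | yes c≈0 =
    hasSum-cong (λ k → sym (trans (*-congʳ c≈0) (zeroˡ _))) (sym (trans (*-congʳ c≈0) (zeroˡ _))) hasSum-0
  ... | no  c≤0 | no  c≉0 =
    hasSum-cong (λ k → neg-neg (a k)) (neg-neg s) (hasSum-neg (hasSum-*-pos 0<-c h))
    where
    0<-c : 0# < - c
    0<-c = neg-nonneg (≮⇒≥ c≤0) , λ 0≈-c → c≉0 (trans (sym (-‿involutive c)) (trans (-‿cong (sym 0≈-c)) -0#≈0#))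
    neg-neg : ∀ x → - (- c * x) ≈ c * x
    neg-neg x = solve 2 (λ c x → :- (:- c :* x) := c :* x) refl c x

  hasSum-- : ∀ {a b s t} → a sumsTo s → b sumsTo t → (λ k → a k - b k) sumsTo s - t
  hasSum-- ha hb = hasSum-+ ha (hasSum-neg hb)

  hasSum-sum : ∀ {n} (a : Fin n → ℕ → ℝ) (s : Vector ℝ n) → (∀ i → a i sumsTo s i) →
               (λ k → sum λ i → a i k) sumsTo sum s
  hasSum-sum {zero}  a s h = hasSum-0
  hasSum-sum {suc n} a s h = hasSum-+ (h zero) (hasSum-sum (a ∘ suc) (s ∘ suc) (h ∘ suc))

  hasSum-≤ : ∀ {a b s t} → (∀ k → a k ≤ b k) → a sumsTo s → b sumsTo t → s ≤ t
  hasSum-≤ {a} {b} {s} {t} a≤b ha hb = ≮⇒≥ λ t<s → impossible t<s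
    where
    impossible : ¬ (t < s)
    impossible t<s with halve (difference-pos t<s)
    ... | h , 0<h , h+h≈s-t with hasSum ha 0<h | hasSum hb 0<h
    ...   | N , close | N′ , close′ =
      <⇒≱ (proj₁ (close (ℕₚ.m≤m⊔n N N′)))
        (≤-trans (sum-mono {N ℕ.⊔ N′} _ _ λ i → a≤b (toℕ i))
        (≤-trans (proj₁ (proj₂ (close′ (ℕₚ.m≤n⊔m N N′)))) (≤-reflexive (begin
          t + h               ≈⟨ solve 3 (λ s t h → t :+ h := s :- (s :- t) :+ h) refl s t h ⟩
          s - (s - t) + h     ≈⟨ +-congʳ (+-congˡ (-‿cong h+h≈s-t)) ⟨
          s - (h + h) + h     ≈⟨ solve 2 (λ s h → s :- (h :+ h) :+ h := s :- h) refl s h ⟩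
          s - h               ∎))))

  hasSum-unique : ∀ {a s t} → a sumsTo s → a sumsTo t → s ≈ t
  hasSum-unique ha ha′ = ≤-antisym (hasSum-≤ (λ _ → ≤-refl) ha ha′) (hasSum-≤ (λ _ → ≤-refl) ha′ ha)

  -- Makes a partial sum the value of a series, so that comparison of series also bounds partial
  -- sums by the full sum.
  truncate : ℕ → (ℕ → ℝ) → ℕ → ℝ
  truncate zero    a k       = 0#
  truncate (suc m) a zero    = a zero
  truncate (suc m) a (suc k) = truncate m (a ∘ suc) k

  hasSum-truncate : ∀ m a → truncate m a sumsTo partial a m
  hasSum-truncate zero    a = hasSum-0
  hasSum-truncate (suc m) a = hasSum-∷ (hasSum-truncate m (a ∘ suc))

  truncate≤ : ∀ m {a} → (∀ k → 0# ≤ a k) → ∀ k → truncate m a k ≤ a k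
  truncate≤ zero    0≤a k       = 0≤a k
  truncate≤ (suc m) 0≤a zero    = ≤-refl
  truncate≤ (suc m) 0≤a (suc k) = truncate≤ m (0≤a ∘ suc) k

  partial≤ : ∀ {a s} → (∀ k → 0# ≤ a k) → a sumsTo s → ∀ m → partial a m ≤ s
  partial≤ {a} 0≤a h m = hasSum-≤ (truncate≤ m 0≤a) (hasSum-truncate m a) h

  hasSum-term≤ : ∀ {a s} → (∀ k → 0# ≤ a k) → a sumsTo s → ∀ k → a k ≤ s
  hasSum-term≤ {a} 0≤a h k =
    ≤-trans (term≤partial 0≤a k) (partial≤ 0≤a h (suc k))
    where
    term≤partial : ∀ {a} → (∀ k → 0# ≤ a k) → ∀ k → a k ≤ partial a (suc k)
    term≤partial {a} 0≤a zero    = ≤-reflexive (sym (+-identityʳ (a 0)))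
    term≤partial {a} 0≤a (suc k) =
      ≤-respˡ (+-identityˡ _) (+-mono-≤ (0≤a 0) (term≤partial (0≤a ∘ suc) k))

  hasSum-≤-bound : ∀ {a s b} → a sumsTo s → (∀ m → partial a m ≤ b) → s ≤ b
  hasSum-≤-bound {a} {s} {b} h partial≤b = ≮⇒≥ λ b<s → let
      N , close = hasSum h (difference-pos b<s)
    in <⇒≱ (proj₁ (close (ℕₚ.≤-refl {N})))
      (≤-trans (partial≤b N) (≤-reflexive (solve 2 (λ s b → b := s :- (s :- b)) refl s b)))

  -- Some partial sum exceeds s - ε, as otherwise s - ε would be a smaller upper bound; the later
  -- ones lie between it and s.
  hasSum-monotone : ∀ {a s} → (∀ k → 0# ≤ a k) → IsSupremum (λ x → ∃[ m ] x ≈ partial a m) s → a sumsTo s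
  hasSum-monotone {a} {s} 0≤a (upper , least) .hasSum {ε} 0<ε with decide (∃[ N ] s - ε < partial a N)
  ... | yes (N , s-ε<) = N , λ {m} N≤m →
    <-≤-trans s-ε< (partial-mono 0≤a N≤m) ,
    ≤-<-trans (upper (m , refl)) (<-by 0<ε (solve 2 (λ s ε → ε := (s :+ ε) :- s) refl s ε))
  ... | no  none = contradiction (least λ { (m , x≈) → ≤-respˡ (sym x≈) (≮⇒≥ λ lt → none (m , lt)) })
    (<⇒≱ (<-by 0<ε (solve 2 (λ s ε → ε := s :- (s :- ε)) refl s ε)))

  -- Finite sums of point masses become series. Past the end the default 0 means mass zero when a
  -- vector of weights is padded; for a vector of points it is an arbitrary location.
  pad : ∀ {n} → Vector ℝ n → ℕ → ℝ
  pad {zero}  v k       = 0#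
  pad {suc n} v zero    = v zero
  pad {suc n} v (suc k) = pad (tail v) k

  pad-toℕ : ∀ {n} (v : Vector ℝ n) i → pad v (toℕ i) ≈ v i
  pad-toℕ v zero    = refl
  pad-toℕ v (suc i) = pad-toℕ (tail v) i

  hasSum-pad : ∀ {n} (ω x : Vector ℝ n) (f : ℝ → ℝ) →
               (λ k → pad ω k * f (pad x k)) sumsTo (sum λ i → ω i * f (x i))
  hasSum-pad {zero}  ω x f = hasSum-cong (λ _ → sym (zeroˡ _)) refl hasSum-0
  hasSum-pad {suc n} ω x f = hasSum-∷ (hasSum-pad (tail ω) (tail x) f)

  pad-nonneg : ∀ {n} {ω : Vector ℝ n} → (∀ i → 0# ≤ ω i) → ∀ k → 0# ≤ pad ω k
  pad-nonneg {zero}  0≤ω k       = ≤-refl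
  pad-nonneg {suc n} 0≤ω zero    = 0≤ω zero
  pad-nonneg {suc n} 0≤ω (suc k) = pad-nonneg (0≤ω ∘ suc) k

-- Borel sets, Dirac sums and atomic measures

module Measures (em : ExcludedMiddle (lsuc 0ℓ)) (F : CompleteOrderedField) where

  open Analysis em F hiding (zero)
  open Reals em F
  open Series em F
  open Determinant commutativeRing using (sum-single; sum-zero)
  open Relation.Binary.Reasoning.Setoid setoid

  ¬¬-elim : ∀ {P : Set} → ¬ ¬ P → P
  ¬¬-elim {P} ¬¬p with decide P
  ... | yes p = p
  ... | no ¬p = contradiction ¬p ¬¬p

  -- A predicate may separate equal reals, but an open set contains an interval around each of its
  -- points and with it all reals equal to that point. The other constructors preserve the property.
  borel-resp-≈ : ∀ {B} → Borel B → ∀ {x y} → x ≈ y → x ∈ B → y ∈ B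
  borel-resp-≈ (isOpen G-open) x≈y x∈G with G-open x∈G
  ... | ε , 0<ε , ball = let lo , hi = within-resp refl refl x≈y (within-refl 0<ε) in ball lo hi
  borel-resp-≈ (complement borel) x≈y x∉B y∈B = x∉B (borel-resp-≈ borel (sym x≈y) y∈B)
  borel-resp-≈ (union borel) x≈y (k , x∈B) = k , borel-resp-≈ (borel k) x≈y x∈B
  borel-resp-≈ (resp (B⊆C , C⊆B) borel) x≈y x∈C = B⊆C (borel-resp-≈ borel x≈y (C⊆B x∈C))

  borel-∅ : Borel ∅
  borel-∅ = isOpen λ ()

  borel-∩ : ∀ {A B} → Borel A → Borel B → Borel (A ∩ B)
  borel-∩ {A} {B} A-borel B-borel = resp
    ( (λ x∉ → ¬¬-elim (λ x∉A → x∉ (0 , x∉A)) , ¬¬-elim (λ x∉B → x∉ (1 , x∉B)))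
    , (λ { (x∈A , x∈B) (zero , x∉A) → x∉A x∈A ; (x∈A , x∈B) (suc k , x∉B) → x∉B x∈B }))
    (complement (union {B = λ { zero → ∁ A ; (suc k) → ∁ B }} λ { zero → complement A-borel ; (suc k) → complement B-borel }))

  borel-singleton : ∀ a → Borel (_≈ a)
  borel-singleton a = resp
    ( (λ x≉≉a → ¬¬-elim x≉≉a) , (λ x≈a x≉a → x≉a x≈a) )
    (complement (isOpen {λ x → x ≉ a} open′))
    where
    open′ : IsOpen (λ x → x ≉ a)
    open′ {x} x≉a with ≤-total x a
    ... | inj₁ x≤a = a - x , difference-pos (x≤a , x≉a) , λ _ y< y≈a →
      proj₂ y< (trans y≈a (solve 2 (λ a x → a := x :+ (a :- x)) refl a x))
    ... | inj₂ a≤x = x - a , difference-pos (a≤x , x≉a ∘ sym) , λ <y _ y≈a →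
      proj₂ <y (trans (solve 2 (λ a x → x :- (x :- a) := a) refl a x) (sym y≈a))

  private

    indicator-yes : ∀ {P : Set} (d : Dec P) → P → (if does d then 1# else 0#) ≈ 1#
    indicator-yes (yes _) p = refl
    indicator-yes (no ¬p) p = contradiction p ¬p

    indicator-no : ∀ {P : Set} (d : Dec P) → ¬ P → (if does d then 1# else 0#) ≈ 0#
    indicator-no (yes p) ¬p = contradiction p ¬p
    indicator-no (no _)  ¬p = refl

  δ-∈ : ∀ {x B} → x ∈ B → δ x B ≈ 1#
  δ-∈ {x} {B} = indicator-yes (decide (x ∈ B))

  δ-∉ : ∀ {x B} → x ∉ B → δ x B ≈ 0#
  δ-∉ {x} {B} = indicator-no (decide (x ∈ B))

  δ-cases : ∀ x B → (x ∈ B × δ x B ≈ 1#) ⊎ (x ∉ B × δ x B ≈ 0#)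
  δ-cases x B = cases (decide (x ∈ B))
    where
    cases : Dec (x ∈ B) → (x ∈ B × δ x B ≈ 1#) ⊎ (x ∉ B × δ x B ≈ 0#)
    cases (yes x∈B) = inj₁ (x∈B , δ-∈ {x} {B} x∈B)
    cases (no  x∉B) = inj₂ (x∉B , δ-∉ {x} {B} x∉B)

  δ-⇔ : ∀ {x y B C} → (x ∈ B → y ∈ C) → (y ∈ C → x ∈ B) → δ x B ≈ δ y C
  δ-⇔ {x} {y} {B} {C} to from with δ-cases x B
  ... | inj₁ (x∈B , eq) = trans eq (sym (δ-∈ {y} {C} (to x∈B)))
  ... | inj₂ (x∉B , eq) = trans eq (sym (δ-∉ {y} {C} (x∉B ∘ from)))

  δ-nonneg : ∀ x B → 0# ≤ δ x B
  δ-nonneg x B with δ-cases x B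
  ... | inj₁ (_ , eq) = ≤-respʳ (sym eq) (proj₁ 0<1)
  ... | inj₂ (_ , eq) = ≤-reflexive (sym eq)

  hasSum-δ : ∀ x (B : ℕ → Pred ℝ 0ℓ) → Disjoint B → (λ k → δ x (B k)) sumsTo δ x (⋃ ℕ B)
  hasSum-δ x B disjoint = case (decide (∃[ k ] x ∈ B k))
    where
    case : Dec (∃[ k ] x ∈ B k) → (λ k → δ x (B k)) sumsTo δ x (⋃ ℕ B)
    case (yes (k , x∈Bk)) = hasSum-cong (λ _ → refl)
      (trans (δ-∈ {x} {B k} x∈Bk) (sym (δ-∈ {x} {⋃ ℕ B} (k , x∈Bk))))
      (hasSum-single k λ j j≢k → δ-∉ {x} {B j} λ x∈Bj → disjoint j≢k x (x∈Bj , x∈Bk))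
    case (no none) = hasSum-cong (λ k → sym (δ-∉ {x} {B k} λ x∈Bk → none (k , x∈Bk)))
      (sym (δ-∉ {x} {⋃ ℕ B} none)) hasSum-0

  diracMeasure : ∀ {n} (ω λs : Vector ℝ n) → IsWeights ω → ProbabilityMeasure
  diracMeasure {n} ω λs (0≤ω , ∑ω≈1) = record
    { measure    = diracSum ω λs
    ; measure-≐  = λ {B} {C} _ (B⊆C , C⊆B) → sum-cong-≋ {n} λ i → *-congˡ {ω i} (δ-⇔ {λs i} {λs i} {B} {C} B⊆C C⊆B)
    ; nonneg     = λ {B} _ → sum-nonneg {n} _ λ i → *-nonneg (0≤ω i) (δ-nonneg (λs i) B)
    ; empty      = sum-zero {n} λ i → trans (*-congˡ {ω i} (δ-∉ {λs i} {∅} λ ())) (zeroʳ _)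
    ; total      = trans (sum-cong-≋ {n} λ i → trans (*-congˡ {ω i} (δ-∈ {λs i} {U} _)) (*-identityʳ _)) ∑ω≈1
    ; σ-additive = λ B _ disjoint → hasSum (hasSum-sum (λ i k → ω i * δ (λs i) (B k)) (λ i → ω i * δ (λs i) (⋃ ℕ B))
                     λ i → hasSum-* (ω i) (hasSum-δ (λs i) B disjoint))
    }

  -- The points at which the enumeration c takes its k-th value for the first time; as c may repeat, this is
  -- a singleton or empty.
  first : (ℕ → ℝ) → ℕ → Pred ℝ 0ℓ
  first c k x = x ≈ c k × (∀ {j} → j ℕ.< k → x ≉ c j)

  first-disjoint : ∀ c → Disjoint (first c)
  first-disjoint c {i} {j} i≢j x ((x≈ci , i-first) , (x≈cj , j-first)) with ℕₚ.<-cmp i j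
  ... | tri< i<j _ _ = j-first i<j x≈ci
  ... | tri≈ _ i≡j _ = i≢j i≡j
  ... | tri> _ _ j<i = i-first j<i x≈cj

  first-exists : ∀ c k {x} → x ≈ c k → ∃[ j ] j ℕ.≤ k × x ∈ first c j
  first-exists c zero    x≈c0 = 0 , z≤n , x≈c0 , λ ()
  first-exists c (suc k) {x} x≈ck with decide (x ≈ c 0) | first-exists (c ∘ suc) k x≈ck
  ... | yes x≈c0 | _ = 0 , z≤n , x≈c0 , λ ()
  ... | no  x≉c0 | j , j≤k , x≈cj , j-first =
    suc j , s≤s j≤k , x≈cj , λ { {zero} _ → x≉c0 ; {suc i} (s≤s i<j) → j-first i<j }

  borel-first : ∀ c k → Borel (first c k)
  borel-first c k with decide (∃[ j ] j ℕ.< k × c k ≈ c j)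
  ... | yes (j , j<k , ck≈cj) = resp ((λ ()) , λ (x≈ck , k-first) → contradiction (trans x≈ck ck≈cj) (k-first j<k)) borel-∅
  ... | no  none = resp ((λ x≈ck → x≈ck , λ {j} j<k x≈cj → none (j , j<k , trans (sym x≈ck) x≈cj)) , proj₁) (borel-singleton (c k))

  countably-additive : ∀ (ν : ProbabilityMeasure) {S : ℕ → Pred ℝ 0ℓ} → (∀ k → Borel (S k)) → Disjoint S →
                       (λ k → measure ν (S k)) sumsTo measure ν (⋃ ℕ S)
  countably-additive ν {S} borel disjoint = sums (ProbabilityMeasure.σ-additive ν S borel disjoint)

  -- Only countable additivity is available, so B is written as the union of A, B minus A and
  -- infinitely many empty sets; the measure of A is then one term of a nonnegative series.
  measure-mono : ∀ (ν : ProbabilityMeasure) {A B} → Borel A → Borel B → A ⊆ B → measure ν A ≤ measure ν B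
  measure-mono ν {A} {B} A-borel B-borel A⊆B =
    ≤-respʳ (measure-≐ (union borel) (to , from))
      (hasSum-term≤ (λ k → nonneg (borel k)) (countably-additive ν borel disjoint) 0)
    where
    open ProbabilityMeasure ν hiding (measure)
    S : ℕ → Pred ℝ 0ℓ
    S zero          = A
    S (suc zero)    = B ∩ ∁ A
    S (suc (suc k)) = ∅
    borel : ∀ k → Borel (S k)
    borel zero          = A-borel
    borel (suc zero)    = borel-∩ B-borel (complement A-borel)
    borel (suc (suc k)) = borel-∅
    disjoint : Disjoint S
    disjoint {zero}        {zero}        0≢0 x _                 = 0≢0 ≡.refl
    disjoint {zero}        {suc zero}    _   x (x∈A , _ , x∉A)   = x∉A x∈A
    disjoint {suc zero}    {zero}        _   x ((_ , x∉A) , x∈A) = x∉A x∈A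
    disjoint {suc zero}    {suc zero}    1≢1 x _                 = 1≢1 ≡.refl
    to : ⋃ ℕ S ⊆ B
    to (zero , x∈A)           = A⊆B x∈A
    to (suc zero , x∈B , _)   = x∈B
    from : B ⊆ ⋃ ℕ S
    from {x} x∈B with decide (x ∈ A)
    ... | yes x∈A = 0 , x∈A
    ... | no  x∉A = 1 , x∈B , x∉A

  -- The form shared by finite Dirac sums and by discrete measures, in which integration becomes
  -- summation. Atoms may repeat; their masses then add up.
  record Atomic (ν : ProbabilityMeasure) : Set₁ where
    field
      atom        : ℕ → ℝ
      mass        : ℕ → ℝ
      mass-nonneg : ∀ k → 0# ≤ mass k
      represents  : ∀ {B} → Borel B → (λ k → mass k * δ (atom k) B) sumsTo measure ν B

  dirac⇒atomic : ∀ {n} {ω λs : Vector ℝ n} ν → IsWeights ω → measure ν ≈ₘ diracSum ω λs → Atomic ν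
  dirac⇒atomic {ω = ω} {λs} ν (0≤ω , _) ν≈ = record
    { atom        = pad λs
    ; mass        = pad ω
    ; mass-nonneg = pad-nonneg 0≤ω
    ; represents  = λ {B} B-borel → hasSum-cong (λ _ → refl) (sym (ν≈ B-borel)) (hasSum-pad ω λs λ x → δ x B)
    }

  -- Taking the mass of `first c k`, not of the point c k, counts a repeated value once. A Borel set
  -- B splits into its intersections with these sets and a rest, which is null because it avoids the
  -- enumeration and hence lies in the complement of C.
  discrete⇒atomic : ∀ ν → IsDiscrete ν → Atomic ν
  discrete⇒atomic ν (C , C-borel , (c , C⊆c) , ν∁C≈0) = record
    { atom        = c
    ; mass        = λ k → measure ν (first c k)
    ; mass-nonneg = λ k → nonneg (borel-first c k)
    ; represents  = represents
    }
    where
    open ProbabilityMeasure ν hiding (measure)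
    represents : ∀ {B} → Borel B → (λ k → measure ν (first c k) * δ (c k) B) sumsTo measure ν B
    represents {B} B-borel =
      hasSum-cong mass-at (measure-≐ (union borel) (to , from))
        (hasSum-tail rest≈0 (countably-additive ν borel disjoint))
      where
      S : ℕ → Pred ℝ 0ℓ
      S zero    = B ∩ ∁ (⋃ ℕ (first c))
      S (suc k) = B ∩ first c k
      borel : ∀ k → Borel (S k)
      borel zero    = borel-∩ B-borel (complement (union (borel-first c)))
      borel (suc k) = borel-∩ B-borel (borel-first c k)
      disjoint : Disjoint S
      disjoint {zero}  {zero}  0≢0 x _ = 0≢0 ≡.refl
      disjoint {zero}  {suc k} _   x ((_ , x∉) , (_ , x∈)) = x∉ (k , x∈)
      disjoint {suc k} {zero}  _   x ((_ , x∈) , (_ , x∉)) = x∉ (k , x∈)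
      disjoint {suc k} {suc l} k≢l x ((_ , x∈k) , (_ , x∈l)) = first-disjoint c (k≢l ∘ ≡.cong suc) x (x∈k , x∈l)
      to : ⋃ ℕ S ⊆ B
      to (zero , x∈B , _)  = x∈B
      to (suc k , x∈B , _) = x∈B
      from : B ⊆ ⋃ ℕ S
      from {x} x∈B with decide (∃[ k ] x ∈ first c k)
      ... | yes (k , x∈) = suc k , x∈B , x∈
      ... | no  none     = 0 , x∈B , none
      rest≈0 : measure ν (S 0) ≈ 0#
      rest≈0 = ≤-antisym (≤-respʳ ν∁C≈0 (measure-mono ν (borel 0) (complement C-borel) S0⊆∁C)) (nonneg (borel 0))
        where
        S0⊆∁C : S 0 ⊆ ∁ C
        S0⊆∁C (_ , x∉) x∈C = let k , x≈ck = C⊆c x∈C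
                                 j , _ , x∈j = first-exists c k x≈ck
                             in x∉ (j , x∈j)
      -- All points of `first c k` equal c k, and B respects equality; so B either contains that set
      -- or is disjoint from it.
      mass-at : ∀ k → measure ν (B ∩ first c k) ≈ measure ν (first c k) * δ (c k) B
      mass-at k with δ-cases (c k) B
      ... | inj₁ (ck∈B , eq) = trans (measure-≐ (borel (suc k)) (proj₂ , λ x∈ → borel-resp-≈ B-borel (sym (proj₁ x∈)) ck∈B , x∈))
                                     (sym (trans (*-congˡ eq) (*-identityʳ _)))
      ... | inj₂ (ck∉B , eq) = trans (measure-≐ (borel (suc k)) ((λ (x∈B , x∈) → contradiction (borel-resp-≈ B-borel (proj₁ x∈) x∈B) ck∉B) , λ ()))
                                     (trans empty (sym (trans (*-congˡ eq) (zeroʳ _))))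

-- The Lebesgue integral against an atomic measure

module Integrals (em : ExcludedMiddle (lsuc 0ℓ)) (F : CompleteOrderedField) where

  open Analysis em F hiding (zero)
  open Reals em F
  open Series em F
  open Measures em F
  open Determinant commutativeRing using (sum-single; sum-zero)
  open Algebra.Construct.NaturalChoice.Max totalOrder using (⊔-cong; x≤y⊔x; x≤y⇒x⊔y≈y; x≤y⇒y⊔x≈y)
  open Relation.Binary.Reasoning.Setoid setoid

  module NonnegIntegral (ν : ProbabilityMeasure) (ν-atomic : Atomic ν)
    (f : ℝ → ℝ) (f-cong : ∀ {x y} → x ≈ y → f x ≈ f y) (0≤f : ∀ x → 0# ≤ f x) where

    open Atomic ν-atomic

    term : ℕ → ℝ
    term k = mass k * f (atom k)

    term-nonneg : ∀ k → 0# ≤ term k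
    term-nonneg k = *-nonneg (mass-nonneg k) (0≤f (atom k))

    value : SimpleBelow f → ℝ → ℝ
    value φ x = sum λ p → height p * δ x (piece p)
      where open SimpleBelow φ

    value≤f : ∀ φ x → value φ x ≤ f x
    value≤f φ x with any? (λ p → decide (x ∈ SimpleBelow.piece φ p))
    ... | yes (p , x∈p) = ≤-respˡ (sym (begin
      value φ x               ≈⟨ sum-single {size} p _ (λ q q≢p → trans (*-congˡ (δ-∉ {x} {piece q} λ x∈q → disjoint q≢p x (x∈q , x∈p))) (zeroʳ _)) ⟩
      height p * δ x (piece p) ≈⟨ trans (*-congˡ (δ-∈ {x} {piece p} x∈p)) (*-identityʳ _) ⟩
      height p                ∎)) (below p x∈p)
      where open SimpleBelow φ
    ... | no  none = ≤-respˡ (sym (sum-zero {size} λ p → trans (*-congˡ {height p} (δ-∉ {x} {piece p} λ x∈p → none (p , x∈p))) (zeroʳ _))) (0≤f x)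
      where open SimpleBelow φ

    value-nonneg : ∀ φ x → 0# ≤ value φ x
    value-nonneg φ x = sum-nonneg {size} _ λ p → *-nonneg (nonneg p) (δ-nonneg x (piece p))
      where open SimpleBelow φ

    hasSum-simple : ∀ φ → (λ k → mass k * value φ (atom k)) sumsTo simpleIntegral ν φ
    hasSum-simple φ = hasSum-cong
      (λ k → trans (sum-cong-≋ {size} λ p → solve 3 (λ h m d → h :* (m :* d) := m :* (h :* d)) refl (height p) (mass k) (δ (atom k) (piece p)))
                   (sym (*-distribˡ-sum {size} (mass k) λ p → height p * δ (atom k) (piece p))))
      refl
      (hasSum-sum (λ p k → height p * (mass k * δ (atom k) (piece p))) (λ p → height p * measure ν (piece p))
        λ p → hasSum-* (height p) (represents (borel p)))
      where open SimpleBelow φ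

    -- The simple function that agrees with `f` on the first n atoms and is 0 elsewhere. The pieces
    -- are sets of first occurrences, since repeated atoms would violate disjointness.
    atoms-below : ℕ → SimpleBelow f
    atoms-below n = record
      { size     = n
      ; height   = λ i → f (atom (toℕ i))
      ; piece    = λ i → first atom (toℕ i)
      ; borel    = λ i → borel-first atom (toℕ i)
      ; disjoint = λ i≢j → first-disjoint atom (i≢j ∘ toℕ-injective)
      ; nonneg   = λ i → 0≤f _
      ; below    = λ i x∈ → ≤-reflexive (f-cong (sym (proj₁ x∈)))
      }

    -- Atom `k` may repeat an earlier one. The piece containing it then belongs to its first
    -- occurrence j ≤ k, which is still among the first n.
    f≤value : ∀ {n k} → k ℕ.< n → f (atom k) ≤ value (atoms-below n) (atom k)
    f≤value {n} {k} k<n with first-exists atom k refl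
    ... | j , j≤k , k∈j = ≤-trans (≤-reflexive (begin
        f (atom k)                    ≈⟨ f-cong (proj₁ k∈j) ⟩
        f (atom j)                    ≡⟨ ≡.cong (f ∘ atom) (toℕ-fromℕ< j<n) ⟨
        f (atom (toℕ p))              ≈⟨ *-identityʳ _ ⟨
        f (atom (toℕ p)) * 1#         ≈⟨ *-congˡ (δ-∈ {atom k} {first atom (toℕ p)} (≡.subst (λ i → atom k ∈ first atom i) (≡.sym (toℕ-fromℕ< j<n)) k∈j)) ⟨
        height p * δ (atom k) (piece p) ∎))
      (term≤sum _ (λ q → *-nonneg (0≤f _) (δ-nonneg (atom k) (first atom (toℕ q)))) p)
      where
      open SimpleBelow (atoms-below n)
      j<n : j ℕ.< n
      j<n = ℕₚ.≤-<-trans j≤k k<n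
      p : Fin n
      p = fromℕ< j<n

    partial≤simple : ∀ n → partial term n ≤ simpleIntegral ν (atoms-below n)
    partial≤simple n = ≤-trans
      (sum-mono {n} _ _ λ i → *-monoˡ-≤ (mass-nonneg (toℕ i)) (f≤value (toℕ<n i)))
      (partial≤ (λ k → *-nonneg (mass-nonneg k) (value-nonneg (atoms-below n) (atom k))) (hasSum-simple (atoms-below n)) n)

    simple≤ : ∀ φ {s} → term sumsTo s → simpleIntegral ν φ ≤ s
    simple≤ φ h = hasSum-≤ (λ k → *-monoˡ-≤ (mass-nonneg k) (value≤f φ (atom k))) (hasSum-simple φ) h

    -- Any simple function below `f` is dominated by `f` at every atom, which gives the upper bound.
    -- It is the least one because the functions `atoms-below n` already dominate all partial sums.
    hasSum⇒integral : ∀ {s} → term sumsTo s → HasNonnegIntegral ν f s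
    hasSum⇒integral h =
      (λ { (φ , x≈) → ≤-respˡ (sym x≈) (simple≤ φ h) }) ,
      λ upper → hasSum-≤-bound h λ n → ≤-trans (partial≤simple n) (upper (atoms-below n , refl))

    -- A finite integral bounds the partial sums, so by completeness the series has some sum. That
    -- sum is an integral as well, by the converse implication, and suprema are unique.
    integral⇒hasSum : ∀ {p} → HasNonnegIntegral ν f p → term sumsTo p
    integral⇒hasSum {p} (upper , least)
      with complete (λ x → ∃[ n ] x ≈ partial term n) (_ , 0 , refl)
             (p , λ { (n , x≈) → ≤-respˡ (sym x≈) (≤-trans (partial≤simple n) (upper (atoms-below n , refl))) })
    ... | s , s-supremum = hasSum-cong (λ _ → refl)
      (≤-antisym (proj₂ (hasSum⇒integral h) upper) (least (proj₁ (hasSum⇒integral h)))) h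
      where h = hasSum-monotone term-nonneg s-supremum

  ⊔0-nonneg : ∀ x → 0# ≤ x ⊔ 0#
  ⊔0-nonneg x = x≤y⊔x x 0#

  ⊔0-split : ∀ x → (x ⊔ 0#) - (- x ⊔ 0#) ≈ x
  ⊔0-split x = cases (≤-total 0# x)
    where
    cases : 0# ≤ x ⊎ x ≤ 0# → (x ⊔ 0#) - (- x ⊔ 0#) ≈ x
    cases (inj₁ 0≤x) = begin
      (x ⊔ 0#) - (- x ⊔ 0#)  ≈⟨ +-cong (x≤y⇒y⊔x≈y 0≤x) (-‿cong (x≤y⇒x⊔y≈y -x≤0)) ⟩
      x - 0#                 ≈⟨ trans (+-congˡ -0#≈0#) (+-identityʳ x) ⟩
      x                      ∎
      where -x≤0 = ≤-by 0≤x (solve 1 (λ x → x := con 0ℤ :- :- x) refl x)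
    cases (inj₂ x≤0) = begin
      (x ⊔ 0#) - (- x ⊔ 0#)  ≈⟨ +-cong (x≤y⇒x⊔y≈y x≤0) (-‿cong (x≤y⇒y⊔x≈y (neg-nonneg x≤0))) ⟩
      0# - - x               ≈⟨ solve 1 (λ x → con 0ℤ :- :- x := x) refl x ⟩
      x                      ∎

  module Integral (ν : ProbabilityMeasure) (ν-atomic : Atomic ν)
    (f : ℝ → ℝ) (f-cong : ∀ {x y} → x ≈ y → f x ≈ f y) where

    open Atomic ν-atomic

    private
      module Positive = NonnegIntegral ν ν-atomic (λ x → f x ⊔ 0#)
        (λ x≈y → ⊔-cong (f-cong x≈y) refl) (λ x → ⊔0-nonneg (f x))
      module Negative = NonnegIntegral ν ν-atomic (λ x → - f x ⊔ 0#)
        (λ x≈y → ⊔-cong (-‿cong (f-cong x≈y)) refl) (λ x → ⊔0-nonneg (- f x))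

    hasSum-parts : ∀ {p q} → Positive.term sumsTo p → Negative.term sumsTo q →
                   (λ k → mass k * f (atom k)) sumsTo p - q
    hasSum-parts hp hq = hasSum-cong
      (λ k → trans (solve 3 (λ m u v → m :* u :- m :* v := m :* (u :- v)) refl (mass k) (f (atom k) ⊔ 0#) (- f (atom k) ⊔ 0#))
                   (*-congˡ (⊔0-split (f (atom k)))))
      refl (hasSum-- hp hq)

    integral⇒hasSum : ∀ {I} → HasIntegral ν f I → (λ k → mass k * f (atom k)) sumsTo I
    integral⇒hasSum (_ , p , q , hp , hq , I≈) = hasSum-cong (λ _ → refl) (sym I≈)
      (hasSum-parts (Positive.integral⇒hasSum hp) (Negative.integral⇒hasSum hq))

    hasSum⇒integral : ∀ {p q} → Measurable f → Positive.term sumsTo p → Negative.term sumsTo q → HasIntegral ν f (p - q)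
    hasSum⇒integral f-measurable hp hq =
      f-measurable , _ , _ , Positive.hasSum⇒integral hp , Negative.hasSum⇒integral hq , refl

  ^-cong : ∀ k {x y} → x ≈ y → x ^ k ≈ y ^ k
  ^-cong zero    x≈y = refl
  ^-cong (suc k) x≈y = *-cong x≈y (^-cong k x≈y)

  Bounded : ℝ → ℝ → Set
  Bounded x b = x ≤ b × - x ≤ b

  bounded-exists : ∀ x → ∃[ b ] 0# ≤ b × Bounded x b
  bounded-exists x with ≤-total 0# x
  ... | inj₁ 0≤x = x , 0≤x , ≤-refl , ≤-by (+-nonneg 0≤x 0≤x) (solve 1 (λ x → x :+ x := x :- :- x) refl x)
  ... | inj₂ x≤0 = - x , neg-nonneg x≤0 , ≤-by (+-nonneg (neg-nonneg x≤0) (neg-nonneg x≤0)) refl , ≤-refl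

  bounded-+ : ∀ {x y b c} → Bounded x b → Bounded y c → Bounded (x + y) (b + c)
  bounded-+ {x} {y} (x≤b , -x≤b) (y≤c , -y≤c) =
    +-mono-≤ x≤b y≤c , ≤-respˡ (solve 2 (λ x y → :- x :+ :- y := :- (x :+ y)) refl x y) (+-mono-≤ -x≤b -y≤c)

  double-nonneg : ∀ {x} → 0# ≤ x + x → 0# ≤ x
  double-nonneg {x} 0≤2x with ≤-total 0# x
  ... | inj₁ 0≤x = 0≤x
  ... | inj₂ x≤0 = ≤-trans 0≤2x (≤-respʳ (+-identityʳ x) (+-monoʳ-≤ x x≤0))

  -- The bounds make b ± x and c ± y nonnegative, and both 2(bc - xy) and 2(bc + xy) are sums of two
  -- products of these numbers.
  bounded-* : ∀ {x y b c} → Bounded x b → Bounded y c → Bounded (x * y) (b * c)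
  bounded-* {x} {y} {b} {c} (x≤b , -x≤b) (y≤c , -y≤c) =
    ≤-by (double-nonneg (≤-respʳ
      (solve 4 (λ x y b c → (b :- x) :* (c :- :- y) :+ (b :- :- x) :* (c :- y) := (b :* c :- x :* y) :+ (b :* c :- x :* y)) refl x y b c)
      (+-nonneg (*-nonneg (difference-nonneg x≤b) (difference-nonneg -y≤c)) (*-nonneg (difference-nonneg -x≤b) (difference-nonneg y≤c))))) refl ,
    ≤-by (double-nonneg (≤-respʳ
      (solve 4 (λ x y b c → (b :- x) :* (c :- y) :+ (b :- :- x) :* (c :- :- y) := (b :* c :- :- (x :* y)) :+ (b :* c :- :- (x :* y))) refl x y b c)
      (+-nonneg (*-nonneg (difference-nonneg x≤b) (difference-nonneg y≤c)) (*-nonneg (difference-nonneg -x≤b) (difference-nonneg -y≤c))))) refl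

  opaque

    -- With u = x^k and v = y^k one has yv - xu = (y - x)(v - u) + (y - x)u + x(v - u). The three
    -- terms are at most d·Ld, dP and X·Ld, and d ≤ 1 reduces the first to Ld, whence the constant L
    -- + P + XL.
    ^-locally-lipschitz : ∀ k x → ∃[ L ] 0# ≤ L ×
      (∀ {y d} → 0# ≤ d → d ≤ 1# → Bounded (y - x) d → Bounded (y ^ k - x ^ k) (L * d))
    ^-locally-lipschitz zero    x = 0# , ≤-refl , λ {y} {d} _ _ _ →
      ≤-reflexive (trans (-‿inverseʳ 1#) (sym (zeroˡ d))) ,
      ≤-reflexive (trans (-‿cong (-‿inverseʳ 1#)) (trans -0#≈0# (sym (zeroˡ d))))
    ^-locally-lipschitz (suc k) x with ^-locally-lipschitz k x | bounded-exists x | bounded-exists (x ^ k)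
    ... | L , 0≤L , lipschitz | X , 0≤X , x-bounded | P , 0≤P , xᵏ-bounded =
      L + P + X * L , +-nonneg (+-nonneg 0≤L 0≤P) (*-nonneg 0≤X 0≤L) , λ {y} {d} 0≤d d≤1 near →
        let lo , hi = bounded-+ (bounded-+ (bounded-* near (lipschitz 0≤d d≤1 near)) (bounded-* near xᵏ-bounded))
                                (bounded-* x-bounded (lipschitz 0≤d d≤1 near))
            split = solve 4 (λ x y u v → (y :- x) :* (v :- u) :+ (y :- x) :* u :+ x :* (v :- u) := y :* v :- x :* u) refl x y (x ^ k) (y ^ k)
            weaken = ≤-by (*-nonneg (*-nonneg 0≤d 0≤L) (difference-nonneg d≤1))
              (solve 4 (λ L P X d → (d :* L) :* (con 1ℤ :- d) := (L :+ P :+ X :* L) :* d :- (d :* (L :* d) :+ d :* P :+ X :* (L :* d))) refl L P X d)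
        in ≤-respˡ split (≤-trans lo weaken) , ≤-respˡ (-‿cong split) (≤-trans hi weaken)

  -- Preimages commute with complements and unions, so only the open sets require continuity.
  ^-measurable : ∀ k → Measurable (λ x → x ^ k)
  ^-measurable k (complement borel)          = complement (^-measurable k borel)
  ^-measurable k (union borel)               = union λ j → ^-measurable k (borel j)
  ^-measurable k (resp (B⊆C , C⊆B) borel)    = resp (B⊆C , C⊆B) (^-measurable k borel)
  ^-measurable k (isOpen {G} G-open)         = isOpen preimage
    where
    preimage : IsOpen (λ x → G (x ^ k))
    preimage {x} xᵏ∈G with G-open xᵏ∈G | ^-locally-lipschitz k x
    ... | ε , 0<ε , ball | L , 0≤L , lipschitz with inverse-pos (+-pos-nonneg 0<ε (+-nonneg 0≤L (proj₁ 0<1)))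
    ...   | z , 0<z , cz≈1 = d , 0<d , λ {y} lo hi →
      let below , above = lipschitz (proj₁ 0<d) d≤1
            ( ≤-by (difference-nonneg (proj₁ hi)) (solve 3 (λ x y d → (x :+ d) :- y := d :- (y :- x)) refl x y d)
            , ≤-by (difference-nonneg (proj₁ lo)) (solve 3 (λ x y d → y :- (x :- d) := d :- :- (y :- x)) refl x y d) )
      in ball
        (<-by (+-pos-nonneg 0<ε-Ld (difference-nonneg above)) (solve 4 (λ ε e u v → (ε :- e) :+ (e :- :- (v :- u)) := v :- (u :- ε)) refl ε (L * d) (x ^ k) (y ^ k)))
        (<-by (+-pos-nonneg 0<ε-Ld (difference-nonneg below)) (solve 4 (λ ε e u v → (ε :- e) :+ (e :- (v :- u)) := (u :+ ε) :- v) refl ε (L * d) (x ^ k) (y ^ k)))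
      where
      -- This is ε/(ε + L + 1): it is at most 1, as the Lipschitz estimate demands, and Ld is
      -- strictly below ε.
      d = ε * z
      0<d : 0# < d
      0<d = *-pos 0<ε 0<z
      d≤1 : d ≤ 1#
      d≤1 = ≤-by (*-nonneg (+-nonneg 0≤L (proj₁ 0<1)) (proj₁ 0<z))
        (trans (solve 3 (λ ε L z → (L :+ con 1ℤ) :* z := (ε :+ (L :+ con 1ℤ)) :* z :- ε :* z) refl ε L z) (+-congʳ cz≈1))
      0<ε-Ld : 0# < ε - L * d
      0<ε-Ld = <-resp refl (begin
        ε * ((ε + 1#) * z)                      ≈⟨ solve 3 (λ ε L z → ε :* ((ε :+ con 1ℤ) :* z) := ε :* ((ε :+ (L :+ con 1ℤ)) :* z) :- L :* (ε :* z)) refl ε L z ⟩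
        ε * ((ε + (L + 1#)) * z) - L * (ε * z)  ≈⟨ +-congʳ (trans (*-congˡ cz≈1) (*-identityʳ ε)) ⟩
        ε - L * d                               ∎) (*-pos 0<ε (*-pos (+-pos 0<ε 0<1) 0<z))

-- Moments determine a discrete measure

module MomentProblem (em : ExcludedMiddle (lsuc 0ℓ)) (F : CompleteOrderedField) where

  open Analysis em F hiding (zero)
  open Reals em F
  open Series em F
  open Measures em F
  open Integrals em F
  open Determinant commutativeRing using (sum-zero; sum-linear)
  open Relation.Binary.Reasoning.Setoid setoid

  module _ (atom mass : ℕ → ℝ) (0≤mass : ∀ k → 0# ≤ mass k) {n} (ω λs : Vector ℝ n)
    (moments : ∀ j → (λ k → mass k * atom k ^ j) sumsTo sum λ i → ω i * λs i ^ j) where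

    -- The functions built here are polynomials in Newton form; carrying the factor xʲ along makes the class
    -- closed under multiplication by x - a.
    record Transfers (f : ℝ → ℝ) : Set where
      field
        f-cong   : ∀ {x y} → x ≈ y → f x ≈ f y
        transfer : ∀ j → (λ k → mass k * (atom k ^ j * f (atom k))) sumsTo sum λ i → ω i * (λs i ^ j * f (λs i))
    open Transfers

    transfers-0 : Transfers (const 0#)
    transfers-0 = record
      { f-cong   = λ _ → refl
      ; transfer = λ j → hasSum-cong (λ k → sym (trans (*-congˡ (zeroʳ _)) (zeroʳ _)))
          (sym (sum-zero {n} λ i → trans (*-congˡ (zeroʳ _)) (zeroʳ _))) hasSum-0
      }

    transfers-newton : ∀ {f} a b → Transfers f → Transfers (λ x → (x - a) * f x + b)
    transfers-newton {f} a b f-transfers = record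
      { f-cong   = λ x≈y → +-congʳ (*-cong (+-congʳ x≈y) (f-cong f-transfers x≈y))
      ; transfer = λ j → hasSum-cong
          (λ k → expand (mass k) (atom k) (atom k ^ j) (f (atom k)))
          (begin
            b * sum (λ i → ω i * λs i ^ j) + (- a * sum (λ i → ω i * (λs i ^ j * f (λs i))) + sum (λ i → ω i * (λs i ^ suc j * f (λs i))))
              ≈⟨ +-congˡ (sum-linear {n} (- a) (λ i → ω i * (λs i ^ j * f (λs i))) (λ i → ω i * (λs i ^ suc j * f (λs i)))) ⟨
            b * sum (λ i → ω i * λs i ^ j) + sum (λ i → - a * (ω i * (λs i ^ j * f (λs i))) + ω i * (λs i ^ suc j * f (λs i)))
              ≈⟨ sum-linear {n} b (λ i → ω i * λs i ^ j) (λ i → - a * (ω i * (λs i ^ j * f (λs i))) + ω i * (λs i ^ suc j * f (λs i))) ⟨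
            sum (λ i → b * (ω i * λs i ^ j) + (- a * (ω i * (λs i ^ j * f (λs i))) + ω i * (λs i ^ suc j * f (λs i))))
              ≈⟨ sum-cong-≋ {n} (λ i → expand (ω i) (λs i) (λs i ^ j) (f (λs i))) ⟩
            sum (λ i → ω i * (λs i ^ j * ((λs i - a) * f (λs i) + b))) ∎)
          (hasSum-+ (hasSum-* b (moments j)) (hasSum-+ (hasSum-* (- a) (transfer f-transfers j)) (transfer f-transfers (suc j))))
      }
      where
      expand : ∀ m x p y → b * (m * p) + (- a * (m * (p * y)) + m * (x * p * y)) ≈ m * (p * ((x - a) * y + b))
      expand m x p y = solve 6 (λ a b m x p y → b :* (m :* p) :+ (:- a :* (m :* (p :* y)) :+ m :* (x :* p :* y)) := m :* (p :* ((x :- a) :* y :+ b))) refl a b m x p y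

    opaque

      -- Newton interpolation: f(y) = (y - x₀) g(y) + v₀, where g interpolates the divided
      -- differences (vᵢ - v₀)/(xᵢ - x₀) at the remaining nodes.
      interpolate : ∀ {m} (x : Vector ℝ m) → PairwiseDistinct x → (v : Vector ℝ m) →
                    ∃[ f ] Transfers f × (∀ i → f (x i) ≈ v i)
      interpolate {zero}  x distinct v = const 0# , transfers-0 , λ ()
      interpolate {suc m} x distinct v =
        let g , g-transfers , g-values = tail-interpolant
        in _ , transfers-newton (x zero) (v zero) g-transfers , values {g} g-values
        where
        d : Fin m → ℝ
        d i = x (suc i) - x zero
        reciprocal : ∀ i → ∃[ y ] d i * y ≈ 1#
        reciprocal i = inverse λ eq → distinct {suc i} {zero} (λ ()) (x∙y⁻¹≈ε⇒x≈y (x (suc i)) (x zero) eq)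
        quotient : Fin m → ℝ
        quotient i = (v (suc i) - v zero) * proj₁ (reciprocal i)
        tail-interpolant : ∃[ g ] Transfers g × (∀ i → g (x (suc i)) ≈ quotient i)
        tail-interpolant = interpolate (tail x) (λ i≢j → distinct (i≢j ∘ suc-injective)) quotient
        values : ∀ {g : ℝ → ℝ} → (∀ i → g (x (suc i)) ≈ quotient i) → ∀ i → (x i - x zero) * g (x i) + v zero ≈ v i
        values         g-values zero    = trans (+-congʳ (trans (*-congʳ (-‿inverseʳ _)) (zeroˡ _))) (+-identityˡ _)
        values {g = g} g-values (suc i) = begin
          d i * g (x (suc i)) + v zero
            ≈⟨ +-congʳ (*-congˡ (g-values i)) ⟩
          d i * ((v (suc i) - v zero) * y) + v zero
            ≈⟨ solve 4 (λ d u w y → d :* ((u :- w) :* y) :+ w := (u :- w) :* (d :* y) :+ w) refl (d i) (v (suc i)) (v zero) y ⟩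
          (v (suc i) - v zero) * (d i * y) + v zero
            ≈⟨ +-congʳ (trans (*-congˡ (proj₂ (reciprocal i))) (*-identityʳ _)) ⟩
          v (suc i) - v zero + v zero
            ≈⟨ solve 2 (λ u w → u :- w :+ w := u) refl (v (suc i)) (v zero) ⟩
          v (suc i) ∎
          where
          y : ℝ
          y = proj₁ (reciprocal i)

    opaque

      -- Each node contributes two Newton steps with constant term 0, that is, a squared factor. The
      -- squares give nonnegativity, without which a vanishing integral would say nothing about
      -- single atoms.
      vanishing : ∀ {m} (x : Vector ℝ m) → ∃[ f ] Transfers f × (∀ y → 0# ≤ f y) ×
                  (∀ i → f (x i) ≈ 0#) × (∀ y → f y ≈ 0# → ∃[ i ] y ≈ x i)
      -- The empty product 1, presented as a Newton step from the zero function.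
      vanishing {zero} x = _ , transfers-newton 0# 1# transfers-0 ,
        (λ y → ≤-respʳ (sym (value y)) (proj₁ 0<1)) , (λ ()) , λ y eq → contradiction (trans (sym eq) (value y)) 0≉1
        where
        value : ∀ y → (y - 0#) * 0# + 1# ≈ 1#
        value y = trans (+-congʳ (zeroʳ _)) (+-identityˡ 1#)
      vanishing {suc m} x with vanishing (tail x)
      ... | g , g-transfers , 0≤g , g-zero , g-root =
        _ , transfers-newton (x zero) 0# (transfers-newton (x zero) 0# g-transfers) ,
        (λ y → ≤-respʳ (square y) (*-nonneg (square-nonneg (y - x zero)) (0≤g y))) ,
        (λ { zero    → trans (sym (square (x zero))) (trans (*-congʳ (trans (*-congʳ (-‿inverseʳ _)) (zeroˡ _))) (zeroˡ _))
           ; (suc i) → trans (sym (square (x (suc i)))) (trans (*-congˡ (g-zero i)) (zeroʳ _)) }) ,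
        root
        where
        square : ∀ y → (y - x zero) * (y - x zero) * g y ≈ (y - x zero) * ((y - x zero) * g y + 0#) + 0#
        square y = solve 2 (λ d g → d :* d :* g := d :* (d :* g :+ con 0ℤ) :+ con 0ℤ) refl (y - x zero) (g y)
        root : ∀ y → (y - x zero) * ((y - x zero) * g y + 0#) + 0# ≈ 0# → ∃[ i ] y ≈ x i
        root y eq with decide (y ≈ x zero)
        ... | yes y≈x₀ = zero , y≈x₀
        ... | no  y≉x₀ = let i , y≈xᵢ = g-root y (*-cancel-0 d≉0 (*-cancel-0 d≉0 (trans (sym (*-assoc _ _ _)) (trans (square y) eq)))) in suc i , y≈xᵢ
          where
          d≉0 : y - x zero ≉ 0#
          d≉0 d≈0 = y≉x₀ (x∙y⁻¹≈ε⇒x≈y y (x zero) d≈0)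

    -- The terms mass · r(atom) are nonnegative with sum 0, so each vanishes, and an atom of nonzero
    -- mass is a root of r, that is, one of the nodes. There q takes the value of the indicator of
    -- B, and the transfer of q with exponent 0 compares the two sums.
    moments-determine : PairwiseDistinct λs → ∀ {B s} → Borel B →
                        (λ k → mass k * δ (atom k) B) sumsTo s → s ≈ diracSum ω λs B
    moments-determine distinct {B} {s} B-borel h
      with vanishing λs | interpolate λs distinct (λ i → δ (λs i) B)
    ... | r , r-transfers , 0≤r , r-zero , r-root | q , q-transfers , q-values =
      hasSum-unique h (hasSum-cong (λ k → trans (*-congˡ (*-identityˡ _)) (agree k))
        (sum-cong-≋ {n} λ i → *-congˡ (trans (*-identityˡ _) (q-values i))) (transfer q-transfers 0))
      where
      hasSum-r : (λ k → mass k * r (atom k)) sumsTo 0#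
      hasSum-r = hasSum-cong (λ k → *-congˡ (*-identityˡ _))
        (sum-zero {n} λ i → trans (*-congˡ (trans (*-identityˡ _) (r-zero i))) (zeroʳ _)) (transfer r-transfers 0)
      r-null : ∀ k → mass k * r (atom k) ≈ 0#
      r-null k = ≤-antisym (hasSum-term≤ nonneg-terms hasSum-r k) (nonneg-terms k)
        where
        nonneg-terms : ∀ k → 0# ≤ mass k * r (atom k)
        nonneg-terms k = *-nonneg (0≤mass k) (0≤r (atom k))
      agree : ∀ k → mass k * q (atom k) ≈ mass k * δ (atom k) B
      agree k with decide (mass k ≈ 0#)
      -- An atom without mass may lie off the nodes, where q is not the indicator.
      ... | yes m≈0 = trans (trans (*-congʳ m≈0) (zeroˡ _)) (sym (trans (*-congʳ m≈0) (zeroˡ _)))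
      ... | no  m≉0 = *-congˡ (at-node (r-root (atom k) (*-cancel-0 m≉0 (r-null k))))
        where
        at-node : ∃[ i ] atom k ≈ λs i → q (atom k) ≈ δ (atom k) B
        at-node (i , c≈λ) = begin
          q (atom k)       ≈⟨ f-cong q-transfers c≈λ ⟩
          q (λs i)         ≈⟨ q-values i ⟩
          δ (λs i) B       ≈⟨ δ-⇔ {λs i} {atom k} {B} {B} (borel-resp-≈ B-borel (sym c≈λ)) (borel-resp-≈ B-borel c≈λ) ⟩
          δ (atom k) B     ∎

  diracMeasure-discrete : ∀ {n} (ω λs : Vector ℝ n) (ω-weights : IsWeights ω) → IsDiscrete (diracMeasure ω λs ω-weights)
  diracMeasure-discrete {n} ω λs ω-weights =
    C , union (λ k → borel-singleton (pad λs k)) , (pad λs , λ x∈C → x∈C) ,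
    sum-zero {n} λ i → trans (*-congˡ {ω i} (δ-∉ {λs i} {∁ C} λ λ∉C → λ∉C (toℕ i , sym (pad-toℕ λs i)))) (zeroʳ _)
    where
    C : Pred ℝ 0ℓ
    -- Besides the points λᵢ this contains 0, from the padding; as only the complement has to be
    -- null, the extra point is harmless.
    C = ⋃ ℕ λ k → _≈ pad λs k

  -- Stated for any measure that agrees with the Dirac sum on Borel sets, because in the converse
  -- direction the measure is given. Integrability comes from the finitely many nonzero terms of the
  -- positive and negative parts.
  power-integral : ∀ {n} (ω λs : Vector ℝ n) → IsWeights ω → ∀ ν → measure ν ≈ₘ diracSum ω λs → ∀ k →
                   ∃[ I ] HasIntegral ν (λ x → x ^ k) I × I ≈ sum λ i → ω i * λs i ^ k
  power-integral ω λs ω-weights ν ν≈ k =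
    _ , hasSum⇒integral (^-measurable k) hp hq , hasSum-unique (hasSum-parts hp hq) (hasSum-pad ω λs (_^ k))
    where
    open Integral ν (dirac⇒atomic ν ω-weights ν≈) (_^ k) (^-cong k)
    hp = hasSum-pad ω λs λ x → x ^ k ⊔ 0#
    hq = hasSum-pad ω λs λ x → - x ^ k ⊔ 0#

-- The field of complex numbers

module Complex (em : ExcludedMiddle (lsuc 0ℓ)) (F : CompleteOrderedField) where

  open Analysis em F hiding (zero)
  open Reals em F
  open RawRing rawRingℂ using () renaming (_+_ to _+ℂ_; -_ to -ℂ_; 0# to 0ℂ; 1# to 1ℂ)
  open Relation.Binary.Reasoning.Setoid setoid

  isCommutativeRingℂ : IsCommutativeRing _≈ℂ_ _+ℂ_ _*ℂ_ -ℂ_ 0ℂ 1ℂ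
  isCommutativeRingℂ = record
    { isRing = record
      { +-isAbelianGroup = record
        { isGroup = record
          { isMonoid = record
            { isSemigroup = record
              { isMagma = record
                { isEquivalence = record
                  { refl  = refl , refl
                  ; sym   = λ (p , q) → sym p , sym q
                  ; trans = λ (p , q) (p′ , q′) → trans p p′ , trans q q′
                  }
                ; ∙-cong = λ (p , q) (p′ , q′) → +-cong p p′ , +-cong q q′
                }
              ; assoc = λ _ _ _ → +-assoc _ _ _ , +-assoc _ _ _
              }
            ; identity = (λ _ → +-identityˡ _ , +-identityˡ _) , (λ _ → +-identityʳ _ , +-identityʳ _)
            }
          ; inverse = (λ _ → -‿inverseˡ _ , -‿inverseˡ _) , (λ _ → -‿inverseʳ _ , -‿inverseʳ _)
          ; ⁻¹-cong = λ (p , q) → -‿cong p , -‿cong q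
          }
        ; comm = λ _ _ → +-comm _ _ , +-comm _ _
        }
      ; *-cong = λ (p , q) (p′ , q′) →
          +-cong (*-cong p p′) (-‿cong (*-cong q q′)) , +-cong (*-cong p q′) (*-cong q p′)
      ; *-assoc = λ (a +i b) (c +i d) (e +i f) →
          solve 6 (λ a b c d e f → (a :* c :- b :* d) :* e :- (a :* d :+ b :* c) :* f := a :* (c :* e :- d :* f) :- b :* (c :* f :+ d :* e)) refl a b c d e f ,
          solve 6 (λ a b c d e f → (a :* c :- b :* d) :* f :+ (a :* d :+ b :* c) :* e := a :* (c :* f :+ d :* e) :+ b :* (c :* e :- d :* f)) refl a b c d e f
      ; *-identity =
          (λ (a +i b) →
            solve 2 (λ a b → con 1ℤ :* a :- con 0ℤ :* b := a) refl a b , solve 2 (λ a b → con 1ℤ :* b :+ con 0ℤ :* a := b) refl a b) ,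
          (λ (a +i b) →
            solve 2 (λ a b → a :* con 1ℤ :- b :* con 0ℤ := a) refl a b , solve 2 (λ a b → a :* con 0ℤ :+ b :* con 1ℤ := b) refl a b)
      ; distrib =
          (λ (a +i b) (c +i d) (e +i f) →
            solve 6 (λ a b c d e f → a :* (c :+ e) :- b :* (d :+ f) := (a :* c :- b :* d) :+ (a :* e :- b :* f)) refl a b c d e f ,
            solve 6 (λ a b c d e f → a :* (d :+ f) :+ b :* (c :+ e) := (a :* d :+ b :* c) :+ (a :* f :+ b :* e)) refl a b c d e f) ,
          (λ (a +i b) (c +i d) (e +i f) →
            solve 6 (λ a b c d e f → (c :+ e) :* a :- (d :+ f) :* b := (c :* a :- d :* b) :+ (e :* a :- f :* b)) refl a b c d e f ,
            solve 6 (λ a b c d e f → (c :+ e) :* b :+ (d :+ f) :* a := (c :* b :+ d :* a) :+ (e :* b :+ f :* a)) refl a b c d e f)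
      }
    ; *-comm = λ (a +i b) (c +i d) →
        solve 4 (λ a b c d → a :* c :- b :* d := c :* a :- d :* b) refl a b c d ,
        solve 4 (λ a b c d → a :* d :+ b :* c := c :* b :+ d :* a) refl a b c d
    }

  commutativeRingℂ : CommutativeRing 0ℓ 0ℓ
  commutativeRingℂ = record { isCommutativeRing = isCommutativeRingℂ }

  ∣_∣² : ℂ → ℝ
  ∣ z ∣² = re z * re z + im z * im z

  ∣∣²-nonneg : ∀ z → 0# ≤ ∣ z ∣²
  ∣∣²-nonneg (x +i y) = +-nonneg (square-nonneg x) (square-nonneg y)

  ∣∣²-definite : ∀ {z} → ∣ z ∣² ≈ 0# → z ≈ℂ 0ℂ
  ∣∣²-definite {x +i y} eq = root x y eq , root y x (trans (+-comm _ _) eq)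
    where
    root : ∀ x y → x * x + y * y ≈ 0# → x ≈ 0#
    root x y eq with decide (x ≈ 0#)
    ... | yes x≈0 = x≈0
    ... | no  x≉0 = contradiction (*-cancel-0 x≉0 (≤-antisym
      (≤-by (square-nonneg y) (begin
        y * y                        ≈⟨ solve 2 (λ x y → y :* y := (x :* x :+ y :* y) :- x :* x) refl x y ⟩
        (x * x + y * y) - x * x      ≈⟨ +-congʳ eq ⟩
        0# - x * x                   ∎))
      (square-nonneg x))) x≉0

  conj-*-self : ∀ z → conj z *ℂ z ≈ℂ fromℝ ∣ z ∣²
  conj-*-self (x +i y) =
    solve 2 (λ x y → x :* x :- (:- y) :* y := x :* x :+ y :* y) refl x y ,
    solve 2 (λ x y → x :* y :+ (:- y) :* x := con 0ℤ) refl x y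

  isDiscreteFieldℂ : IsDiscreteField commutativeRingℂ
  isDiscreteFieldℂ = record
    { 0≉1     = λ (eq , _) → 0≉1 eq
    ; _≟0     = λ z → decide (z ≈ℂ 0ℂ)
    ; inverse = λ {z} z≉0 → let w , ∣z∣²w≈1 = inverse (z≉0 ∘ ∣∣²-definite {z}) in inverse-of z w ∣z∣²w≈1
    }
    where
    inverse-of : ∀ z w → ∣ z ∣² * w ≈ 1# → ∃[ u ] z *ℂ u ≈ℂ 1ℂ
    -- The inverse is the conjugate of z divided by its squared modulus.
    inverse-of (x +i y) w eq = (x * w) +i (- y * w) ,
      trans (solve 3 (λ x y w → x :* (x :* w) :- y :* (:- y :* w) := (x :* x :+ y :* y) :* w) refl x y w) eq ,
      solve 3 (λ x y w → x :* (:- y :* w) :+ y :* (x :* w) := con 0ℤ) refl x y w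

  conj-cong : ∀ {z w} → z ≈ℂ w → conj z ≈ℂ conj w
  conj-cong (p , q) = p , -‿cong q

  conj-involutive : ∀ z → conj (conj z) ≈ℂ z
  conj-involutive z = refl , -‿involutive (im z)

  conj-+ : ∀ z w → conj (z +ℂ w) ≈ℂ conj z +ℂ conj w
  conj-+ (a +i b) (c +i d) = refl , solve 2 (λ b d → :- (b :+ d) := :- b :+ :- d) refl b d

  conj-* : ∀ z w → conj (z *ℂ w) ≈ℂ conj z *ℂ conj w
  conj-* (a +i b) (c +i d) =
    solve 4 (λ a b c d → a :* c :- b :* d := a :* c :- (:- b) :* (:- d)) refl a b c d ,
    solve 4 (λ a b c d → :- (a :* d :+ b :* c) := a :* (:- d) :+ (:- b) :* c) refl a b c d

  conj-fromℝ : ∀ x → conj (fromℝ x) ≈ℂ fromℝ x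
  conj-fromℝ x = refl , -0#≈0#

  fromℝ-cong : ∀ {x y} → x ≈ y → fromℝ x ≈ℂ fromℝ y
  fromℝ-cong x≈y = x≈y , refl

  fromℝ-injective : ∀ {x y} → fromℝ x ≈ℂ fromℝ y → x ≈ y
  fromℝ-injective = proj₁

  fromℝ-* : ∀ x y → fromℝ (x * y) ≈ℂ fromℝ x *ℂ fromℝ y
  fromℝ-* x y =
    solve 2 (λ x y → x :* y := x :* y :- con 0ℤ :* con 0ℤ) refl x y ,
    solve 2 (λ x y → con 0ℤ := x :* con 0ℤ :+ con 0ℤ :* y) refl x y

  fromℝ-sum : ∀ {n} (f : Vector ℝ n) → fromℝ (sum f) ≈ℂ sumℂ (fromℝ ∘ f)
  fromℝ-sum {zero}  f = refl , refl
  fromℝ-sum {suc n} f = let p , q = fromℝ-sum (f ∘ suc) in +-congˡ p , trans (sym (+-identityˡ 0#)) (+-congˡ q)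

-- Spectral measures of Hermitian matrices

module SpectralTheorem (em : ExcludedMiddle (lsuc 0ℓ)) (F : CompleteOrderedField) where

  open Analysis em F hiding (zero)
  open Reals em F
  open Series em F
  open Measures em F
  open Integrals em F
  open Complex em F
  open MomentProblem em F
  module ℂ-ring = CommutativeRing commutativeRingℂ
  module ℂ-sum = Algebra.Properties.Semiring.Sum ℂ-ring.semiring
  open Algebra.Definitions.RawSemiring (RawRing.rawSemiring rawRingℂ) using () renaming (_^_ to _^ℂ_)

  norm² : ∀ {n} → Vector ℂ n → ℝ
  norm² v = sum λ i → ∣ v i ∣²

  ip-self : ∀ {n} (v : Vector ℂ n) → ⟨ v , v ⟩ ≈ℂ fromℝ (norm² v)
  ip-self {n} v = ℂ-ring.trans (ℂ-sum.sum-cong-≋ {n} λ i → conj-*-self (v i)) (ℂ-ring.sym (fromℝ-sum λ i → ∣ v i ∣²))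

  isStarFieldℂ : IsStarField commutativeRingℂ conj
  isStarFieldℂ = record
    { isDiscreteField = isDiscreteFieldℂ
    ; conj-cong       = λ {z} {w} → conj-cong {z} {w}
    ; conj-+          = conj-+
    ; conj-*          = conj-*
    ; conj-involutive = conj-involutive
    ; definite        = λ v ⟨v,v⟩≈0 i → ∣∣²-definite {v i} (≤-antisym
        (≤-trans (term≤sum (λ i → ∣ v i ∣²) (λ i → ∣∣²-nonneg (v i)) i)
                 (≤-reflexive (trans (sym (proj₁ (ip-self v))) (proj₁ ⟨v,v⟩≈0))))
        (∣∣²-nonneg (v i)))
    }

  open InnerProduct commutativeRingℂ conj isStarFieldℂ
    using (EigenDecomposition; Orthonormal; moment; eigenDecomposition; ip-cong; sum-scalar;
           basis-with-coordinates; spectralMatrix; spectral-hermitian; spectral-eigenvalues;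
           spectral-decomposition; spectral-weight)

  fromℝ-^ : ∀ x k → fromℝ (x ^ k) ≈ℂ fromℝ x ^ℂ k
  fromℝ-^ x zero    = ℂ-ring.refl
  fromℝ-^ x (suc k) = ℂ-ring.trans (fromℝ-* x (x ^ k)) (ℂ-ring.*-congˡ {fromℝ x} (fromℝ-^ x k))

  module _ {n} {A : Matrix n} {λs : Vector ℝ n} {ξ : Vector ℂ n}
    (decomposition : EigenDecomposition A (fromℝ ∘ λs) ξ) where

    open EigenDecomposition decomposition

    weight : Vector ℝ n
    weight i = norm² (component i)

    vectorState-moment : ∀ k → vectorState ξ (A ^ᴹ k) ≈ℂ fromℝ (sum λ i → weight i * λs i ^ k)
    vectorState-moment k = ℂ-ring.trans (moment decomposition k) (ℂ-ring.trans
      (ℂ-sum.sum-cong-≋ {n} λ i → ℂ-ring.trans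
        (ℂ-ring.*-cong (ℂ-ring.sym (fromℝ-^ (λs i) k)) (ip-self (component i)))
        (ℂ-ring.trans (ℂ-ring.*-comm (fromℝ (λs i ^ k)) (fromℝ (weight i))) (ℂ-ring.sym (fromℝ-* (weight i) (λs i ^ k)))))
      (ℂ-ring.sym (fromℝ-sum λ i → weight i * λs i ^ k)))

    -- The total weight is the zeroth moment, which is ⟨ξ,ξ⟩ because A⁰ is the identity.
    weight-isWeights : IsUnit ξ → IsWeights weight
    weight-isWeights ξ-unit =
      (λ i → sum-nonneg (λ j → ∣ component i j ∣²) λ j → ∣∣²-nonneg (component i j)) ,
      trans (sum-cong-≋ {n} λ i → sym (*-identityʳ (weight i)))
        (fromℝ-injective (ℂ-ring.trans (ℂ-ring.sym (vectorState-moment 0))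
          (ℂ-ring.trans (ip-cong {n} (λ _ → ℂ-ring.refl) (λ i → ℂ-ring.trans (sum-scalar {n} (fromℝ 1#) ξ i) (ℂ-ring.*-identityˡ (ξ i)))) ξ-unit)))

    -- The weights ω are kept apart from the norms of the components: in the converse direction they
    -- are prescribed, and the norms only turn out equal to them.
    momentsAgree : ∀ {ω} → (∀ i → weight i ≈ ω i) → IsWeights ω → ∀ ν → measure ν ≈ₘ diracSum ω λs → MomentsAgree ξ A ν
    momentsAgree {ω} weight≈ω ω-weights ν ν≈ k =
      let I , integral , I≈ = power-integral ω λs ω-weights ν ν≈ k
      in I , integral , ℂ-ring.trans (vectorState-moment k)
           (fromℝ-cong (trans (sum-cong-≋ {n} λ i → *-congʳ (weight≈ω i)) (sym I≈)))

    -- Agreement of moments for ν is converted into convergent series over its atoms, with the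
    -- spectral weights on the other side, which is the hypothesis of `moments-determine`.
    moments-unique : PairwiseDistinct λs → ∀ ν → IsDiscrete ν → MomentsAgree ξ A ν → measure ν ≈ₘ diracSum weight λs
    moments-unique distinct ν ν-discrete agree B-borel =
      moments-determine atom mass mass-nonneg weight λs moments distinct B-borel (represents B-borel)
      where
      ν-atomic = discrete⇒atomic ν ν-discrete
      open Atomic ν-atomic
      moments : ∀ j → (λ k → mass k * atom k ^ j) sumsTo sum λ i → weight i * λs i ^ j
      moments j = let I , integral , state≈I = agree j in
        hasSum-cong (λ _ → refl) (fromℝ-injective (ℂ-ring.trans (ℂ-ring.sym state≈I) (vectorState-moment j)))
          (Integral.integral⇒hasSum ν ν-atomic (_^ j) (^-cong j) integral)

  spectralMeasure : ∀ {n} (ξ : Vector ℂ n) → IsUnit ξ → (A : Matrix n) (λs : Vector ℝ n) →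
    IsHermitian A → HasRealEigenvalues A λs → PairwiseDistinct λs →
    Σ[ μ ∈ ProbabilityMeasure ]
      (IsDiscrete μ × MomentsAgree ξ A μ)
      × ((ν : ProbabilityMeasure) → IsDiscrete ν → MomentsAgree ξ A ν → measure ν ≈ₘ measure μ)
      × (Σ[ ω ∈ Vector ℝ n ] IsWeights ω × measure μ ≈ₘ diracSum ω λs)
  spectralMeasure ξ ξ-unit A λs A-hermitian λs-eigenvalues distinct =
    μ , (diracMeasure-discrete ω λs ω-weights , momentsAgree decomposition (λ _ → refl) ω-weights μ (λ _ → refl)) ,
    moments-unique decomposition distinct , ω , ω-weights , λ _ → refl
    where
    decomposition : EigenDecomposition A (fromℝ ∘ λs) ξ
    decomposition = eigenDecomposition A-hermitian λs-eigenvalues (λ i → conj-fromℝ (λs i))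
      (λ i≢j λᵢ≈λⱼ → distinct i≢j (fromℝ-injective λᵢ≈λⱼ)) ξ
    ω = weight decomposition
    ω-weights = weight-isWeights decomposition ξ-unit
    μ = diracMeasure ω λs ω-weights

  matrixWithMoments : ∀ {n} (ξ : Vector ℂ n) → IsUnit ξ → (ω λs : Vector ℝ n) → IsWeights ω →
    (μ : ProbabilityMeasure) → measure μ ≈ₘ diracSum ω λs →
    Σ[ A ∈ Matrix n ] IsHermitian A × HasRealEigenvalues A λs × MomentsAgree ξ A μ
  matrixWithMoments {n} ξ ξ-unit ω λs ω-weights@(0≤ω , ∑ω≈1) μ μ≈ =
    spectralMatrix u-orthonormal z-real , spectral-hermitian u-orthonormal z-real ,
    spectral-eigenvalues u-orthonormal z-real , momentsAgree decomposition weight≈ω ω-weights μ μ≈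
    where
    z-real : ∀ i → conj (fromℝ (λs i)) ≈ℂ fromℝ (λs i)
    z-real i = conj-fromℝ (λs i)
    η : Vector ℂ n
    η i = fromℝ (proj₁ (sqrt (0≤ω i)))
    ∣η∣²≈ω : ∀ i → ∣ η i ∣² ≈ ω i
    ∣η∣²≈ω i = trans (+-cong (proj₂ (sqrt (0≤ω i))) (zeroˡ 0#)) (+-identityʳ (ω i))
    basis : ∃[ u ] Orthonormal u × (∀ j → ξ j ≈ℂ sumℂ λ i → η i *ℂ u i j)
    -- Both vectors have norm 1: η because the weights add up to 1, ξ by assumption.
    basis = basis-with-coordinates η ξ (ℂ-ring.trans (ip-self η)
      (ℂ-ring.trans (fromℝ-cong (trans (sum-cong-≋ {n} ∣η∣²≈ω) ∑ω≈1)) (ℂ-ring.sym {⟨ ξ , ξ ⟩} {fromℝ 1#} ξ-unit)))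
    u = proj₁ basis
    u-orthonormal : Orthonormal u
    u-orthonormal = proj₁ (proj₂ basis)
    decomposition : EigenDecomposition (spectralMatrix u-orthonormal z-real) (fromℝ ∘ λs) ξ
    decomposition = spectral-decomposition u-orthonormal z-real (proj₂ (proj₂ basis))
    weight≈ω : ∀ i → weight decomposition i ≈ ω i
    weight≈ω i = trans (fromℝ-injective (begin
      fromℝ (weight decomposition i)           ≈⟨ ip-self (λ j → η i *ℂ u i j) ⟨
      ⟨ (λ j → η i *ℂ u i j) , (λ j → η i *ℂ u i j) ⟩  ≈⟨ spectral-weight u-orthonormal z-real (η i) i ⟩
      conj (η i) *ℂ η i                        ≈⟨ conj-*-self (η i) ⟩
      fromℝ ∣ η i ∣²                           ∎)) (∣η∣²≈ω i)
      where open Relation.Binary.Reasoning.Setoid ℂ-ring.setoid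

theorem3p3 :
    (em : ExcludedMiddle (lsuc 0ℓ)) (F : CompleteOrderedField) →
    let open Analysis em F in
    (n : ℕ) → 1 ℕ.≤ n → (ξ : Vector ℂ n) → IsUnit ξ →
    ((A : Matrix n) (λs : Vector ℝ n) →
      IsHermitian A → HasRealEigenvalues A λs → PairwiseDistinct λs →
      Σ[ μ ∈ ProbabilityMeasure ]
        (IsDiscrete μ × MomentsAgree ξ A μ)
        × ((ν : ProbabilityMeasure) → IsDiscrete ν → MomentsAgree ξ A ν →
            measure ν ≈ₘ measure μ)
        × (Σ[ ω ∈ Vector ℝ n ] IsWeights ω × measure μ ≈ₘ diracSum ω λs))
    × ((ω λs : Vector ℝ n) → IsWeights ω →
      (μ : ProbabilityMeasure) → IsDiscrete μ → measure μ ≈ₘ diracSum ω λs →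
      Σ[ A ∈ Matrix n ]
        IsHermitian A × HasRealEigenvalues A λs × MomentsAgree ξ A μ)
theorem3p3 em F n _ ξ ξ-unit =
  spectralMeasure ξ ξ-unit ,
  λ ω λs ω-weights μ _ μ≈ → matrixWithMoments ξ ξ-unit ω λs ω-weights μ μ≈
  where open SpectralTheorem em F
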